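{- Let $M=\mathbb{Q}(i)$, so $\mathbb{Z}_M=\mathbb{Z}[i]$. Let $t$ be a positive integer with $t\le 100$ such that $t^2+4$ is square-free, let $\xi$ be a root of $f(x)=x^4-itx^2+1$ (which is irreducible over $M$), let $K=M(\xi)$ and let $\mathcal{O}=\mathbb{Z}_K$ be the ring of integers of $K$. Then, up to equivalence, the generators of relative power integral bases of $\mathcal{O}$ over $\mathbb{Z}[i]$ of the form $\alpha=x\xi+y\xi^2+z\xi^3$ with $x,y,z\in\mathbb{Z}[i]$ and $\max(|x|,|y|,|z|)\le 30$ are exactly \[ \alpha=\xi\quad\text{and}\quad\alpha=-it\xi+\xi^3 \] when $t\neq 1$; and when $t=1$ they are exactly these two together with \[ \alpha=3\xi+(1+i)\xi^2+2i\xi^3,\quad 3\xi-(1+i)\xi^2+2i\xi^3,\quad i\xi+(1+i)\xi^2+\xi^3,\quad i\xi-(1+i)\xi^2+\xi^3. \]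
   Context: An element $\alpha\in\mathcal{O}$ generates a relative power integral basis of $\mathcal{O}$ over $\mathbb{Z}[i]$ if $\mathcal{O}=\mathbb{Z}[i][\alpha]$, i.e. $1,\alpha,\alpha^2,\alpha^3$ is a $\mathbb{Z}[i]$-module basis of $\mathcal{O}$. Two elements of $\mathcal{O}$ are called equivalent if one is obtained from the other by multiplication by a unit and translation by an element of $\mathbb{Z}[i]$. Absolute values are complex absolute values.
   Formalization: The bound max(|x|,|y|,|z|) ≤ 30 is imposed only on the generators being classified; the listed elements are shown to be generators but not to lie within the bound, since −itξ+ξ³ exceeds it when t > 30 (e.g. t = 31). -}

module Defs where

open import Data.Nat as ℕ using (ℕ)
open import Data.Nat.Divisibility using (_∣_)
open import Data.Integer as ℤ using (ℤ; +_)
open import Data.Rational as ℚ using (ℚ; 0ℚ; 1ℚ)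
open import Data.List using (List; []; _∷_)
open import Data.Product using (_×_; _,_; Σ; ∃)
open import Data.Sum using (_⊎_)
open import Relation.Binary.PropositionalEquality using (_≡_)

SquareFree : ℕ → Set
SquareFree n = ∀ (d : ℕ) → (d ℕ.* d) ∣ n → d ≡ 1

GZ : Set
GZ = ℤ × ℤ

infixl 6 _+ᶻ_
infixl 7 _*ᶻ_

_+ᶻ_ : GZ → GZ → GZ
(a , b) +ᶻ (c , d) = (a ℤ.+ c , b ℤ.+ d)

_*ᶻ_ : GZ → GZ → GZ
(a , b) *ᶻ (c , d) = (a ℤ.* c ℤ.- b ℤ.* d , a ℤ.* d ℤ.+ b ℤ.* c)

-ᶻ_ : GZ → GZ
-ᶻ (a , b) = (ℤ.- a , ℤ.- b)

0ᶻ 1ᶻ iᶻ : GZ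
0ᶻ = (+ 0 , + 0)
1ᶻ = (+ 1 , + 0)
iᶻ = (+ 0 , + 1)

normᶻ : GZ → ℤ
normᶻ (a , b) = a ℤ.* a ℤ.+ b ℤ.* b

AbsLe30 : GZ → Set
AbsLe30 x = normᶻ x ℤ.≤ + 900

IsUnitᶻ : GZ → Set
IsUnitᶻ u = Σ GZ λ v → u *ᶻ v ≡ 1ᶻ

GQ : Set
GQ = ℚ × ℚ

_+q_ : GQ → GQ → GQ
(a , b) +q (c , d) = (a ℚ.+ c , b ℚ.+ d)

_-q_ : GQ → GQ → GQ
(a , b) -q (c , d) = (a ℚ.- c , b ℚ.- d)

_*q_ : GQ → GQ → GQ
(a , b) *q (c , d) = (a ℚ.* c ℚ.- b ℚ.* d , a ℚ.* d ℚ.+ b ℚ.* c)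

infixl 6 _+q_ _-q_
infixl 7 _*q_

0q 1q : GQ
0q = (0ℚ , 0ℚ)
1q = (1ℚ , 0ℚ)

ℤ→ℚ : ℤ → ℚ
ℤ→ℚ n = n ℚ./ 1

GZ→GQ : GZ → GQ
GZ→GQ (a , b) = (ℤ→ℚ a , ℤ→ℚ b)

-- K = M(ξ) = M[x]/(f),  f(x) = x^4 - i t x^2 + 1,
-- an element is  a₀ + a₁ ξ + a₂ ξ² + a₃ ξ³  with aⱼ ∈ M.

record K : Set where
  constructor mkK
  field
    c0 c1 c2 c3 : GQ

open K public

itq : ℕ → GQ
itq t = (0ℚ , ℤ→ℚ (+ t))

addK : K → K → K
addK (mkK a0 a1 a2 a3) (mkK b0 b1 b2 b3) =
  mkK (a0 +q b0) (a1 +q b1) (a2 +q b2) (a3 +q b3)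

-- multiplication in M[x]/(x^4 - c x^2 + 1), c = i t, using
-- ξ^4 = c ξ^2 - 1,  ξ^5 = c ξ^3 - ξ,  ξ^6 = (c^2 - 1) ξ^2 - c.
mulK : ℕ → K → K → K
mulK t (mkK a0 a1 a2 a3) (mkK b0 b1 b2 b3) =
  mkK (p0 -q p4 -q c *q p6)
      (p1 -q p5)
      (p2 +q c *q p4 +q (c *q c -q 1q) *q p6)
      (p3 +q c *q p5)
  where
    c  = itq t
    p0 = a0 *q b0
    p1 = a0 *q b1 +q a1 *q b0
    p2 = a0 *q b2 +q a1 *q b1 +q a2 *q b0
    p3 = a0 *q b3 +q a1 *q b2 +q a2 *q b1 +q a3 *q b0
    p4 = a1 *q b3 +q a2 *q b2 +q a3 *q b1
    p5 = a2 *q b3 +q a3 *q b2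
    p6 = a3 *q b3

scalarK : GQ → K
scalarK a = mkK a 0q 0q 0q

0K 1K : K
0K = scalarK 0q
1K = scalarK 1q

ιZ : ℤ → K
ιZ n = scalarK (ℤ→ℚ n , 0ℚ)

ιGZ : GZ → K
ιGZ x = scalarK (GZ→GQ x)

ξK : K
ξK = mkK 0q 1q 0q 0q

elemXYZ : GZ → GZ → GZ → K
elemXYZ x y z = mkK 0q (GZ→GQ x) (GZ→GQ y) (GZ→GQ z)

-- Ring of integers 𝒪 = ℤ_K : elements of K integral over ℤ.
-- A list [a_{n-1}, …, a₀] of integers encodes the monic polynomial
-- x^n + a_{n-1} x^{n-1} + … + a₀ ; evaluate by Horner's scheme.

hornerMonic : ℕ → K → K → List ℤ → K
hornerMonic t β acc []       = acc
hornerMonic t β acc (a ∷ as) = hornerMonic t β (addK (mulK t acc β) (ιZ a)) as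

InO : ℕ → K → Set
InO t β = Σ (List ℤ) λ as → hornerMonic t β 1K as ≡ 0K

linComb : ℕ → K → GZ → GZ → GZ → GZ → K
linComb t α a0 a1 a2 a3 =
  addK (ιGZ a0)
   (addK (mulK t (ιGZ a1) α)
    (addK (mulK t (ιGZ a2) α2) (mulK t (ιGZ a3) (mulK t α2 α))))
  where α2 = mulK t α α

IsPowerGen : ℕ → K → Set
IsPowerGen t α =
  InO t α
  × (∀ β → InO t β → Σ GZ λ a0 → Σ GZ λ a1 → Σ GZ λ a2 → Σ GZ λ a3 →
        linComb t α a0 a1 a2 a3 ≡ β)
  × (∀ a0 a1 a2 a3 → linComb t α a0 a1 a2 a3 ≡ 0K →
        (a0 ≡ 0ᶻ) × (a1 ≡ 0ᶻ) × (a2 ≡ 0ᶻ) × (a3 ≡ 0ᶻ))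

ObtainedFrom : ℕ → K → K → Set
ObtainedFrom t α β = Σ GZ λ ε → IsUnitᶻ ε × Σ GZ λ c →
  β ≡ addK (mulK t (ιGZ ε) α) (ιGZ c)

Equivalent : ℕ → K → K → Set
Equivalent t α β = ObtainedFrom t α β ⊎ ObtainedFrom t β α

minusItᶻ : ℕ → GZ
minusItᶻ t = (+ 0 , ℤ.- (+ t))

onePlusI : GZ
onePlusI = (+ 1 , + 1)

Listed : ℕ → K → Set
Listed t α =
    α ≡ elemXYZ 1ᶻ 0ᶻ 0ᶻ
  ⊎ α ≡ elemXYZ (minusItᶻ t) 0ᶻ 1ᶻ
  ⊎ (t ≡ 1 ×
      ( α ≡ elemXYZ (+ 3 , + 0) onePlusI (+ 0 , + 2)
      ⊎ α ≡ elemXYZ (+ 3 , + 0) (-ᶻ onePlusI) (+ 0 , + 2)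
      ⊎ α ≡ elemXYZ iᶻ onePlusI 1ᶻ
      ⊎ α ≡ elemXYZ iᶻ (-ᶻ onePlusI) 1ᶻ))

{-# OPTIONS --safe #-}
-- ℤ_K = ℤ[i][ξ]: an integral element has powers of bounded denominator, and this property passes to traces and norms
-- along ℚ ⊂ ℚ(i) ⊂ ℚ(i, ξ²) ⊂ K. At each step trace and norm bound the denominator by the discriminant, which is removed
-- by t² + 4 being squarefree at the odd primes and by a computation modulo powers of 1 + i at 2.
--
-- If α = x ξ + y ξ² + z ξ³ generates ℤ_K, then ξ is a polynomial in α, so (α − α′) / (ξ − ξ′) is a unit for every
-- conjugation. Taking the conjugates −ξ, 1/ξ, −1/ξ of ξ and norms, and writing c = i t, the following are units of ℤ[i]:
--   F₁ = x² + c x z + z²,   F₊ = (x + (c + 1) z)² − (c + 2) y²,   F₋ = (x + (c − 1) z)² − (c − 2) y².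
-- Since (2 − c) F₊ + (2 + c) F₋ = 4 F₁ and t is odd, the three agree, say with ε, and y² = z (x + c z).
-- If y = 0, then α is a unit multiple of ξ or 1/ξ. Otherwise ε + (c + 2) y² and ε + (c − 2) y² are both squares in ℤ[i];
-- for |y| ≤ 30 and t ≤ 100 a search shows that this happens only for t = 1 and y = ±1 ± i.
module Submission where

open import Defs
open import Algebra.Bundles using (CommutativeRing)
open import Algebra.Core using (Op₂)
open import Algebra.Structures using (IsCommutativeRing)
import Algebra.Properties.Ring as RingProperties
import Algebra.Properties.Semiring.Mult.TCOptimised as SemiringMult
import Algebra.Solver.Ring
import Algebra.Solver.Ring.AlmostCommutativeRing as ACR
open import Data.Bool using (Bool; true; false; T; _∧_; _∨_; _xor_; not; if_then_else_)
import Data.Bool.Properties as Bool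
open import Data.Empty using (⊥; ⊥-elim)
open import Data.Fin using (Fin; zero; suc; #_)
import Data.Fin.Properties as Fin
open import Data.Integer as ℤ using (ℤ; +_; -[1+_]; _⊖_)
import Data.Integer.Properties as ℤ
import Data.Integer.DivMod as ℤ
import Data.Integer.Divisibility.Signed as ℤ∣
open import Data.List using (List; []; _∷_; length; map)
import Data.Maybe as Maybe
open import Data.Nat as ℕ using (ℕ; zero; suc)
import Data.Nat.Properties as ℕ
import Data.Nat.DivMod as ℕ
import Data.Nat.GCD as ℕ
open import Data.Nat.Coprimality as Coprimality using (Coprime; coprime-divisor)
open import Data.Nat.Divisibility as ℕ∣ using (_∣_; divides)
import Data.Nat.Solver as ℕSolver
open import Data.Product using (_×_; _,_; proj₁; proj₂; Σ)
import Data.Product.Properties as ×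
open import Data.Rational as ℚ using (ℚ; mkℚ; ↥_; ↧ₙ_; toℚᵘ)
import Data.Rational.Properties as ℚ
open import Data.Rational.Unnormalised as ℚᵘ using (mkℚᵘ; *≡*)
import Data.Rational.Unnormalised.Properties as ℚᵘ
open import Data.Sum using (_⊎_; inj₁; inj₂; [_,_]′)
open import Data.Unit using (tt)
open import Function using (_∘_; id)
open import Function.Bundles using (Equivalence)
open import Level using (0ℓ)
open import Relation.Binary.PropositionalEquality
open import Relation.Nullary using (Dec; yes; no; ¬_; _×-dec_; _→-dec_)
open import Relation.Nullary.Decidable using (True; toWitness; map′; dec⇒maybe)

-- Commutative rings with propositional equality

-- The roots of f are ±ξ and ±1/ξ, and with θ = ξ² and θ̄ = c - θ = 1/θ one has 1/ξ = θ̄ ξ. So every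
-- conjugation is an automorphism of ℤ[i][ξ] itself, and no splitting field has to be built. One
-- construction R[x]/(x² - p x - n) on pairs gives all three extensions, with rational, integral and
-- mod 2 coordinates alike, so that elements stay tuples that evaluate. Identities are proved over
-- an arbitrary ring and then instantiated, which keeps the solver away from concrete numbers. The
-- two obstructions to maximality sit on different storeys: ℤ[i][ξ²] has discriminant -(t² + 4),
-- which is odd, while adjoining ξ to it has discriminant 4 θ with θ a unit, so that only 2 matters
-- there. The search is small because x and z are eliminated first: for each odd t only y in one
-- quadrant and four units ε remain, instead of triples (x, y, z).

record Ring : Set₁ where
  infixl 6 _+_
  infixl 7 _*_
  infix  8 -_
  field
    Carrier : Set
    _+_ _*_ : Carrier → Carrier → Carrier
    -_      : Carrier → Carrier
    0# 1#   : Carrier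
    isCommutativeRing : IsCommutativeRing _≡_ _+_ _*_ -_ 0# 1#

  commutativeRing : CommutativeRing 0ℓ 0ℓ
  commutativeRing = record { isCommutativeRing = isCommutativeRing }

  open CommutativeRing commutativeRing public
    using (_-_; +-assoc; +-comm; +-identityˡ; +-identityʳ; -‿inverseˡ; -‿inverseʳ; *-assoc; *-comm
          ; *-identityˡ; *-identityʳ; distribˡ; distribʳ; zeroˡ; zeroʳ; ring; semiring)

  infixr 8 _^_
  _^_ : Carrier → ℕ → Carrier
  a ^ zero  = 1#
  a ^ suc n = a * a ^ n

  open SemiringMult semiring using () renaming (_×_ to _·_)

  -- The optimised multiple makes `fromℤ (+ 1)` reduce to `1#`, so the solver's constant 1 and the
  -- unit of the ring agree by computation.
  fromℤ : ℤ → Carrier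
  fromℤ (+ n)    = n · 1#
  fromℤ -[1+ n ] = - (suc n · 1#)

module _ (R : Ring) where
  open Ring R
  open RingProperties ring using (-‿distribˡ-*; -‿distribʳ-*; -‿involutive; -0#≈0#; -‿+-comm)
  open SemiringMult semiring using () renaming (_×_ to _·_; 1+× to 1+·; ×-homo-+ to ·-homo-+; ×1-homo-* to ·1-homo-*)
  open ≡-Reasoning

  private
    fromℤ-neg : ∀ i → fromℤ (ℤ.- i) ≡ - fromℤ i
    fromℤ-neg (+ zero)    = sym -0#≈0#
    fromℤ-neg (+ suc n)   = refl
    fromℤ-neg -[1+ n ]    = sym (-‿involutive _)

    cancel-1 : ∀ a b → a - b ≡ (1# + a) - (1# + b)
    cancel-1 a b = sym (begin
      (1# + a) + - (1# + b)     ≡⟨ cong (λ e → (1# + a) + e) (sym (-‿+-comm 1# b)) ⟩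
      (1# + a) + (- 1# + - b)   ≡⟨ cong (λ e → e + (- 1# + - b)) (+-comm 1# a) ⟩
      (a + 1#) + (- 1# + - b)   ≡⟨ +-assoc a 1# _ ⟩
      a + (1# + (- 1# + - b))   ≡⟨ cong (λ e → a + e) (sym (+-assoc 1# (- 1#) (- b))) ⟩
      a + ((1# + - 1#) + - b)   ≡⟨ cong (λ e → a + (e + - b)) (-‿inverseʳ 1#) ⟩
      a + (0# + - b)            ≡⟨ cong (λ e → a + e) (+-identityˡ _) ⟩
      a + - b                   ∎)

    fromℤ-⊖ : ∀ m n → fromℤ (m ⊖ n) ≡ m · 1# - n · 1#
    fromℤ-⊖ zero    zero    = sym (-‿inverseʳ 0#)
    fromℤ-⊖ zero    (suc n) = sym (+-identityˡ _)
    fromℤ-⊖ (suc m) zero    = sym (trans (cong (λ e → suc m · 1# + e) -0#≈0#) (+-identityʳ _))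
    fromℤ-⊖ (suc m) (suc n) = begin
      fromℤ (suc m ⊖ suc n)     ≡⟨ cong fromℤ (ℤ.[1+m]⊖[1+n]≡m⊖n m n) ⟩
      fromℤ (m ⊖ n)             ≡⟨ fromℤ-⊖ m n ⟩
      m · 1# - n · 1#           ≡⟨ cancel-1 _ _ ⟩
      (1# + m · 1#) - (1# + n · 1#)  ≡⟨ sym (cong₂ _-_ (1+· m 1#) (1+· n 1#)) ⟩
      suc m · 1# - suc n · 1#   ∎

    fromℤ-+ : ∀ i j → fromℤ (i ℤ.+ j) ≡ fromℤ i + fromℤ j
    fromℤ-+ (+ m)    (+ n)    = ·-homo-+ 1# m n
    fromℤ-+ (+ m)    -[1+ n ] = fromℤ-⊖ m (suc n)
    fromℤ-+ -[1+ m ] (+ n)    = trans (fromℤ-⊖ n (suc m)) (+-comm _ _)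
    fromℤ-+ -[1+ m ] -[1+ n ] = begin
      - (suc (suc (m ℕ.+ n)) · 1#)         ≡⟨ cong (λ k → - (suc k · 1#)) (sym (ℕ.+-suc m n)) ⟩
      - ((suc m ℕ.+ suc n) · 1#)           ≡⟨ cong -_ (·-homo-+ 1# (suc m) (suc n)) ⟩
      - (suc m · 1# + suc n · 1#)          ≡⟨ sym (-‿+-comm _ _) ⟩
      - (suc m · 1#) + - (suc n · 1#)      ∎

    fromℤ-+* : ∀ m j → fromℤ (+ m ℤ.* j) ≡ fromℤ (+ m) * fromℤ j
    fromℤ-+* m (+ n)    = trans (cong fromℤ (sym (ℤ.pos-* m n))) (·1-homo-* m n)
    fromℤ-+* m -[1+ n ] = begin
      fromℤ (+ m ℤ.* ℤ.- (+ suc n))        ≡⟨ cong fromℤ (sym (ℤ.neg-distribʳ-* (+ m) (+ suc n))) ⟩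
      fromℤ (ℤ.- (+ m ℤ.* + suc n))        ≡⟨ fromℤ-neg (+ m ℤ.* + suc n) ⟩
      - fromℤ (+ m ℤ.* + suc n)            ≡⟨ cong -_ (fromℤ-+* m (+ suc n)) ⟩
      - (fromℤ (+ m) * fromℤ (+ suc n))    ≡⟨ -‿distribʳ-* _ _ ⟩
      fromℤ (+ m) * fromℤ -[1+ n ]         ∎

  fromℤ-* : ∀ i j → fromℤ (i ℤ.* j) ≡ fromℤ i * fromℤ j
  fromℤ-* (+ m)    j = fromℤ-+* m j
  fromℤ-* -[1+ m ] j = begin
    fromℤ (ℤ.- (+ suc m) ℤ.* j)      ≡⟨ cong fromℤ (sym (ℤ.neg-distribˡ-* (+ suc m) j)) ⟩
    fromℤ (ℤ.- (+ suc m ℤ.* j))      ≡⟨ fromℤ-neg (+ suc m ℤ.* j) ⟩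
    - fromℤ (+ suc m ℤ.* j)          ≡⟨ cong -_ (fromℤ-+* (suc m) j) ⟩
    - (fromℤ (+ suc m) * fromℤ j)    ≡⟨ -‿distribˡ-* _ _ ⟩
    fromℤ -[1+ m ] * fromℤ j         ∎

  fromℤ-morphism : CommutativeRing.rawRing ℤ.+-*-commutativeRing
                   ACR.-Raw-AlmostCommutative⟶ ACR.fromCommutativeRing commutativeRing
  fromℤ-morphism = record
    { ⟦_⟧    = fromℤ
    ; +-homo = fromℤ-+
    ; *-homo = fromℤ-*
    ; -‿homo = fromℤ-neg
    ; 0-homo = refl
    ; 1-homo = refl
    }

  -- With integers as coefficients, normal forms are compared in ℤ; no decidable equality on the
  -- carrier is involved, so the solver works over a variable ring.
  module Solver where
    open Algebra.Solver.Ring _ _ fromℤ-morphism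
      (λ i j → Maybe.map (cong fromℤ) (dec⇒maybe (i ℤ.≟ j))) public
      using (Polynomial; solve; _:=_; con; _:+_; _:*_; _:-_; :-_)

record Hom (R S : Ring) : Set where
  private
    module R = Ring R
    module S = Ring S
  field
    ⟦_⟧ : R.Carrier → S.Carrier
    +-homo : ∀ x y → ⟦ x R.+ y ⟧ ≡ ⟦ x ⟧ S.+ ⟦ y ⟧
    *-homo : ∀ x y → ⟦ x R.* y ⟧ ≡ ⟦ x ⟧ S.* ⟦ y ⟧
    1-homo : ⟦ R.1# ⟧ ≡ S.1#

module HomProperties {R S : Ring} (f : Hom R S) where
  private
    module R = Ring R
    module S = Ring S
  open Hom f
  open ≡-Reasoning

  0-homo : ⟦ R.0# ⟧ ≡ S.0#
  0-homo = begin
    ⟦ R.0# ⟧                                      ≡⟨ lemma ⟦ R.0# ⟧ ⟩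
    (⟦ R.0# ⟧ S.+ ⟦ R.0# ⟧) S.+ S.- ⟦ R.0# ⟧      ≡⟨ cong (S._+ S.- ⟦ R.0# ⟧) (sym (+-homo R.0# R.0#)) ⟩
    ⟦ R.0# R.+ R.0# ⟧ S.+ S.- ⟦ R.0# ⟧            ≡⟨ cong (λ e → ⟦ e ⟧ S.+ S.- ⟦ R.0# ⟧) (R.+-identityˡ R.0#) ⟩
    ⟦ R.0# ⟧ S.+ S.- ⟦ R.0# ⟧                     ≡⟨ S.-‿inverseʳ _ ⟩
    S.0#                                          ∎
    where
    open Solver S
    lemma : ∀ a → a ≡ (a S.+ a) S.+ S.- a
    lemma = solve 1 (λ a → a := (a :+ a) :+ :- a) refl

  -‿homo : ∀ x → ⟦ R.- x ⟧ ≡ S.- ⟦ x ⟧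
  -‿homo x = begin
    ⟦ R.- x ⟧                                   ≡⟨ lemma ⟦ R.- x ⟧ ⟦ x ⟧ ⟩
    (⟦ R.- x ⟧ S.+ ⟦ x ⟧) S.+ S.- ⟦ x ⟧         ≡⟨ cong (S._+ S.- ⟦ x ⟧) (sym (+-homo _ x)) ⟩
    ⟦ R.- x R.+ x ⟧ S.+ S.- ⟦ x ⟧               ≡⟨ cong (λ e → ⟦ e ⟧ S.+ S.- ⟦ x ⟧) (R.-‿inverseˡ x) ⟩
    ⟦ R.0# ⟧ S.+ S.- ⟦ x ⟧                      ≡⟨ cong (S._+ S.- ⟦ x ⟧) 0-homo ⟩
    S.0# S.+ S.- ⟦ x ⟧                          ≡⟨ S.+-identityˡ _ ⟩
    S.- ⟦ x ⟧                                   ∎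
    where
    open Solver S
    lemma : ∀ a b → a ≡ (a S.+ b) S.+ S.- b
    lemma = solve 2 (λ a b → a := (a :+ b) :+ :- b) refl

  private
    fromℕ-homo : ∀ n → ⟦ R.fromℤ (+ n) ⟧ ≡ S.fromℤ (+ n)
    fromℕ-homo zero          = 0-homo
    fromℕ-homo (suc zero)    = 1-homo
    fromℕ-homo (suc (suc n)) = trans (+-homo _ _) (cong₂ S._+_ (fromℕ-homo (suc n)) 1-homo)

  fromℤ-homo : ∀ i → ⟦ R.fromℤ i ⟧ ≡ S.fromℤ i
  fromℤ-homo (+ n)    = fromℕ-homo n
  fromℤ-homo -[1+ n ] = trans (-‿homo _) (cong S.-_ (fromℕ-homo (suc n)))

_∘ᴴ_ : ∀ {R S T} → Hom S T → Hom R S → Hom R T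
g ∘ᴴ f = record
  { ⟦_⟧    = λ x → G.⟦ F.⟦ x ⟧ ⟧
  ; +-homo = λ x y → trans (cong G.⟦_⟧ (F.+-homo x y)) (G.+-homo _ _)
  ; *-homo = λ x y → trans (cong G.⟦_⟧ (F.*-homo x y)) (G.*-homo _ _)
  ; 1-homo = trans (cong G.⟦_⟧ F.1-homo) G.1-homo
  }
  where
  module F = Hom f
  module G = Hom g

-- Quadratic extensions: conjugation, trace and norm

module _ (R : Ring) where
  open Ring R

  quadMul : (p n : Carrier) → Carrier × Carrier → Carrier × Carrier → Carrier × Carrier
  quadMul p n (u , v) (u′ , v′) = u * u′ + n * (v * v′) , u * v′ + v * u′ + p * (v * v′)

-- The ring R[x]/(x² − p x − n), its elements u + v x being written (u , v).
-- The multiplication is a parameter so that the operations of Defs can be used on the nose.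
module Quadratic (R : Ring) (p n : Ring.Carrier R)
  (mul : Op₂ (Ring.Carrier R × Ring.Carrier R))
  (mul-correct : ∀ a b → mul a b ≡ quadMul R p n a b) where

  open Ring R

  private
    C = Carrier × Carrier

    add : C → C → C
    add (u , v) (u′ , v′) = u + u′ , v + v′

    neg : C → C
    neg (u , v) = - u , - v

    one : C
    one = 1# , 0#

    _⊛_ : C → C → C
    _⊛_ = quadMul R p n

    open Solver R

    ⊛-assoc : ∀ a b c → (a ⊛ b) ⊛ c ≡ a ⊛ (b ⊛ c)
    ⊛-assoc (a , a′) (b , b′) (c , c′) = cong₂ _,_
      (solve 8 (λ p n a a′ b b′ c c′ →
          (a :* b :+ n :* (a′ :* b′)) :* c :+ n :* ((a :* b′ :+ a′ :* b :+ p :* (a′ :* b′)) :* c′)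
        := a :* (b :* c :+ n :* (b′ :* c′)) :+ n :* (a′ :* (b :* c′ :+ b′ :* c :+ p :* (b′ :* c′))))
        refl p n a a′ b b′ c c′)
      (solve 8 (λ p n a a′ b b′ c c′ →
          (a :* b :+ n :* (a′ :* b′)) :* c′ :+ (a :* b′ :+ a′ :* b :+ p :* (a′ :* b′)) :* c
            :+ p :* ((a :* b′ :+ a′ :* b :+ p :* (a′ :* b′)) :* c′)
        := a :* (b :* c′ :+ b′ :* c :+ p :* (b′ :* c′)) :+ a′ :* (b :* c :+ n :* (b′ :* c′))
            :+ p :* (a′ :* (b :* c′ :+ b′ :* c :+ p :* (b′ :* c′))))
        refl p n a a′ b b′ c c′)

    ⊛-comm : ∀ a b → a ⊛ b ≡ b ⊛ a
    ⊛-comm (a , a′) (b , b′) = cong₂ _,_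
      (solve 5 (λ n a a′ b b′ → a :* b :+ n :* (a′ :* b′) := b :* a :+ n :* (b′ :* a′)) refl n a a′ b b′)
      (solve 5 (λ p a a′ b b′ → a :* b′ :+ a′ :* b :+ p :* (a′ :* b′)
                             := b :* a′ :+ b′ :* a :+ p :* (b′ :* a′)) refl p a a′ b b′)

    ⊛-identityˡ : ∀ a → one ⊛ a ≡ a
    ⊛-identityˡ (a , a′) = cong₂ _,_
      (solve 3 (λ n a a′ → con (+ 1) :* a :+ n :* (con (+ 0) :* a′) := a) refl n a a′)
      (solve 3 (λ p a a′ → con (+ 1) :* a′ :+ con (+ 0) :* a :+ p :* (con (+ 0) :* a′) := a′) refl p a a′)

    ⊛-distribˡ : ∀ a b c → a ⊛ add b c ≡ add (a ⊛ b) (a ⊛ c)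
    ⊛-distribˡ (a , a′) (b , b′) (c , c′) = cong₂ _,_
      (solve 7 (λ n a a′ b b′ c c′ → a :* (b :+ c) :+ n :* (a′ :* (b′ :+ c′))
        := a :* b :+ n :* (a′ :* b′) :+ (a :* c :+ n :* (a′ :* c′))) refl n a a′ b b′ c c′)
      (solve 7 (λ p a a′ b b′ c c′ → a :* (b′ :+ c′) :+ a′ :* (b :+ c) :+ p :* (a′ :* (b′ :+ c′))
        := a :* b′ :+ a′ :* b :+ p :* (a′ :* b′) :+ (a :* c′ :+ a′ :* c :+ p :* (a′ :* c′)))
        refl p a a′ b b′ c c′)

    open ≡-Reasoning

    mul-comm : ∀ a b → mul a b ≡ mul b a
    mul-comm a b = begin
      mul a b  ≡⟨ mul-correct a b ⟩
      a ⊛ b    ≡⟨ ⊛-comm a b ⟩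
      b ⊛ a    ≡⟨ sym (mul-correct b a) ⟩
      mul b a  ∎

    mul-assoc : ∀ a b c → mul (mul a b) c ≡ mul a (mul b c)
    mul-assoc a b c = begin
      mul (mul a b) c    ≡⟨ mul-correct _ c ⟩
      (mul a b) ⊛ c      ≡⟨ cong (_⊛ c) (mul-correct a b) ⟩
      (a ⊛ b) ⊛ c        ≡⟨ ⊛-assoc a b c ⟩
      a ⊛ (b ⊛ c)        ≡⟨ cong (a ⊛_) (sym (mul-correct b c)) ⟩
      a ⊛ mul b c        ≡⟨ sym (mul-correct a _) ⟩
      mul a (mul b c)    ∎

    mul-distribˡ : ∀ a b c → mul a (add b c) ≡ add (mul a b) (mul a c)
    mul-distribˡ a b c = begin
      mul a (add b c)           ≡⟨ mul-correct a _ ⟩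
      a ⊛ add b c               ≡⟨ ⊛-distribˡ a b c ⟩
      add (a ⊛ b) (a ⊛ c)       ≡⟨ sym (cong₂ add (mul-correct a b) (mul-correct a c)) ⟩
      add (mul a b) (mul a c)   ∎

    mul-identityˡ : ∀ a → mul one a ≡ a
    mul-identityˡ a = trans (mul-correct one a) (⊛-identityˡ a)

  -- Without the barrier, comparing two such rings unfolds the solver proofs.
  abstract
    quadratic-isCommutativeRing : IsCommutativeRing _≡_ add mul neg (0# , 0#) one
    quadratic-isCommutativeRing = record
      { isRing = record
        { +-isAbelianGroup = record
          { isGroup = record
            { isMonoid = record
              { isSemigroup = record
                { isMagma = record { isEquivalence = isEquivalence ; ∙-cong = cong₂ add }
                ; assoc = λ a b c → cong₂ _,_ (+-assoc _ _ _) (+-assoc _ _ _)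
                }
              ; identity = (λ a → cong₂ _,_ (+-identityˡ _) (+-identityˡ _))
                         , (λ a → cong₂ _,_ (+-identityʳ _) (+-identityʳ _))
              }
            ; inverse = (λ a → cong₂ _,_ (-‿inverseˡ _) (-‿inverseˡ _))
                      , (λ a → cong₂ _,_ (-‿inverseʳ _) (-‿inverseʳ _))
            ; ⁻¹-cong = cong neg
            }
          ; comm = λ a b → cong₂ _,_ (+-comm _ _) (+-comm _ _)
          }
        ; *-cong = cong₂ mul
        ; *-assoc = mul-assoc
        ; *-identity = mul-identityˡ , (λ a → trans (mul-comm a one) (mul-identityˡ a))
        ; distrib = mul-distribˡ
                  , (λ a b c → trans (mul-comm _ a) (trans (mul-distribˡ a b c) (cong₂ add (mul-comm a b) (mul-comm a c))))
        }
      ; *-comm = mul-comm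
      }

  quadratic : Ring
  quadratic = record
    { Carrier = C
    ; _+_ = add
    ; _*_ = mul
    ; -_  = neg
    ; 0#  = 0# , 0#
    ; 1#  = one
    ; isCommutativeRing = quadratic-isCommutativeRing
    }

  module Q = Ring quadratic

  scalar : Hom R quadratic
  scalar = record
    { ⟦_⟧    = λ a → a , 0#
    ; +-homo = λ a b → cong (a + b ,_) (sym (+-identityˡ 0#))
    ; *-homo = λ a b → sym (trans (mul-correct (a , 0#) (b , 0#)) (cong₂ _,_
        (solve 3 (λ n a b → a :* b :+ n :* (con (+ 0) :* con (+ 0)) := a :* b) refl n a b)
        (solve 3 (λ p a b → a :* con (+ 0) :+ con (+ 0) :* b :+ p :* (con (+ 0) :* con (+ 0)) := con (+ 0)) refl p a b)))
    ; 1-homo = refl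
    }

  scalar-* : ∀ a u v → (a , 0#) Q.* (u , v) ≡ (a * u , a * v)
  scalar-* a u v = trans (mul-correct _ _) (cong₂ _,_
    (solve 4 (λ n a u v → a :* u :+ n :* (con (+ 0) :* v) := a :* u) refl n a u v)
    (solve 4 (λ p a u v → a :* v :+ con (+ 0) :* u :+ p :* (con (+ 0) :* v) := a :* v) refl p a u v))

  fromℤ-quad : ∀ i → Q.fromℤ i ≡ (fromℤ i , 0#)
  fromℤ-quad i = sym (HomProperties.fromℤ-homo scalar i)

  fromℤ-quad-* : ∀ i u v → Q.fromℤ i Q.* (u , v) ≡ (fromℤ i * u , fromℤ i * v)
  fromℤ-quad-* i u v = trans (cong (Q._* (u , v)) (fromℤ-quad i)) (scalar-* (fromℤ i) u v)

  -- The automorphism x ↦ p - x, which exchanges the two roots of x² - p x - n.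
  conj : Hom quadratic quadratic
  conj = record
    { ⟦_⟧    = λ (u , v) → u + p * v , - v
    ; +-homo = λ (a , a′) (b , b′) → cong₂ _,_
        (solve 5 (λ p a a′ b b′ → (a :+ b) :+ p :* (a′ :+ b′) := (a :+ p :* a′) :+ (b :+ p :* b′)) refl p a a′ b b′)
        (solve 2 (λ a′ b′ → :- (a′ :+ b′) := :- a′ :+ :- b′) refl a′ b′)
    ; *-homo = λ (a , a′) (b , b′) → trans (cong conj′ (mul-correct _ _)) (trans (cong₂ _,_
        (solve 6 (λ p n a a′ b b′ → (a :* b :+ n :* (a′ :* b′)) :+ p :* (a :* b′ :+ a′ :* b :+ p :* (a′ :* b′))
           := (a :+ p :* a′) :* (b :+ p :* b′) :+ n :* (:- a′ :* :- b′)) refl p n a a′ b b′)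
        (solve 5 (λ p a a′ b b′ → :- (a :* b′ :+ a′ :* b :+ p :* (a′ :* b′))
           := (a :+ p :* a′) :* :- b′ :+ :- a′ :* (b :+ p :* b′) :+ p :* (:- a′ :* :- b′)) refl p a a′ b b′))
        (sym (mul-correct _ _)))
    ; 1-homo = cong₂ _,_ (solve 1 (λ p → con (+ 1) :+ p :* con (+ 0) := con (+ 1)) refl p)
                         (solve 0 (:- con (+ 0) := con (+ 0)) refl)
    }
    where
    conj′ : C → C
    conj′ (u , v) = u + p * v , - v

  private module conj = Hom conj

  trace norm : C → Carrier
  trace (u , v) = u + u + p * v
  norm (u , v) = u * u + p * (u * v) + - (n * (v * v))

  +-conj : ∀ a → a Q.+ conj.⟦ a ⟧ ≡ (trace a , 0#)
  +-conj (u , v) = cong₂ _,_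
    (solve 3 (λ p u v → u :+ (u :+ p :* v) := u :+ u :+ p :* v) refl p u v)
    (-‿inverseʳ v)

  *-conj : ∀ a → a Q.* conj.⟦ a ⟧ ≡ (norm a , 0#)
  *-conj (u , v) = trans (mul-correct _ _) (cong₂ _,_
    (solve 4 (λ p n u v → u :* (u :+ p :* v) :+ n :* (v :* :- v)
      := u :* u :+ p :* (u :* v) :+ :- (n :* (v :* v))) refl p n u v)
    (solve 3 (λ p u v → u :* :- v :+ v :* (u :+ p :* v) :+ p :* (v :* :- v) := con (+ 0)) refl p u v))

  -- As a scalar the norm is a times its conjugate, so it inherits multiplicativity from `conj`; the
  -- equation between scalars is read off in the first coordinate.
  norm-* : ∀ a b → norm (a Q.* b) ≡ norm a * norm b
  norm-* a b = cong proj₁ (begin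
    norm (a Q.* b) , 0#                                   ≡⟨ sym (*-conj (a Q.* b)) ⟩
    a Q.* b Q.* conj.⟦ a Q.* b ⟧                          ≡⟨ cong (a Q.* b Q.*_) (conj.*-homo a b) ⟩
    a Q.* b Q.* (conj.⟦ a ⟧ Q.* conj.⟦ b ⟧)               ≡⟨ interchange a b _ _ ⟩
    (a Q.* conj.⟦ a ⟧) Q.* (b Q.* conj.⟦ b ⟧)             ≡⟨ cong₂ Q._*_ (*-conj a) (*-conj b) ⟩
    (norm a , 0#) Q.* (norm b , 0#)                       ≡⟨ sym (Hom.*-homo scalar _ _) ⟩
    norm a * norm b , 0#                                  ∎)
    where
    open import Algebra.Properties.CommutativeSemigroup
      (CommutativeRing.*-commutativeSemigroup Q.commutativeRing) using (interchange)

  norm-unit : ∀ a b → a Q.* b ≡ Q.1# → norm a * norm b ≡ 1#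
  norm-unit a b ab≡1 = trans (sym (norm-* a b)) (trans (cong norm ab≡1)
    (solve 2 (λ p n → con (+ 1) :* con (+ 1) :+ p :* (con (+ 1) :* con (+ 0)) :+ :- (n :* (con (+ 0) :* con (+ 0))) := con (+ 1)) refl p n))

-- Serves both to include each integral storey in the rational one and to reduce the integral tower
-- modulo 2.
module QuadraticMap {R S : Ring} (f : Hom R S) (p n : Ring.Carrier R)
  (mulR : Op₂ (Ring.Carrier R × Ring.Carrier R)) (mulR-correct : ∀ a b → mulR a b ≡ quadMul R p n a b)
  (mulS : Op₂ (Ring.Carrier S × Ring.Carrier S)) (mulS-correct : ∀ a b → mulS a b ≡ quadMul S (Hom.⟦_⟧ f p) (Hom.⟦_⟧ f n) a b) where
  open Hom f
  private
    module R = Ring R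
    module S = Ring S

    map-quadMul : ∀ a b → (⟦ proj₁ (quadMul R p n a b) ⟧ , ⟦ proj₂ (quadMul R p n a b) ⟧)
                ≡ quadMul S ⟦ p ⟧ ⟦ n ⟧ (⟦ proj₁ a ⟧ , ⟦ proj₂ a ⟧) (⟦ proj₁ b ⟧ , ⟦ proj₂ b ⟧)
    map-quadMul (a , a′) (b , b′) = cong₂ _,_
      (trans (+-homo _ _) (cong₂ S._+_ (*-homo a b) (h3 n a′ b′)))
      (trans (+-homo _ _) (cong₂ S._+_ (trans (+-homo _ _) (cong₂ S._+_ (*-homo a b′) (*-homo a′ b))) (h3 p a′ b′)))
      where
      h3 : ∀ x y z → ⟦ x R.* (y R.* z) ⟧ ≡ ⟦ x ⟧ S.* (⟦ y ⟧ S.* ⟦ z ⟧)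
      h3 x y z = trans (*-homo x _) (cong (⟦ x ⟧ S.*_) (*-homo y z))

  mapHom : Hom (Quadratic.quadratic R p n mulR mulR-correct) (Quadratic.quadratic S ⟦ p ⟧ ⟦ n ⟧ mulS mulS-correct)
  mapHom = record
    { ⟦_⟧    = λ (u , v) → ⟦ u ⟧ , ⟦ v ⟧
    ; +-homo = λ a b → cong₂ _,_ (+-homo _ _) (+-homo _ _)
    ; *-homo = λ a b → trans (cong (λ (u , v) → ⟦ u ⟧ , ⟦ v ⟧) (mulR-correct a b))
                         (trans (map-quadMul a b) (sym (mulS-correct _ _)))
    ; 1-homo = cong₂ _,_ 1-homo (HomProperties.0-homo f)
    }

-- Integral elements

nonzero-* : ∀ {i j} → i ≢ + 0 → j ≢ + 0 → i ℤ.* j ≢ + 0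
nonzero-* {i} i≢0 j≢0 ij≡0 = [ i≢0 , j≢0 ]′ (ℤ.i*j≡0⇒i≡0∨j≡0 i ij≡0)

module _ (R : Ring) where
  open Ring R

  ^-+ : ∀ a m n → a ^ (m ℕ.+ n) ≡ a ^ m * a ^ n
  ^-+ a zero    n = sym (*-identityˡ _)
  ^-+ a (suc m) n = trans (cong (a *_) (^-+ a m n)) (sym (*-assoc a _ _))

module _ {R S : Ring} (f : Hom R S) where
  private
    module R = Ring R
    module S = Ring S
  open Hom f

  ^-homo : ∀ a n → ⟦ a R.^ n ⟧ ≡ ⟦ a ⟧ S.^ n
  ^-homo a zero    = 1-homo
  ^-homo a (suc n) = trans (*-homo a _) (cong (⟦ a ⟧ S.*_) (^-homo a n))

-- Z inside F with integer denominators: enough of a field of fractions to speak of bounded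
-- denominators, without any division in F.
record Order : Set₁ where
  field
    F Z : Ring
    ι   : Hom Z F

  module F = Ring F
  module Z = Ring Z
  module ι = Hom ι
  open F using (_+_; _*_; _^_; -_; 0#; 1#; fromℤ)

  field
    ι-injective : ∀ {a b} → ι.⟦ a ⟧ ≡ ι.⟦ b ⟧ → a ≡ b
    denominator : ∀ a → Σ ℤ λ d → d ≢ + 0 × Σ Z.Carrier λ z → ι.⟦ z ⟧ ≡ fromℤ d * a
    torsionFree : ∀ d a → d ≢ + 0 → fromℤ d * a ≡ 0# → a ≡ 0#

  Integral : F.Carrier → Set
  Integral a = Σ Z.Carrier λ z → ι.⟦ z ⟧ ≡ a

  -- Boundedness of the denominators of all powers replaces being a root of a monic polynomial;
  -- it is inherited by sums and products without any elimination theory.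
  Bounded : F.Carrier → Set
  Bounded a = Σ ℤ λ d → d ≢ + 0 × ∀ m → Integral (fromℤ d * a ^ m)

  IntegrallyClosed : Set
  IntegrallyClosed = ∀ a → Bounded a → Integral a

  open HomProperties ι renaming (-‿homo to ι-neg; fromℤ-homo to ι-fromℤ; 0-homo to ι-0) using () public

  integral-+ : ∀ {a b} → Integral a → Integral b → Integral (a + b)
  integral-+ (x , refl) (y , refl) = x Z.+ y , ι.+-homo x y

  integral-* : ∀ {a b} → Integral a → Integral b → Integral (a * b)
  integral-* (x , refl) (y , refl) = x Z.* y , ι.*-homo x y

  integral-neg : ∀ {a} → Integral a → Integral (- a)
  integral-neg (x , refl) = Z.- x , ι-neg x

  integral-fromℤ : ∀ i → Integral (fromℤ i)
  integral-fromℤ i = Z.fromℤ i , ι-fromℤ i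

  private
    F-fromℤ-* = fromℤ-* F
  open Solver F

  module _ (d : ℤ) (a b : F.Carrier) (bound : ∀ j k → Integral (fromℤ d * (a ^ j * b ^ k))) where

    private
      Conductor : F.Carrier → Set
      Conductor c = ∀ j k → Integral (fromℤ d * (c * (a ^ j * b ^ k)))

      -- The multipliers of the set of conductors are closed under sums and products and contain a
      -- and b. As 1 is a conductor by `bound`, all powers of a multiplier are conductors, so a
      -- single d bounds their denominators.
      Multiplier : F.Carrier → Set
      Multiplier x = ∀ c → Conductor c → Conductor (x * c)

      multiplierˡ : Multiplier a
      multiplierˡ c h j k = subst Integral
        (solve 5 (λ d a c x y → d :* (c :* (a :* x :* y)) := d :* (a :* c :* (x :* y))) refl (fromℤ d) a c (a ^ j) (b ^ k))
        (h (suc j) k)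

      multiplierʳ : Multiplier b
      multiplierʳ c h j k = subst Integral
        (solve 5 (λ d b c x y → d :* (c :* (x :* (b :* y))) := d :* (b :* c :* (x :* y))) refl (fromℤ d) b c (a ^ j) (b ^ k))
        (h j (suc k))

      multiplier-+ : ∀ {x y} → Multiplier x → Multiplier y → Multiplier (x + y)
      multiplier-+ {x} {y} hx hy c h j k = subst Integral
        (solve 5 (λ d x y c w → d :* (x :* c :* w) :+ d :* (y :* c :* w) := d :* ((x :+ y) :* c :* w))
          refl (fromℤ d) x y c (a ^ j * b ^ k))
        (integral-+ (hx c h j k) (hy c h j k))

      multiplier-* : ∀ {x y} → Multiplier x → Multiplier y → Multiplier (x * y)
      multiplier-* {x} {y} hx hy c h = subst Conductor (sym (F.*-assoc x y c)) (hx (y * c) (hy c h))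

      bounded-multiplier : ∀ {x} → d ≢ + 0 → Multiplier x → Bounded x
      bounded-multiplier {x} d≢0 hx = d , d≢0 , λ m → subst Integral
          (solve 2 (λ d w → d :* (w :* (con (+ 1) :* con (+ 1))) := d :* w) refl (fromℤ d) (x ^ m))
          (powers m 0 0)
        where
        powers : ∀ m → Conductor (x ^ m)
        powers zero j k = subst Integral (cong (fromℤ d *_) (sym (F.*-identityˡ _))) (bound j k)
        powers (suc m)  = hx _ (powers m)

    jointly-bounded-+ : d ≢ + 0 → Bounded (a + b)
    jointly-bounded-+ d≢0 = bounded-multiplier d≢0 (multiplier-+ multiplierˡ multiplierʳ)

    jointly-bounded-* : d ≢ + 0 → Bounded (a * b)
    jointly-bounded-* d≢0 = bounded-multiplier d≢0 (multiplier-* multiplierˡ multiplierʳ)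

  private
    joint-bound : ∀ {a b} → ((d , _) : Bounded a) → ((e , _) : Bounded b) →
                  ∀ j k → Integral (fromℤ (d ℤ.* e) * (a ^ j * b ^ k))
    joint-bound {a} {b} (d , _ , ha) (e , _ , hb) j k = subst Integral
      (trans (solve 4 (λ d e x y → d :* x :* (e :* y) := d :* e :* (x :* y)) refl (fromℤ d) (fromℤ e) (a ^ j) (b ^ k))
             (cong (_* (a ^ j * b ^ k)) (sym (F-fromℤ-* d e))))
      (integral-* (ha j) (hb k))

  bounded-+ : ∀ {a b} → Bounded a → Bounded b → Bounded (a + b)
  bounded-+ {a} {b} ha@(d , d≢0 , _) hb@(e , e≢0 , _) =
    jointly-bounded-+ (d ℤ.* e) a b (joint-bound ha hb) (nonzero-* d≢0 e≢0)

  bounded-* : ∀ {a b} → Bounded a → Bounded b → Bounded (a * b)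
  bounded-* {a} {b} ha@(d , d≢0 , _) hb@(e , e≢0 , _) =
    jointly-bounded-* (d ℤ.* e) a b (joint-bound ha hb) (nonzero-* d≢0 e≢0)

  horner : F.Carrier → F.Carrier → List Z.Carrier → F.Carrier
  horner b acc []       = acc
  horner b acc (c ∷ cs) = horner b (acc * b + ι.⟦ c ⟧) cs

  private
    lower : F.Carrier → List Z.Carrier → F.Carrier
    lower b []       = 0#
    lower b (c ∷ cs) = ι.⟦ c ⟧ * b ^ length cs + lower b cs

    horner-lower : ∀ b acc cs → horner b acc cs ≡ acc * b ^ length cs + lower b cs
    horner-lower b acc []       = solve 1 (λ a → a := a :* con (+ 1) :+ con (+ 0)) refl acc
    horner-lower b acc (c ∷ cs) = trans (horner-lower b _ cs)
      (solve 5 (λ a b c x l → (a :* b :+ c) :* x :+ l := a :* (b :* x) :+ (c :* x :+ l))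
        refl acc b ι.⟦ c ⟧ (b ^ length cs) (lower b cs))

    common-denominator : ∀ b n → Σ ℤ λ d → d ≢ + 0 × ∀ {j} → j ℕ.< n → Integral (fromℤ d * b ^ j)
    common-denominator b zero    = + 1 , (λ ()) , λ ()
    common-denominator b (suc n) with common-denominator b n | denominator (b ^ n)
    ... | d , d≢0 , h | e , e≢0 , z = d ℤ.* e , nonzero-* d≢0 e≢0 , step
      where
      step : ∀ {j} → j ℕ.< suc n → Integral (fromℤ (d ℤ.* e) * b ^ j)
      step {j} j<1+n with ℕ.m≤n⇒m<n∨m≡n (ℕ.≤-pred j<1+n)
      ... | inj₁ j<n = subst Integral
        (trans (solve 3 (λ d e x → e :* (d :* x) := d :* e :* x) refl (fromℤ d) (fromℤ e) (b ^ j))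
               (cong (_* b ^ j) (sym (F-fromℤ-* d e))))
        (integral-* (integral-fromℤ e) (h j<n))
      ... | inj₂ refl = subst Integral
        (trans (sym (F.*-assoc _ _ _)) (cong (_* b ^ j) (sym (F-fromℤ-* d e))))
        (integral-* (integral-fromℤ d) z)

    shifted-lower : ∀ d b k cs → (∀ {j} → j ℕ.< k ℕ.+ length cs → Integral (fromℤ d * b ^ j)) →
                    Integral (fromℤ d * (b ^ k * lower b cs))
    shifted-lower d b k []       h = subst Integral
      (solve 2 (λ d x → con (+ 0) := d :* (x :* con (+ 0))) refl (fromℤ d) (b ^ k)) (integral-fromℤ (+ 0))
    shifted-lower d b k (c ∷ cs) h = subst Integral
      (trans (cong (λ x → ι.⟦ c ⟧ * (fromℤ d * x) + fromℤ d * (b ^ k * lower b cs)) (^-+ F b k (length cs)))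
        (solve 5 (λ d c x y l → c :* (d :* (x :* y)) :+ d :* (x :* l) := d :* (x :* (c :* y :+ l)))
          refl (fromℤ d) ι.⟦ c ⟧ (b ^ k) (b ^ length cs) (lower b cs)))
      (integral-+ (integral-* (c , refl) (h (ℕ.+-monoʳ-< k (ℕ.n<1+n _))))
                  (shifted-lower d b k cs (λ j< → h (ℕ.<-trans j< (ℕ.+-monoʳ-< k (ℕ.n<1+n _))))))

  -- A common denominator of the powers below the degree n serves all others: for j ≥ n, multiplying
  -- the equation by b^(j - n) expresses b^j through lower powers with integral coefficients.
  bounded-root : ∀ b cs → horner b 1# cs ≡ 0# → Bounded b
  bounded-root b cs root with common-denominator b (length cs)
  ... | d , d≢0 , h = d , d≢0 , λ m → below (suc m) ℕ.≤-refl
    where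
    below : ∀ N {j} → j ℕ.< N → Integral (fromℤ d * b ^ j)
    below (suc N) {j} j<1+N with ℕ.m≤n⇒m<n∨m≡n (ℕ.≤-pred j<1+N)
    ... | inj₁ j<N  = below N j<N
    ... | inj₂ refl with j ℕ.<? length cs
    ... | yes j<n = h j<n
    ... | no  j≮n = subst Integral eq (integral-neg (shifted-lower d b k cs (λ {i} j< → below N {i} (subst (i ℕ.<_) k+n≡j j<))))
      where
      k = j ℕ.∸ length cs
      k+n≡j : k ℕ.+ length cs ≡ j
      k+n≡j = ℕ.m∸n+n≡m (ℕ.≮⇒≥ j≮n)

      leading : 1# * b ^ length cs ≡ - lower b cs
      leading = trans (solve 2 (λ x l → x := (x :+ l) :+ :- l) refl _ (lower b cs))
        (trans (cong (_+ - lower b cs) (trans (sym (horner-lower b 1# cs)) root)) (F.+-identityˡ _))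

      eq : - (fromℤ d * (b ^ k * lower b cs)) ≡ fromℤ d * b ^ j
      eq = trans (solve 3 (λ d x l → :- (d :* (x :* l)) := d :* (x :* :- l)) refl (fromℤ d) (b ^ k) (lower b cs))
        (cong (fromℤ d *_) (trans (cong (b ^ k *_) (trans (sym leading) (F.*-identityˡ _)))
          (trans (sym (^-+ F b k (length cs))) (cong (b ^_) k+n≡j))))

  bounded-quadratic-root : ∀ {a p q} → Integral p → Integral q → a * a ≡ p * a + q → Bounded a
  bounded-quadratic-root {a} (p , refl) (q , refl) eq = bounded-root a (Z.- p ∷ Z.- q ∷ [])
    (trans (cong₂ (λ x y → (1# * a + x) * a + y) (ι-neg p) (ι-neg q))
    (trans (solve 3 (λ a p q → (con (+ 1) :* a :+ :- p) :* a :+ :- q := a :* a :+ :- (p :* a :+ q)) refl a ι.⟦ p ⟧ ι.⟦ q ⟧)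
    (trans (cong (_+ - (ι.⟦ p ⟧ * a + ι.⟦ q ⟧)) eq) (F.-‿inverseʳ _))))

  bounded-sqrt : ∀ {a} → Integral (a * a) → Bounded a
  bounded-sqrt {a} h = bounded-quadratic-root (integral-fromℤ (+ 0)) h
    (solve 1 (λ a → a :* a := con (+ 0) :* a :+ a :* a) refl a)

  cancel : ∀ d {a b} → d ≢ + 0 → fromℤ d * a ≡ fromℤ d * b → a ≡ b
  cancel d {a} {b} d≢0 eq = trans (solve 2 (λ a b → a := (a :+ :- b) :+ b) refl a b)
    (trans (cong (_+ b) (torsionFree d _ d≢0
      (trans (solve 3 (λ d a b → d :* (a :+ :- b) := d :* a :+ :- (d :* b)) refl (fromℤ d) a b)
        (trans (cong (_+ - (fromℤ d * b)) eq) (F.-‿inverseʳ _)))))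
    (F.+-identityˡ b))

  bounded-hom : (σ : Hom F F) → (∀ z → Integral (Hom.⟦_⟧ σ ι.⟦ z ⟧)) →
                ∀ {a} → Bounded a → Bounded (Hom.⟦_⟧ σ a)
  bounded-hom σ σ-integral {a} (d , d≢0 , h) = d , d≢0 , λ m → subst Integral
    (trans (σ.*-homo _ _) (cong₂ _*_ (HomProperties.fromℤ-homo σ d) (^-homo σ a m)))
    (subst (λ e → Integral σ.⟦ e ⟧) (proj₂ (h m)) (σ-integral (proj₁ (h m))))
    where module σ = Hom σ

module QuadraticOrder (O : Order) (p n : Ring.Carrier (Order.Z O))
  (mulF : Op₂ (Ring.Carrier (Order.F O) × Ring.Carrier (Order.F O))) (mulF-correct : ∀ a b → mulF a b ≡ quadMul (Order.F O) (Hom.⟦_⟧ (Order.ι O) p) (Hom.⟦_⟧ (Order.ι O) n) a b)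
  (mulZ : Op₂ (Ring.Carrier (Order.Z O) × Ring.Carrier (Order.Z O))) (mulZ-correct : ∀ a b → mulZ a b ≡ quadMul (Order.Z O) p n a b) where
  open Order O
  module QF = Quadratic F ι.⟦ p ⟧ ι.⟦ n ⟧ mulF mulF-correct
  module QZ = Quadratic Z p n mulZ mulZ-correct
  open F using (_+_; _*_; _^_; -_; 0#; 1#; fromℤ)

  private
    module ιᵩ = Hom (QuadraticMap.mapHom ι p n mulZ mulZ-correct mulF mulF-correct)

    clear-denominator : ∀ d e u x → ι.⟦ x ⟧ ≡ fromℤ d * u → ι.⟦ Z.fromℤ e Z.* x ⟧ ≡ fromℤ (d ℤ.* e) * u
    clear-denominator d e u x ιx = trans (ι.*-homo _ x) (trans (cong₂ _*_ (ι-fromℤ e) ιx)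
      (trans (solve 3 (λ d e u → e :* (d :* u) := d :* e :* u) refl (fromℤ d) (fromℤ e) u)
        (cong (_* u) (sym (fromℤ-* F d e)))))
      where open Solver F

    denominatorᵩ : ∀ a → Σ ℤ λ d → d ≢ + 0 × Σ QZ.Q.Carrier λ z → ιᵩ.⟦ z ⟧ ≡ QF.Q.fromℤ d QF.Q.* a
    denominatorᵩ (u , v) =
      let (d , d≢0 , x , ιx) = denominator u
          (e , e≢0 , y , ιy) = denominator v
      in d ℤ.* e , nonzero-* d≢0 e≢0 , (Z.fromℤ e Z.* x , Z.fromℤ d Z.* y) ,
         trans (cong₂ _,_ (clear-denominator d e u x ιx)
                          (trans (clear-denominator e d v y ιy) (cong (λ i → fromℤ i * v) (ℤ.*-comm e d))))
               (sym (QF.fromℤ-quad-* (d ℤ.* e) u v))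

    torsionFreeᵩ : ∀ d a → d ≢ + 0 → QF.Q.fromℤ d QF.Q.* a ≡ QF.Q.0# → a ≡ QF.Q.0#
    torsionFreeᵩ d (u , v) d≢0 eq =
      cong₂ _,_ (torsionFree d u d≢0 (cong proj₁ eq′)) (torsionFree d v d≢0 (cong proj₂ eq′))
      where
      eq′ : (fromℤ d * u , fromℤ d * v) ≡ (0# , 0#)
      eq′ = trans (sym (QF.fromℤ-quad-* d u v)) eq

  order : Order
  order = record
    { F = QF.quadratic
    ; Z = QZ.quadratic
    ; ι = QuadraticMap.mapHom ι p n mulZ mulZ-correct mulF mulF-correct
    ; ι-injective = λ eq → cong₂ _,_ (ι-injective (cong proj₁ eq)) (ι-injective (cong proj₂ eq))
    ; denominator = denominatorᵩ
    ; torsionFree = torsionFreeᵩ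
    }

  private module E = Order order

  bounded-scalar : ∀ {a} → E.Bounded (a , 0#) → Bounded a
  bounded-scalar {a} (d , d≢0 , h) = d , d≢0 , λ m → let (z , eq) = h m in
    proj₁ z , cong proj₁ (trans eq
      (trans (cong (λ x → E.F.fromℤ d E.F.* x) (sym (^-homo QF.scalar a m))) (QF.fromℤ-quad-* d (a ^ m) 0#)))

  private
    bounded-conj : ∀ {a} → E.Bounded a → E.Bounded (Hom.⟦_⟧ QF.conj a)
    bounded-conj = E.bounded-hom QF.conj λ (x , y) → (x Z.+ p Z.* y , Z.- y) ,
      cong₂ _,_ (trans (ι.+-homo _ _) (cong (λ e → ι.⟦ x ⟧ + e) (ι.*-homo p y))) (ι-neg y)

  -- The sum of a and its conjugate is bounded in the extension and happens to be a scalar; a bound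
  -- for a scalar upstairs is one downstairs. The norm is treated likewise.
  bounded-trace : ∀ {a} → E.Bounded a → Bounded (QF.trace a)
  bounded-trace {a} h = bounded-scalar (subst E.Bounded (QF.+-conj a) (E.bounded-+ h (bounded-conj h)))

  bounded-norm : ∀ {a} → E.Bounded a → Bounded (QF.norm a)
  bounded-norm {a} h = bounded-scalar (subst E.Bounded (QF.*-conj a) (E.bounded-* h (bounded-conj h)))

  private
    P = ι.⟦ p ⟧
    N = ι.⟦ n ⟧

  open Solver F

  -- For a = u + v x, the difference of a and its conjugate is v (2 x - p). Its square is the trace
  -- squared minus four times the norm on the one hand, and v² (p² + 4 n) on the other.
  4norm-trace² : ∀ u v → fromℤ (+ 4) * QF.norm (u , v) + - (QF.trace (u , v) * QF.trace (u , v))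
               ≡ - (P * P + fromℤ (+ 4) * N) * (v * v)
  4norm-trace² u v = solve 4 (λ p n u v →
      con (+ 4) :* (u :* u :+ p :* (u :* v) :+ :- (n :* (v :* v))) :+ :- ((u :+ u :+ p :* v) :* (u :+ u :+ p :* v))
        := :- (p :* p :+ con (+ 4) :* n) :* (v :* v)) refl P N u v

  integral-discriminant : IntegrallyClosed → ∀ {u v} → E.Bounded (u , v) →
                          Integral (- (P * P + fromℤ (+ 4) * N) * (v * v))
  integral-discriminant closed {u} {v} h = subst Integral (4norm-trace² u v)
    (integral-+ (integral-* (integral-fromℤ (+ 4)) (closed _ (bounded-norm h)))
                (integral-neg (integral-* trace-integral trace-integral)))
    where
    trace-integral = closed _ (bounded-trace h)

  integrallyClosed : IntegrallyClosed → (∀ {u v} → E.Bounded (u , v) → Integral v) → E.IntegrallyClosed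
  integrallyClosed closed second (u , v) h =
    -- Once v is integral, the norm equation is a monic quadratic equation for u with integral
    -- coefficients.
    let (x , ιx) = closed u (bounded-quadratic-root
                     (integral-neg (integral-* (p , refl) v-integral))
                     (integral-+ (integral-* (n , refl) (integral-* v-integral v-integral)) (closed _ (bounded-norm h)))
                     (solve 4 (λ p n u v → u :* u := (:- (p :* v)) :* u :+ (n :* (v :* v) :+ (u :* u :+ p :* (u :* v) :+ :- (n :* (v :* v)))))
                       refl P N u v))
        (y , ιy) = v-integral
    in (x , y) , cong₂ _,_ ιx ιy
    where
    v-integral = second h

  -- Integrality of d v² makes (d v)² = d (d v²) integral, hence d v integral. Its square is
  -- divisible by d, so, Z/d having no nilpotents, d v is too, and v is integral.
  integrallyClosed-reduced : IntegrallyClosed → ∀ d → d ≢ + 0 → Z.- (p Z.* p Z.+ Z.fromℤ (+ 4) Z.* n) ≡ Z.fromℤ d →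
    (∀ x y → x Z.* x ≡ Z.fromℤ d Z.* y → Σ Z.Carrier λ z → x ≡ Z.fromℤ d Z.* z) → E.IntegrallyClosed
  integrallyClosed-reduced closed d d≢0 disc reduced = integrallyClosed closed second
    where
    open ≡-Reasoning

    discF : - (P * P + fromℤ (+ 4) * N) ≡ fromℤ d
    discF = begin
      - (P * P + fromℤ (+ 4) * N)                              ≡⟨ sym (cong -_ (cong₂ _+_ (ι.*-homo p p) (trans (ι.*-homo _ n) (cong (_* N) (ι-fromℤ (+ 4)))))) ⟩
      - (ι.⟦ p Z.* p ⟧ + ι.⟦ Z.fromℤ (+ 4) Z.* n ⟧)            ≡⟨ sym (trans (ι-neg _) (cong -_ (ι.+-homo _ _))) ⟩
      ι.⟦ Z.- (p Z.* p Z.+ Z.fromℤ (+ 4) Z.* n) ⟧              ≡⟨ trans (cong ι.⟦_⟧ disc) (ι-fromℤ d) ⟩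
      fromℤ d                                                  ∎

    square-of-multiple : ∀ v → fromℤ d * v * (fromℤ d * v) ≡ fromℤ d * (fromℤ d * (v * v))
    square-of-multiple = solve 2 (λ d v → d :* v :* (d :* v) := d :* (d :* (v :* v))) refl (fromℤ d)

    second : ∀ {u v} → E.Bounded (u , v) → Integral v
    second {u} {v} h =
      let (y , ιy) = subst Integral (cong (_* (v * v)) discF) (integral-discriminant closed h)
          (x , ιx) = closed (fromℤ d * v) (bounded-sqrt (subst Integral
                       (sym (square-of-multiple v)) (integral-* (integral-fromℤ d) (y , ιy))))
          (z , x≡) = reduced x y (ι-injective (begin
              ι.⟦ x Z.* x ⟧                     ≡⟨ ι.*-homo x x ⟩
              ι.⟦ x ⟧ * ι.⟦ x ⟧                 ≡⟨ cong₂ _*_ ιx ιx ⟩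
              fromℤ d * v * (fromℤ d * v)       ≡⟨ square-of-multiple v ⟩
              fromℤ d * (fromℤ d * (v * v))     ≡⟨ sym (cong₂ _*_ (ι-fromℤ d) ιy) ⟩
              ι.⟦ Z.fromℤ d ⟧ * ι.⟦ y ⟧         ≡⟨ sym (ι.*-homo (Z.fromℤ d) y) ⟩
              ι.⟦ Z.fromℤ d Z.* y ⟧             ∎))
      in z , cancel d d≢0 (begin
           fromℤ d * ι.⟦ z ⟧             ≡⟨ cong (_* ι.⟦ z ⟧) (sym (ι-fromℤ d)) ⟩
           ι.⟦ Z.fromℤ d ⟧ * ι.⟦ z ⟧     ≡⟨ sym (ι.*-homo (Z.fromℤ d) z) ⟩
           ι.⟦ Z.fromℤ d Z.* z ⟧         ≡⟨ cong ι.⟦_⟧ (sym x≡) ⟩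
           ι.⟦ x ⟧                       ≡⟨ ιx ⟩
           fromℤ d * v                   ∎)

-- ℤ, ℤ[i] and ℤ[i][ξ²] are integrally closed

ℤ-ring ℚ-ring : Ring
ℤ-ring = record { isCommutativeRing = ℤ.+-*-isCommutativeRing }
ℚ-ring = record { isCommutativeRing = ℚ.+-*-isCommutativeRing }

module ℤR = Ring ℤ-ring
module ℚR = Ring ℚ-ring

fromℤ-ℤ : ∀ i → ℤR.fromℤ i ≡ i
fromℤ-ℤ (+ n)    = fromℕ n
  where
  fromℕ : ∀ n → ℤR.fromℤ (+ n) ≡ + n
  fromℕ zero          = refl
  fromℕ (suc zero)    = refl
  fromℕ (suc (suc n)) = trans (cong (ℤ._+ + 1) (fromℕ (suc n))) (cong +_ (ℕ.+-comm (suc n) 1))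
fromℤ-ℤ -[1+ n ] = cong ℤ.-_ (fromℤ-ℤ (+ suc n))

ℤ→ℚ-hom : Hom ℤ-ring ℚ-ring
ℤ→ℚ-hom = record
  { ⟦_⟧    = ℤ→ℚ
  ; +-homo = λ i j → ℚ.toℚᵘ-injective (begin
      toℚᵘ (ℤ→ℚ (i ℤ.+ j))              ≈⟨ ℚ.toℚᵘ-fromℚᵘ (mkℚᵘ (i ℤ.+ j) 0) ⟩
      mkℚᵘ (i ℤ.+ j) 0                  ≈⟨ *≡* (cong (ℤ._* + 1) (sym (cong₂ ℤ._+_ (ℤ.*-identityʳ i) (ℤ.*-identityʳ j)))) ⟩
      mkℚᵘ i 0 ℚᵘ.+ mkℚᵘ j 0            ≈⟨ ℚᵘ.≃-sym (ℚᵘ.+-cong (ℚ.toℚᵘ-fromℚᵘ (mkℚᵘ i 0)) (ℚ.toℚᵘ-fromℚᵘ (mkℚᵘ j 0))) ⟩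
      toℚᵘ (ℤ→ℚ i) ℚᵘ.+ toℚᵘ (ℤ→ℚ j)    ≈⟨ ℚᵘ.≃-sym (ℚ.toℚᵘ-homo-+ (ℤ→ℚ i) (ℤ→ℚ j)) ⟩
      toℚᵘ (ℤ→ℚ i ℚ.+ ℤ→ℚ j)            ∎)
  ; *-homo = λ i j → ℚ.toℚᵘ-injective (begin
      toℚᵘ (ℤ→ℚ (i ℤ.* j))              ≈⟨ ℚ.toℚᵘ-fromℚᵘ (mkℚᵘ (i ℤ.* j) 0) ⟩
      mkℚᵘ i 0 ℚᵘ.* mkℚᵘ j 0            ≈⟨ ℚᵘ.≃-sym (ℚᵘ.*-cong (ℚ.toℚᵘ-fromℚᵘ (mkℚᵘ i 0)) (ℚ.toℚᵘ-fromℚᵘ (mkℚᵘ j 0))) ⟩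
      toℚᵘ (ℤ→ℚ i) ℚᵘ.* toℚᵘ (ℤ→ℚ j)    ≈⟨ ℚᵘ.≃-sym (ℚ.toℚᵘ-homo-* (ℤ→ℚ i) (ℤ→ℚ j)) ⟩
      toℚᵘ (ℤ→ℚ i ℚ.* ℤ→ℚ j)            ∎)
  ; 1-homo = refl
  }
  where open ℚᵘ.≃-Reasoning

ℤ→ℚ-injective : ∀ {i j} → ℤ→ℚ i ≡ ℤ→ℚ j → i ≡ j
ℤ→ℚ-injective {i} {j} eq with ℚ.fromℚᵘ-injective {mkℚᵘ i 0} {mkℚᵘ j 0} eq
... | *≡* eq′ = trans (sym (ℤ.*-identityʳ i)) (trans eq′ (ℤ.*-identityʳ j))

fromℤ-ℚ : ∀ i → ℚR.fromℤ i ≡ ℤ→ℚ i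
fromℤ-ℚ i = trans (sym (HomProperties.fromℤ-homo ℤ→ℚ-hom i)) (cong ℤ→ℚ (fromℤ-ℤ i))

↧*≡↥ : ∀ a → ℤ→ℚ (+ ↧ₙ a) ℚ.* a ≡ ℤ→ℚ (↥ a)
↧*≡↥ a@(mkℚ n d-1 _) = ℚ.toℚᵘ-injective (begin
  toℚᵘ (ℤ→ℚ (+ suc d-1) ℚ.* a)             ≈⟨ ℚ.toℚᵘ-homo-* (ℤ→ℚ (+ suc d-1)) a ⟩
  toℚᵘ (ℤ→ℚ (+ suc d-1)) ℚᵘ.* mkℚᵘ n d-1   ≈⟨ ℚᵘ.*-congʳ (ℚ.toℚᵘ-fromℚᵘ (mkℚᵘ (+ suc d-1) 0)) ⟩
  mkℚᵘ (+ suc d-1) 0 ℚᵘ.* mkℚᵘ n d-1       ≈⟨ *≡* (trans (ℤ.*-identityʳ _) (trans (ℤ.*-comm (+ suc d-1) n) (cong (λ m → n ℤ.* + m) (sym (ℕ.*-identityˡ (suc d-1)))))) ⟩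
  mkℚᵘ n 0                                 ≈⟨ ℚᵘ.≃-sym (ℚ.toℚᵘ-fromℚᵘ (mkℚᵘ n 0)) ⟩
  toℚᵘ (ℤ→ℚ n)                             ∎)
  where open ℚᵘ.≃-Reasoning

↥-↧-coprime : ∀ a → Coprime ℤ.∣ ↥ a ∣ (↧ₙ a)
↥-↧-coprime (mkℚ _ _ c) = Coprimality.recompute c

ℤ→ℚ-torsionFree : ∀ d a → d ≢ + 0 → ℤ→ℚ d ℚ.* a ≡ ℚ.0ℚ → a ≡ ℚ.0ℚ
ℤ→ℚ-torsionFree d a d≢0 eq = begin
  a                          ≡⟨ sym (ℚ.*-identityˡ a) ⟩
  ℚ.1ℚ ℚ.* a                 ≡⟨ cong (ℚ._* a) (sym (ℚ.*-inverseˡ (ℤ→ℚ d))) ⟩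
  ℚ.1/ ℤ→ℚ d ℚ.* ℤ→ℚ d ℚ.* a  ≡⟨ ℚ.*-assoc (ℚ.1/ ℤ→ℚ d) (ℤ→ℚ d) a ⟩
  ℚ.1/ ℤ→ℚ d ℚ.* (ℤ→ℚ d ℚ.* a) ≡⟨ cong (ℚ.1/ ℤ→ℚ d ℚ.*_) eq ⟩
  ℚ.1/ ℤ→ℚ d ℚ.* ℚ.0ℚ        ≡⟨ ℚ.*-zeroʳ (ℚ.1/ ℤ→ℚ d) ⟩
  ℚ.0ℚ                       ∎
  where
  open ≡-Reasoning
  instance
    d-nonZero : ℚ.NonZero (ℤ→ℚ d)
    d-nonZero = ℚ.≢-nonZero (d≢0 ∘ ℤ→ℚ-injective {d} {+ 0})

ℤ-order : Order
ℤ-order = record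
  { F = ℚ-ring
  ; Z = ℤ-ring
  ; ι = ℤ→ℚ-hom
  ; ι-injective = ℤ→ℚ-injective
  ; denominator = λ a → + ↧ₙ a , (λ ()) , ↥ a , trans (sym (↧*≡↥ a)) (cong (ℚ._* a) (sym (fromℤ-ℚ (+ ↧ₙ a))))
  ; torsionFree = λ d a d≢0 eq → ℤ→ℚ-torsionFree d a d≢0 (trans (cong (ℚ._* a) (sym (fromℤ-ℚ d))) eq)
  }

coprime-* : ∀ {a b c} → Coprime a b → Coprime a c → Coprime a (b ℕ.* c)
coprime-* ab ac (d∣a , d∣bc) = ac (d∣a , coprime-divisor (λ (e∣d , e∣b) → ab (ℕ∣.∣-trans e∣d d∣a , e∣b)) d∣bc)

coprime-^ʳ : ∀ {a b} n → Coprime a b → Coprime a (b ℕ.^ n)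
coprime-^ʳ zero    ab (_ , d∣1) = ℕ∣.∣1⇒≡1 d∣1
coprime-^ʳ (suc n) ab = coprime-* ab (coprime-^ʳ n ab)

coprime-^ : ∀ {a b} m n → Coprime a b → Coprime (a ℕ.^ m) (b ℕ.^ n)
coprime-^ m n ab = coprime-^ʳ n (Coprimality.sym (coprime-^ʳ m (Coprimality.sym ab)))

n<2^n : ∀ n → n ℕ.< 2 ℕ.^ n
n<2^n zero    = ℕ.s≤s ℕ.z≤n
n<2^n (suc n) = ℕ.<-≤-trans (ℕ.s<s (n<2^n n))
  (ℕ.≤-trans (ℕ.+-monoˡ-≤ (2 ℕ.^ n) (ℕ.m^n>0 2 n)) (ℕ.≤-reflexive (cong (2 ℕ.^ n ℕ.+_) (sym (ℕ.+-identityʳ _)))))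

∣^∣ : ∀ i n → ℤ.∣ i ℤR.^ n ∣ ≡ ℤ.∣ i ∣ ℕ.^ n
∣^∣ i zero    = refl
∣^∣ i (suc n) = trans (ℤ.abs-* i _) (cong (ℤ.∣ i ∣ ℕ.*_) (∣^∣ i n))

^-distrib-* : ∀ (R : Ring) → let open Ring R in ∀ a b n → (a * b) ^ n ≡ a ^ n * b ^ n
^-distrib-* R a b zero    = sym (Ring.*-identityˡ R _)
^-distrib-* R a b (suc n) = trans (cong (a * b *_) (^-distrib-* R a b n))
  (solve 4 (λ a b x y → a :* b :* (x :* y) := a :* x :* (b :* y)) refl a b (a ^ n) (b ^ n))
  where
  open Ring R
  open Solver R

-- For a = p/q in lowest terms, integrality of d aᵐ gives qᵐ ∣ d for every m. At m = |d| this
-- contradicts n < 2ⁿ unless q = 1.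
ℤ-integrallyClosed : Order.IntegrallyClosed ℤ-order
ℤ-integrallyClosed a (d , d≢0 , h) = ↥ a , (begin
  ℤ→ℚ (↥ a)                ≡⟨ sym (↧*≡↥ a) ⟩
  ℤ→ℚ (+ ↧ₙ a) ℚ.* a       ≡⟨ cong (λ m → ℤ→ℚ (+ m) ℚ.* a) (q≡1 q refl) ⟩
  ℤ→ℚ (+ 1) ℚ.* a          ≡⟨ ℚ.*-identityˡ a ⟩
  a                        ∎)
  where
  open ≡-Reasoning
  p = ↥ a
  q = ↧ₙ a

  powers : ∀ m → d ℤ.* p ℤR.^ m ≡ (+ q) ℤR.^ m ℤ.* proj₁ (h m)
  powers m = ℤ→ℚ-injective {d ℤ.* p ℤR.^ m} {(+ q) ℤR.^ m ℤ.* proj₁ (h m)} (begin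
    ι.⟦ d ℤ.* p ℤR.^ m ⟧                          ≡⟨ ι.*-homo d (p ℤR.^ m) ⟩
    ι.⟦ d ⟧ ℚ.* ι.⟦ p ℤR.^ m ⟧                    ≡⟨ cong₂ ℚ._*_ (sym (fromℤ-ℚ d)) (^-homo ℤ→ℚ-hom p m) ⟩
    ℚR.fromℤ d ℚ.* ι.⟦ p ⟧ ℚR.^ m                 ≡⟨ cong (λ x → ℚR.fromℤ d ℚ.* x ℚR.^ m) (sym (↧*≡↥ a)) ⟩
    ℚR.fromℤ d ℚ.* (ι.⟦ + q ⟧ ℚ.* a) ℚR.^ m       ≡⟨ cong (ℚR.fromℤ d ℚ.*_) (^-distrib-* ℚ-ring ι.⟦ + q ⟧ a m) ⟩
    ℚR.fromℤ d ℚ.* (ι.⟦ + q ⟧ ℚR.^ m ℚ.* a ℚR.^ m)  ≡⟨ swap (ℚR.fromℤ d) (ι.⟦ + q ⟧ ℚR.^ m) (a ℚR.^ m) ⟩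
    ι.⟦ + q ⟧ ℚR.^ m ℚ.* (ℚR.fromℤ d ℚ.* a ℚR.^ m)  ≡⟨ cong₂ ℚ._*_ (sym (^-homo ℤ→ℚ-hom (+ q) m)) (sym (proj₂ (h m))) ⟩
    ι.⟦ (+ q) ℤR.^ m ⟧ ℚ.* ι.⟦ proj₁ (h m) ⟧      ≡⟨ sym (ι.*-homo ((+ q) ℤR.^ m) (proj₁ (h m))) ⟩
    ι.⟦ (+ q) ℤR.^ m ℤ.* proj₁ (h m) ⟧            ∎)
    where
    module ι = Hom ℤ→ℚ-hom
    open import Algebra.Properties.CommutativeSemigroup (CommutativeRing.*-commutativeSemigroup ℚ.+-*-commutativeRing)
      using () renaming (x∙yz≈y∙xz to swap)

  q^m∣d : ∀ m → q ℕ.^ m ∣ ℤ.∣ d ∣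
  q^m∣d m = coprime-divisor {n = ℤ.∣ p ∣ ℕ.^ m} (coprime-^ m m (Coprimality.sym (↥-↧-coprime a)))
    (divides ℤ.∣ proj₁ (h m) ∣ (begin
      ℤ.∣ p ∣ ℕ.^ m ℕ.* ℤ.∣ d ∣              ≡⟨ ℕ.*-comm (ℤ.∣ p ∣ ℕ.^ m) ℤ.∣ d ∣ ⟩
      ℤ.∣ d ∣ ℕ.* ℤ.∣ p ∣ ℕ.^ m              ≡⟨ cong (ℤ.∣ d ∣ ℕ.*_) (sym (∣^∣ p m)) ⟩
      ℤ.∣ d ∣ ℕ.* ℤ.∣ p ℤR.^ m ∣             ≡⟨ sym (ℤ.abs-* d (p ℤR.^ m)) ⟩
      ℤ.∣ d ℤ.* p ℤR.^ m ∣                   ≡⟨ cong ℤ.∣_∣ (powers m) ⟩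
      ℤ.∣ (+ q) ℤR.^ m ℤ.* proj₁ (h m) ∣     ≡⟨ ℤ.abs-* ((+ q) ℤR.^ m) (proj₁ (h m)) ⟩
      ℤ.∣ (+ q) ℤR.^ m ∣ ℕ.* ℤ.∣ proj₁ (h m) ∣  ≡⟨ cong (ℕ._* ℤ.∣ proj₁ (h m) ∣) (∣^∣ (+ q) m) ⟩
      q ℕ.^ m ℕ.* ℤ.∣ proj₁ (h m) ∣          ≡⟨ ℕ.*-comm (q ℕ.^ m) ℤ.∣ proj₁ (h m) ∣ ⟩
      ℤ.∣ proj₁ (h m) ∣ ℕ.* q ℕ.^ m          ∎))

  -- The case distinction is on a variable r equal to q, since q itself is a projection of a.
  q≡1 : ∀ r → r ≡ q → r ≡ 1
  q≡1 zero          ()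
  q≡1 (suc zero)    _ = refl
  q≡1 (suc (suc r)) r≡q = ⊥-elim (ℕ.<-irrefl refl (ℕ.<-≤-trans (n<2^n ℤ.∣ d ∣)
    (ℕ.≤-trans (ℕ.^-monoˡ-≤ ℤ.∣ d ∣ (ℕ.s≤s (ℕ.s≤s ℕ.z≤n)))
      (ℕ∣.∣⇒≤ {{ℕ.≢-nonZero (d≢0 ∘ ℤ.∣i∣≡0⇒i≡0)}} (subst (λ r → r ℕ.^ ℤ.∣ d ∣ ∣ ℤ.∣ d ∣) (sym r≡q) (q^m∣d ℤ.∣ d ∣))))))

module _ (R : Ring) where
  open Ring R
  open Solver R

  gaussianMul : Carrier × Carrier → Carrier × Carrier → Carrier × Carrier
  gaussianMul (a , b) (c , d) = a * c - b * d , a * d + b * c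

  gaussianMul-correct : ∀ x y → gaussianMul x y ≡ quadMul R 0# (- 1#) x y
  gaussianMul-correct (a , b) (c , d) = cong₂ _,_
    (solve 4 (λ a b c d → a :* c :- b :* d := a :* c :+ :- con (+ 1) :* (b :* d)) refl a b c d)
    (solve 4 (λ a b c d → a :* d :+ b :* c := a :* d :+ b :* c :+ con (+ 0) :* (b :* d)) refl a b c d)

module GZ-Quadratic = QuadraticOrder ℤ-order (+ 0) -[1+ 0 ]
  _*q_ (gaussianMul-correct ℚ-ring) _*ᶻ_ (gaussianMul-correct ℤ-ring)

GZ-order : Order
GZ-order = GZ-Quadratic.order

module ZM = Order GZ-order

GZ-ring : Ring
GZ-ring = ZM.Z

fromℤ-hom : (R : Ring) → Hom ℤ-ring R
fromℤ-hom R = record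
  { ⟦_⟧    = Ring.fromℤ R
  ; +-homo = morphism.+-homo
  ; *-homo = morphism.*-homo
  ; 1-homo = refl
  }
  where
  open import Algebra.Solver.Ring.AlmostCommutativeRing
  module morphism = _-Raw-AlmostCommutative⟶_ (fromℤ-morphism R)

-- The field with two elements; the unique homomorphism from ℤ into it is the parity.
Bool-ring : Ring
Bool-ring = record { isCommutativeRing = CommutativeRing.isCommutativeRing Bool.xor-∧-commutativeRing }

module Parity = Hom (fromℤ-hom Bool-ring)

odd? : ℤ → Bool
odd? = Parity.⟦_⟧

half : ∀ i → (odd? i ≡ false × Σ ℤ λ k → i ≡ + 2 ℤ.* k) ⊎ (odd? i ≡ true × Σ ℤ λ k → i ≡ + 1 ℤ.+ + 2 ℤ.* k)
half i with i ℤ.%ℕ 2 | ℤ.n%ℕd<d i 2 | ℤ.a≡a%ℕn+[a/ℕn]*n i 2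
... | 0 | _ | eq = inj₁ (trans (cong odd? eq′) (Parity.*-homo (+ 2) k) , k , eq′)
  where
  k = i ℤ./ℕ 2
  eq′ : i ≡ + 2 ℤ.* k
  eq′ = trans eq (trans (ℤ.+-identityˡ _) (ℤ.*-comm k (+ 2)))
... | 1 | _ | eq = inj₂ (trans (cong odd? eq′) (trans (Parity.+-homo (+ 1) (+ 2 ℤ.* k)) (cong (true xor_) (Parity.*-homo (+ 2) k))) , k , eq′)
  where
  k = i ℤ./ℕ 2
  eq′ : i ≡ + 1 ℤ.+ + 2 ℤ.* k
  eq′ = trans eq (cong (λ e → + 1 ℤ.+ e) (ℤ.*-comm k (+ 2)))
... | suc (suc _) | ℕ.s≤s (ℕ.s≤s ()) | _

true≢false : true ≢ false
true≢false ()

odd?-double : ∀ k → odd? (+ 2 ℤ.* k) ≡ false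
odd?-double k = Parity.*-homo (+ 2) k

-- A sum of two odd squares is 2 modulo 4.
sum-of-squares≡0[4] : ∀ a b n → a ℤ.* a ℤ.+ b ℤ.* b ≡ + 4 ℤ.* n → Σ ℤ λ k → b ≡ + 2 ℤ.* k
sum-of-squares≡0[4] a b n eq with half b
... | inj₁ (_ , b-even) = b-even
... | inj₂ (b-odd , l , b≡) with half a
... | inj₁ (a-even , _) = ⊥-elim (true≢false (trans (sym parity-lhs) (trans (cong odd? eq) (Parity.*-homo (+ 4) n))))
  where
  parity-lhs : odd? (a ℤ.* a ℤ.+ b ℤ.* b) ≡ true
  parity-lhs = trans (Parity.+-homo (a ℤ.* a) (b ℤ.* b))
    (cong₂ _xor_ (trans (Parity.*-homo a a) (cong₂ _∧_ a-even a-even)) (trans (Parity.*-homo b b) (cong₂ _∧_ b-odd b-odd)))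
... | inj₂ (_ , k , a≡) = ⊥-elim (true≢false (trans (sym parity-lhs) (trans (cong odd? halved) (odd?-double n))))
  where
  m = k ℤ.* k ℤ.+ k ℤ.+ l ℤ.* l ℤ.+ l
  expand : ∀ R → let open Ring R in ∀ k l →
    (1# + fromℤ (+ 2) * k) * (1# + fromℤ (+ 2) * k) + (1# + fromℤ (+ 2) * l) * (1# + fromℤ (+ 2) * l)
      ≡ fromℤ (+ 2) * (1# + fromℤ (+ 2) * (k * k + k + l * l + l))
  expand R = solve 2 (λ k l → (con (+ 1) :+ con (+ 2) :* k) :* (con (+ 1) :+ con (+ 2) :* k) :+ (con (+ 1) :+ con (+ 2) :* l) :* (con (+ 1) :+ con (+ 2) :* l)
      := con (+ 2) :* (con (+ 1) :+ con (+ 2) :* (k :* k :+ k :+ l :* l :+ l))) refl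
    where open Solver R
  halved : + 1 ℤ.+ + 2 ℤ.* m ≡ + 2 ℤ.* n
  halved = ℤ.*-cancelˡ-≡ (+ 2) _ _ (begin
    + 2 ℤ.* (+ 1 ℤ.+ + 2 ℤ.* m)      ≡⟨ sym (expand ℤ-ring k l) ⟩
    _                                ≡⟨ sym (cong₂ (λ a b → a ℤ.* a ℤ.+ b ℤ.* b) a≡ b≡) ⟩
    a ℤ.* a ℤ.+ b ℤ.* b              ≡⟨ eq ⟩
    + 4 ℤ.* n                        ≡⟨ ℤ.*-assoc (+ 2) (+ 2) n ⟩
    + 2 ℤ.* (+ 2 ℤ.* n)              ∎)
    where open ≡-Reasoning
  parity-lhs : odd? (+ 1 ℤ.+ + 2 ℤ.* m) ≡ true
  parity-lhs = trans (Parity.+-homo (+ 1) (+ 2 ℤ.* m)) (cong (true xor_) (odd?-double m))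

private
  gaussian-discriminant : ∀ R → let open Ring R in ∀ v →
    - (0# * 0# + fromℤ (+ 4) * - 1#) * (v * v) ≡ fromℤ (+ 2) * v * (fromℤ (+ 2) * v)
  gaussian-discriminant R = solve 1 (λ v →
      :- (con (+ 0) :* con (+ 0) :+ con (+ 4) :* :- con (+ 1)) :* (v :* v)
        := con (+ 2) :* v :* (con (+ 2) :* v)) refl
    where open Solver R

-- The discriminant -4 is not squarefree, so parity does the work: T = 2 u and w = 2 v are integers
-- with T² + w² = 4 (u² + v²) divisible by 4, which forces w to be even.
GZ-integrallyClosed : ZM.IntegrallyClosed
GZ-integrallyClosed = GZ-Quadratic.integrallyClosed ℤ-integrallyClosed second
  where
  open Order ℤ-order
  open GZ-Quadratic using (module QF)
  open Ring ℚ-ring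

  second : ∀ {u v} → ZM.Bounded (u , v) → Integral v
  second {u} {v} h =
    let (T , ιT) = ℤ-integrallyClosed _ (GZ-Quadratic.bounded-trace h)
        (N , ιN) = ℤ-integrallyClosed _ (GZ-Quadratic.bounded-norm h)
        (w , ιw) = ℤ-integrallyClosed (fromℤ (+ 2) * v) (bounded-sqrt (subst Integral (double v)
                     (GZ-Quadratic.integral-discriminant ℤ-integrallyClosed {u} {v} h)))
        eq : T ℤ.* T ℤ.+ w ℤ.* w ≡ + 4 ℤ.* N
        eq = ι-injective (begin
          ι.⟦ T ℤ.* T ℤ.+ w ℤ.* w ⟧                  ≡⟨ ι.+-homo (T ℤ.* T) (w ℤ.* w) ⟩
          ι.⟦ T ℤ.* T ⟧ + ι.⟦ w ℤ.* w ⟧              ≡⟨ cong₂ _+_ (ι.*-homo T T) (ι.*-homo w w) ⟩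
          ι.⟦ T ⟧ * ι.⟦ T ⟧ + ι.⟦ w ⟧ * ι.⟦ w ⟧      ≡⟨ cong₂ _+_ (cong₂ _*_ ιT ιT) (cong₂ _*_ ιw ιw) ⟩
          _                                          ≡⟨ cong (λ e → QF.trace (u , v) * QF.trace (u , v) + e) (trans (sym (double v)) (sym (GZ-Quadratic.4norm-trace² u v))) ⟩
          _                                          ≡⟨ rearrange (QF.trace (u , v) * QF.trace (u , v)) (fromℤ (+ 4) * QF.norm (u , v)) ⟩
          fromℤ (+ 4) * QF.norm (u , v)              ≡⟨ sym (cong₂ _*_ (fromℤ-ℚ (+ 4)) ιN) ⟩
          ι.⟦ + 4 ⟧ * ι.⟦ N ⟧                        ≡⟨ sym (ι.*-homo (+ 4) N) ⟩
          ι.⟦ + 4 ℤ.* N ⟧                            ∎)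
        (k , w≡2k) = sum-of-squares≡0[4] T w N eq
    in k , cancel (+ 2) (λ ()) (trans (cong (_* ι.⟦ k ⟧) (fromℤ-ℚ (+ 2)))
         (trans (sym (ι.*-homo (+ 2) k)) (trans (cong ι.⟦_⟧ (sym w≡2k)) ιw)))
    where
    open ≡-Reasoning
    double : ∀ v → - (ι.⟦ + 0 ⟧ * ι.⟦ + 0 ⟧ + fromℤ (+ 4) * ι.⟦ -[1+ 0 ] ⟧) * (v * v) ≡ fromℤ (+ 2) * v * (fromℤ (+ 2) * v)
    double = gaussian-discriminant ℚ-ring
    rearrange : ∀ x y → x + (y + - x) ≡ y
    rearrange x y = trans (cong (λ e → x + e) (+-comm y (- x))) (trans (sym (+-assoc x (- x) y))
      (trans (cong (_+ y) (-‿inverseʳ x)) (+-identityˡ y)))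

-- Let g = gcd(d, n) and e = d/g. Since e is coprime to n/g, it follows from e g ∣ n² first that e ∣
-- n and then that e ∣ g. So e² ∣ d and e = 1, without factoring into primes.
squareFree-∣ : ∀ {d n} .{{_ : ℕ.NonZero d}} → SquareFree d → d ∣ n ℕ.* n → d ∣ n
squareFree-∣ {d} {n} sf d∣n² = ℕ∣.∣-trans (ℕ∣.∣-reflexive d≡g) (ℕ.gcd[m,n]∣n d n)
  where
  open ≡-Reasoning
  g = ℕ.gcd d n
  instance
    g≢0 : ℕ.NonZero g
    g≢0 = ℕ.≢-nonZero (ℕ.gcd[m,n]≢0 d n (inj₁ (ℕ.≢-nonZero⁻¹ d)))
  e = d ℕ./ g
  f = n ℕ./ g
  d≡ : d ≡ e ℕ.* g
  d≡ = sym (ℕ.m/n*n≡m (ℕ.gcd[m,n]∣m d n))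
  n≡ : n ≡ f ℕ.* g
  n≡ = sym (ℕ.m/n*n≡m (ℕ.gcd[m,n]∣n d n))
  e⊥f : Coprime e f
  e⊥f = Coprimality.coprime-/gcd d n
  e∣f*n : e ∣ f ℕ.* n
  e∣f*n = ℕ∣.*-cancelʳ-∣ g (subst₂ _∣_ d≡ (begin
    n ℕ.* n           ≡⟨ cong (ℕ._* n) n≡ ⟩
    f ℕ.* g ℕ.* n     ≡⟨ ℕ.*-assoc f g n ⟩
    f ℕ.* (g ℕ.* n)   ≡⟨ cong (f ℕ.*_) (ℕ.*-comm g n) ⟩
    f ℕ.* (n ℕ.* g)   ≡⟨ sym (ℕ.*-assoc f n g) ⟩
    f ℕ.* n ℕ.* g     ∎) d∣n²)
  e∣g : e ∣ g
  e∣g = coprime-divisor e⊥f (subst (e ∣_) n≡ (coprime-divisor e⊥f e∣f*n))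
  e≡1 : e ≡ 1
  e≡1 = sf e (subst (e ℕ.* e ∣_) (sym d≡) (ℕ∣.*-monoʳ-∣ e e∣g))
  d≡g : d ≡ g
  d≡g = trans d≡ (trans (cong (ℕ._* g) e≡1) (ℕ.*-identityˡ g))

squareFree-∣ℤ : ∀ {d} .{{_ : ℕ.NonZero d}} → SquareFree d → ∀ a k → a ℤ.* a ≡ + d ℤ.* k → Σ ℤ λ j → a ≡ + d ℤ.* j
squareFree-∣ℤ {d} sf a k eq with ℤ∣.∣ᵤ⇒∣ {+ d} {a} (squareFree-∣ sf (divides ℤ.∣ k ∣ (begin
    ℤ.∣ a ∣ ℕ.* ℤ.∣ a ∣   ≡⟨ sym (ℤ.abs-* a a) ⟩
    ℤ.∣ a ℤ.* a ∣         ≡⟨ cong ℤ.∣_∣ eq ⟩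
    ℤ.∣ + d ℤ.* k ∣       ≡⟨ ℤ.abs-* (+ d) k ⟩
    d ℕ.* ℤ.∣ k ∣         ≡⟨ ℕ.*-comm d ℤ.∣ k ∣ ⟩
    ℤ.∣ k ∣ ℕ.* d         ∎)))
  where open ≡-Reasoning
... | ℤ∣.divides j a≡ = j , trans a≡ (ℤ.*-comm j (+ d))

module _ (R : Ring) where
  open Ring R
  open Solver R

  norm²-identity : ∀ a b → (a * a + b * b) * (a * a + b * b)
    ≡ (a * a - b * b) * (a * a - b * b) + (a * b + b * a) * (a * b + b * a)
  norm²-identity = solve 2 (λ a b → (a :* a :+ b :* b) :* (a :* a :+ b :* b)
    := (a :* a :- b :* b) :* (a :* a :- b :* b) :+ (a :* b :+ b :* a) :* (a :* b :+ b :* a)) refl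

  sum-of-multiples : ∀ d m n → d * m * (d * m) + d * n * (d * n) ≡ d * (d * m * m + d * n * n)
  sum-of-multiples = solve 3 (λ d m n → d :* m :* (d :* m) :+ d :* n :* (d :* n) := d :* (d :* m :* m :+ d :* n :* n)) refl

  -- a² = d a² − e (2 a²) for d = 1 + 2 e, and 2 a² = (a² + b²) + (a² − b²).
  halve-multipleˡ : ∀ a b e l m → a * a + b * b ≡ (1# + fromℤ (+ 2) * e) * l → a * a - b * b ≡ (1# + fromℤ (+ 2) * e) * m →
    a * a ≡ (1# + fromℤ (+ 2) * e) * (a * a - e * (l + m))
  halve-multipleˡ a b e l m h₊ h₋ = trans
    (solve 3 (λ a b e → a :* a := (con (+ 1) :+ con (+ 2) :* e) :* (a :* a) :- e :* ((a :* a :+ b :* b) :+ (a :* a :- b :* b))) refl a b e)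
    (trans (cong₂ (λ x y → (1# + fromℤ (+ 2) * e) * (a * a) - e * (x + y)) h₊ h₋)
    (solve 4 (λ x e l m → (con (+ 1) :+ con (+ 2) :* e) :* x :- e :* ((con (+ 1) :+ con (+ 2) :* e) :* l :+ (con (+ 1) :+ con (+ 2) :* e) :* m)
      := (con (+ 1) :+ con (+ 2) :* e) :* (x :- e :* (l :+ m))) refl (a * a) e l m))

  halve-multipleʳ : ∀ a b e l m → a * a + b * b ≡ (1# + fromℤ (+ 2) * e) * l → a * a - b * b ≡ (1# + fromℤ (+ 2) * e) * m →
    b * b ≡ (1# + fromℤ (+ 2) * e) * (b * b - e * (l - m))
  halve-multipleʳ a b e l m h₊ h₋ = trans
    (solve 3 (λ a b e → b :* b := (con (+ 1) :+ con (+ 2) :* e) :* (b :* b) :- e :* ((a :* a :+ b :* b) :- (a :* a :- b :* b))) refl a b e)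
    (trans (cong₂ (λ x y → (1# + fromℤ (+ 2) * e) * (b * b) - e * (x - y)) h₊ h₋)
    (solve 4 (λ x e l m → (con (+ 1) :+ con (+ 2) :* e) :* x :- e :* ((con (+ 1) :+ con (+ 2) :* e) :* l :- (con (+ 1) :+ con (+ 2) :* e) :* m)
      := (con (+ 1) :+ con (+ 2) :* e) :* (x :- e :* (l :- m))) refl (b * b) e l m))

-- The square of the norm of ω is the norm of ω², so an odd squarefree d dividing ω² divides a² + b² and a² − b².
squareFree-∣GZ : ∀ {d} .{{_ : ℕ.NonZero d}} → SquareFree d → (Σ ℤ λ e → + d ≡ + 1 ℤ.+ + 2 ℤ.* e) →
  ∀ ω μ → ω *ᶻ ω ≡ ZM.Z.fromℤ (+ d) *ᶻ μ → Σ GZ λ κ → ω ≡ ZM.Z.fromℤ (+ d) *ᶻ κ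
squareFree-∣GZ {d} sf (e , d≡) (a , b) (m , n) eq =
  let (l , ∣ω∣²≡) = squareFree-∣ℤ sf (a ℤ.* a ℤ.+ b ℤ.* b) (+ d ℤ.* m ℤ.* m ℤ.+ + d ℤ.* n ℤ.* n)
        (trans (norm²-identity ℤ-ring a b) (trans (cong₂ (λ x y → x ℤ.* x ℤ.+ y ℤ.* y) re≡ im≡) (sum-of-multiples ℤ-ring (+ d) m n)))
      (a′ , a≡) = squareFree-∣ℤ sf a (a ℤ.* a ℤ.- e ℤ.* (l ℤ.+ m))
        (odd-multiple (halve-multipleˡ ℤ-ring a b e l m (multiple-odd ∣ω∣²≡) (multiple-odd re≡)))
      (b′ , b≡) = squareFree-∣ℤ sf b (b ℤ.* b ℤ.- e ℤ.* (l ℤ.- m))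
        (odd-multiple (halve-multipleʳ ℤ-ring a b e l m (multiple-odd ∣ω∣²≡) (multiple-odd re≡)))
  in (a′ , b′) , trans (cong₂ _,_ a≡ b≡) (sym (fromℤ-d* a′ b′))
  where
  fromℤ-d* : ∀ m n → ZM.Z.fromℤ (+ d) *ᶻ (m , n) ≡ (+ d ℤ.* m , + d ℤ.* n)
  fromℤ-d* m n = trans (GZ-Quadratic.QZ.fromℤ-quad-* (+ d) m n) (cong (λ x → x ℤ.* m , x ℤ.* n) (fromℤ-ℤ (+ d)))
  re≡ : a ℤ.* a ℤ.- b ℤ.* b ≡ + d ℤ.* m
  re≡ = cong proj₁ (trans eq (fromℤ-d* m n))
  im≡ : a ℤ.* b ℤ.+ b ℤ.* a ≡ + d ℤ.* n
  im≡ = cong proj₂ (trans eq (fromℤ-d* m n))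
  multiple-odd : ∀ {x y} → x ≡ + d ℤ.* y → x ≡ (+ 1 ℤ.+ + 2 ℤ.* e) ℤ.* y
  multiple-odd {x} {y} h = trans h (cong (ℤ._* y) d≡)
  odd-multiple : ∀ {x y} → x ≡ (+ 1 ℤ.+ + 2 ℤ.* e) ℤ.* y → x ≡ + d ℤ.* y
  odd-multiple {x} {y} h = trans h (cong (ℤ._* y) (sym d≡))

itᶻ : ℕ → GZ
itᶻ t = + 0 , + t

-- ℤ[i][θ] for θ = ξ², by the relation θ² = i t θ - 1.
module ZL-Quadratic (t : ℕ) = QuadraticOrder GZ-order (itᶻ t) (-ᶻ 1ᶻ)
  (quadMul (Order.F GZ-order) (GZ→GQ (itᶻ t)) (GZ→GQ (-ᶻ 1ᶻ))) (λ _ _ → refl)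
  (quadMul GZ-ring (itᶻ t) (-ᶻ 1ᶻ)) (λ _ _ → refl)

ZL-order : ℕ → Order
ZL-order t = ZL-Quadratic.order t

module _ (R : Ring) where
  open Ring R
  open Solver R

  it-discriminant : ∀ i t → i * i ≡ - 1# → - (t * i * (t * i) + fromℤ (+ 4) * - 1#) ≡ t * t + fromℤ (+ 4)
  it-discriminant i t i² = trans
    (solve 2 (λ i t → :- (t :* i :* (t :* i) :+ con (+ 4) :* :- con (+ 1)) := :- (t :* t :* (i :* i)) :+ con (+ 4)) refl i t)
    (trans (cong (λ x → - (t * t * x) + fromℤ (+ 4)) i²)
      (solve 1 (λ t → :- (t :* t :* :- con (+ 1)) :+ con (+ 4) := t :* t :+ con (+ 4)) refl t))

module _ where
  open ZM.Z using (_+_; _*_; -_; 1#; fromℤ)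

  it-multiple : ∀ t → itᶻ t ≡ fromℤ (+ t) * iᶻ
  it-multiple t = sym (trans (GZ-Quadratic.QZ.fromℤ-quad-* (+ t) (+ 0) (+ 1))
    (cong₂ _,_ (ℤ.*-zeroʳ (ℤR.fromℤ (+ t))) (trans (ℤ.*-identityʳ _) (fromℤ-ℤ (+ t)))))

  itᶻ-discriminant : ∀ t → - (itᶻ t * itᶻ t + fromℤ (+ 4) * - 1#) ≡ fromℤ (+ (t ℕ.* t ℕ.+ 4))
  itᶻ-discriminant t = begin
    - (itᶻ t * itᶻ t + fromℤ (+ 4) * - 1#)   ≡⟨ cong (λ c → - (c * c + fromℤ (+ 4) * - 1#)) (it-multiple t) ⟩
    _                                        ≡⟨ it-discriminant GZ-ring iᶻ (fromℤ (+ t)) refl ⟩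
    fromℤ (+ t) * fromℤ (+ t) + fromℤ (+ 4)  ≡⟨ cong (_+ fromℤ (+ 4)) (sym (fromℤ-* GZ-ring (+ t) (+ t))) ⟩
    fromℤ (+ t ℤ.* + t) + fromℤ (+ 4)        ≡⟨ sym (fromℤ-hom.+-homo (+ t ℤ.* + t) (+ 4)) ⟩
    fromℤ (+ t ℤ.* + t ℤ.+ + 4)              ≡⟨ cong (λ x → fromℤ (x ℤ.+ + 4)) (sym (ℤ.pos-* t t)) ⟩
    fromℤ (+ (t ℕ.* t ℕ.+ 4))                ∎
    where
    open ≡-Reasoning
    module fromℤ-hom = Hom (fromℤ-hom GZ-ring)

odd-discriminant : ∀ m → let t = suc (2 ℕ.* m) in Σ ℤ λ e → + (t ℕ.* t ℕ.+ 4) ≡ + 1 ℤ.+ + 2 ℤ.* e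
odd-discriminant m = + e ,
  trans (cong +_ (solve 1 (λ m → (con 1 :+ con 2 :* m) :* (con 1 :+ con 2 :* m) :+ con 4
                      := con 1 :+ con 2 :* (con 2 :+ con 2 :* m :+ con 2 :* (m :* m))) refl m))
        (cong (λ x → + 1 ℤ.+ x) (ℤ.pos-* 2 e))
  where
  e = 2 ℕ.+ 2 ℕ.* m ℕ.+ 2 ℕ.* (m ℕ.* m)
  open ℕSolver.+-*-Solver

module _ (t : ℕ) (m : ℕ) (t-odd : t ≡ suc (2 ℕ.* m)) (sf : SquareFree (t ℕ.* t ℕ.+ 4)) where
  private
    d = t ℕ.* t ℕ.+ 4
    instance
      d≢0 : ℕ.NonZero d
      d≢0 = ℕ.≢-nonZero (λ d≡0 → ℕ.1+n≢0 (trans (ℕ.+-comm 4 (t ℕ.* t)) d≡0))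

  -- For odd t the discriminant is, up to sign, an odd squarefree integer, and such an integer stays
  -- squarefree in ℤ[i], where only 2 ramifies.
  ZL-integrallyClosed : Order.IntegrallyClosed (ZL-order t)
  ZL-integrallyClosed = ZL-Quadratic.integrallyClosed-reduced t GZ-integrallyClosed (+ d)
    (ℕ.≢-nonZero⁻¹ d ∘ ℤ.+-injective) (itᶻ-discriminant t)
    (squareFree-∣GZ sf (subst (λ t → Σ ℤ λ e → + (t ℕ.* t ℕ.+ 4) ≡ + 1 ℤ.+ + 2 ℤ.* e) (sym t-odd) (odd-discriminant m)))

-- The ring of integers of K

-- Adjoining a square root of a unit θ. With U = 2u and V = 2v the norm gives U² ≡ θ V² modulo 4;
-- if this forces a divisor ϖ of 2, with ϖ² = 2 up to a unit, into U and V, then doing so twice gives 2 ∣ V.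
module SqrtUnitOrder (O : Order) (θ : Ring.Carrier (Order.Z O))
  (mulF : Op₂ (Ring.Carrier (Order.F O) × Ring.Carrier (Order.F O)))
  (mulF-correct : ∀ a b → mulF a b ≡ quadMul (Order.F O) (Hom.⟦_⟧ (Order.ι O) (Ring.0# (Order.Z O))) (Hom.⟦_⟧ (Order.ι O) θ) a b)
  (mulZ : Op₂ (Ring.Carrier (Order.Z O) × Ring.Carrier (Order.Z O)))
  (mulZ-correct : ∀ a b → mulZ a b ≡ quadMul (Order.Z O) (Ring.0# (Order.Z O)) θ a b)
  (closed : Order.IntegrallyClosed O) where
  open Order O
  open QuadraticOrder O Z.0# θ mulF mulF-correct mulZ mulZ-correct
  private
    module E = Order order
  open F using (_+_; _*_; -_; 0#; 1#; fromℤ)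

  module _ (θ⁻¹ ϖ j j⁻¹ : Z.Carrier)
    (θ-inverse : θ Z.* θ⁻¹ ≡ Z.1#) (j-inverse : j Z.* j⁻¹ ≡ Z.1#) (ϖ² : ϖ Z.* ϖ ≡ Z.fromℤ (+ 2) Z.* j)
    (ramified : ∀ U V W → U Z.* U ≡ θ Z.* (V Z.* V) Z.+ Z.fromℤ (+ 2) Z.* W →
      Σ Z.Carrier λ U′ → Σ Z.Carrier λ V′ → U ≡ ϖ Z.* U′ × V ≡ ϖ Z.* V′) where

    private
      2Z = Z.fromℤ (+ 2)
      Θ = ι.⟦ θ ⟧
      0F = ι.⟦ Z.0# ⟧

      cancelZ : ∀ {a b} → 2Z Z.* a ≡ 2Z Z.* b → a ≡ b
      cancelZ {a} {b} eq = ι-injective (cancel (+ 2) (λ ()) (trans (sym (ι-2* a)) (trans (cong ι.⟦_⟧ eq) (ι-2* b))))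
        where
        ι-2* : ∀ a → ι.⟦ 2Z Z.* a ⟧ ≡ fromℤ (+ 2) * ι.⟦ a ⟧
        ι-2* a = trans (ι.*-homo 2Z a) (cong (_* ι.⟦ a ⟧) (ι-fromℤ (+ 2)))

      open ≡-Reasoning

      divide-by-ϖ² : ∀ T V N T′ V′ → T ≡ ϖ Z.* T′ → V ≡ ϖ Z.* V′ → T Z.* T ≡ θ Z.* (V Z.* V) Z.+ 2Z Z.* (2Z Z.* N) →
        2Z Z.* (T′ Z.* T′) ≡ 2Z Z.* (θ Z.* (V′ Z.* V′) Z.+ 2Z Z.* (j⁻¹ Z.* N))
      divide-by-ϖ² _ _ N T′ V′ refl refl eq = begin
        2Z Z.* (T′ Z.* T′)
          ≡⟨ sym (Z.*-identityˡ _) ⟩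
        Z.1# Z.* (2Z Z.* (T′ Z.* T′))
          ≡⟨ cong (Z._* (2Z Z.* (T′ Z.* T′))) (sym j-inverse) ⟩
        j Z.* j⁻¹ Z.* (2Z Z.* (T′ Z.* T′))
          ≡⟨ solve 3 (λ j k x → j :* k :* (con (+ 2) :* x) := k :* (con (+ 2) :* j :* x)) refl j j⁻¹ (T′ Z.* T′) ⟩
        j⁻¹ Z.* (2Z Z.* j Z.* (T′ Z.* T′))
          ≡⟨ cong (λ e → j⁻¹ Z.* (e Z.* (T′ Z.* T′))) (sym ϖ²) ⟩
        j⁻¹ Z.* (ϖ Z.* ϖ Z.* (T′ Z.* T′))
          ≡⟨ cong (j⁻¹ Z.*_) (trans (interchange ϖ T′) eq) ⟩
        j⁻¹ Z.* (θ Z.* (ϖ Z.* V′ Z.* (ϖ Z.* V′)) Z.+ 2Z Z.* (2Z Z.* N))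
          ≡⟨ cong (λ e → j⁻¹ Z.* (θ Z.* e Z.+ 2Z Z.* (2Z Z.* N))) (trans (sym (interchange ϖ V′)) (cong (Z._* (V′ Z.* V′)) ϖ²)) ⟩
        j⁻¹ Z.* (θ Z.* (2Z Z.* j Z.* (V′ Z.* V′)) Z.+ 2Z Z.* (2Z Z.* N))
          ≡⟨ solve 5 (λ j k θ y n → k :* (θ :* (con (+ 2) :* j :* y) :+ con (+ 2) :* (con (+ 2) :* n))
               := con (+ 2) :* (θ :* (j :* k :* y) :+ con (+ 2) :* (k :* n))) refl j j⁻¹ θ (V′ Z.* V′) N ⟩
        2Z Z.* (θ Z.* (j Z.* j⁻¹ Z.* (V′ Z.* V′)) Z.+ 2Z Z.* (j⁻¹ Z.* N))
          ≡⟨ cong (λ e → 2Z Z.* (θ Z.* e Z.+ 2Z Z.* (j⁻¹ Z.* N))) (trans (cong (Z._* (V′ Z.* V′)) j-inverse) (Z.*-identityˡ _)) ⟩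
        2Z Z.* (θ Z.* (V′ Z.* V′) Z.+ 2Z Z.* (j⁻¹ Z.* N)) ∎
        where
        open Solver Z
        interchange : ∀ a b → a Z.* a Z.* (b Z.* b) ≡ a Z.* b Z.* (a Z.* b)
        interchange = solve 2 (λ a b → a :* a :* (b :* b) := a :* b :* (a :* b)) refl

      descend : ∀ T V N → T Z.* T ≡ θ Z.* (V Z.* V) Z.+ 2Z Z.* (2Z Z.* N) → Σ Z.Carrier λ V″ → V ≡ 2Z Z.* (j Z.* V″)
      descend T V N eq =
        let (T′ , V′ , T≡ , V≡) = ramified T V (2Z Z.* N) eq
            eq′ = cancelZ (divide-by-ϖ² T V N T′ V′ T≡ V≡ eq)
            -- Division by ϖ², which is 2 up to the unit j, uses up one factor 2 of 4 N; the
            -- congruence modulo 2 that is left is just what a second application requires.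
            (_ , V″ , _ , V′≡) = ramified T′ V′ (j⁻¹ Z.* N) eq′
        in V″ , (begin
          V                       ≡⟨ V≡ ⟩
          ϖ Z.* V′                ≡⟨ cong (ϖ Z.*_) V′≡ ⟩
          ϖ Z.* (ϖ Z.* V″)        ≡⟨ sym (Z.*-assoc ϖ ϖ V″) ⟩
          ϖ Z.* ϖ Z.* V″          ≡⟨ cong (Z._* V″) ϖ² ⟩
          2Z Z.* j Z.* V″         ≡⟨ Z.*-assoc 2Z j V″ ⟩
          2Z Z.* (j Z.* V″)       ∎)

      open Solver F

      -- The discriminant 4 θ is a square up to the unit θ, so integrality of its product with v² is
      -- integrality of (2 v)².
      square-of-double : ∀ v → - (0F * 0F + fromℤ (+ 4) * Θ) * (v * v) * (- ι.⟦ θ⁻¹ ⟧) ≡ fromℤ (+ 2) * v * (fromℤ (+ 2) * v)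
      square-of-double v = trans (cong (λ z → - (z * z + fromℤ (+ 4) * Θ) * (v * v) * (- ι.⟦ θ⁻¹ ⟧)) ι-0)
        (trans (solve 3 (λ v θ k → :- (con (+ 0) :* con (+ 0) :+ con (+ 4) :* θ) :* (v :* v) :* :- k
                 := θ :* k :* (con (+ 2) :* v :* (con (+ 2) :* v))) refl v Θ ι.⟦ θ⁻¹ ⟧)
        (trans (cong (_* (fromℤ (+ 2) * v * (fromℤ (+ 2) * v))) (trans (sym (ι.*-homo θ θ⁻¹)) (trans (cong ι.⟦_⟧ θ-inverse) ι.1-homo)))
               (F.*-identityˡ _)))

      trace² : ∀ u v → QF.trace (u , v) * QF.trace (u , v)
             ≡ Θ * (fromℤ (+ 2) * v * (fromℤ (+ 2) * v)) + fromℤ (+ 2) * (fromℤ (+ 2) * QF.norm (u , v))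
      trace² u v = trans (cong (λ z → (u + u + z * v) * (u + u + z * v)) ι-0)
        (trans (solve 3 (λ u v θ → (u :+ u :+ con (+ 0) :* v) :* (u :+ u :+ con (+ 0) :* v)
                  := θ :* (con (+ 2) :* v :* (con (+ 2) :* v)) :+ con (+ 2) :* (con (+ 2) :* (u :* u :+ con (+ 0) :* (u :* v) :+ :- (θ :* (v :* v)))))
                refl u v Θ)
        (cong (λ z → Θ * (fromℤ (+ 2) * v * (fromℤ (+ 2) * v)) + fromℤ (+ 2) * (fromℤ (+ 2) * (u * u + z * (u * v) + - (Θ * (v * v))))) (sym ι-0)))

    integrallyClosed-sqrt : E.IntegrallyClosed
    integrallyClosed-sqrt = integrallyClosed closed second
      where
      second : ∀ {u v} → E.Bounded (u , v) → Integral v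
      second {u} {v} h =
        let (T , ιT) = closed _ (bounded-trace h)
            (N , ιN) = closed _ (bounded-norm h)
            (V , ιV) = closed (fromℤ (+ 2) * v) (bounded-sqrt (subst Integral (square-of-double v)
                         (integral-* (integral-discriminant closed h) (integral-neg (θ⁻¹ , refl)))))
            ι-2* = λ a → trans (ι.*-homo 2Z a) (cong (_* ι.⟦ a ⟧) (ι-fromℤ (+ 2)))
            (V″ , V≡) = descend T V N (ι-injective (begin
              ι.⟦ T Z.* T ⟧                       ≡⟨ trans (ι.*-homo T T) (cong₂ _*_ ιT ιT) ⟩
              _                                   ≡⟨ trace² u v ⟩
              _                                   ≡⟨ sym (cong₂ _+_
                                                       (trans (ι.*-homo θ (V Z.* V)) (cong (Θ *_) (trans (ι.*-homo V V) (cong₂ _*_ ιV ιV))))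
                                                       (trans (ι-2* _) (cong (fromℤ (+ 2) *_) (trans (ι-2* N) (cong (fromℤ (+ 2) *_) ιN))))) ⟩
              ι.⟦ θ Z.* (V Z.* V) ⟧ + ι.⟦ 2Z Z.* (2Z Z.* N) ⟧    ≡⟨ sym (ι.+-homo _ _) ⟩
              ι.⟦ θ Z.* (V Z.* V) Z.+ 2Z Z.* (2Z Z.* N) ⟧        ∎))
        in j Z.* V″ , cancel (+ 2) (λ ()) (trans (sym (ι-2* _)) (trans (cong ι.⟦_⟧ (sym V≡)) ιV))

∀Bool? : {P : Bool → Set} → (∀ b → Dec (P b)) → Dec (∀ b → P b)
∀Bool? {P} P? = map′ (λ (f , t) → λ { false → f ; true → t }) (λ h → h false , h true) (P? false ×-dec P? true)

module _ (R : Ring) where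
  open Ring R
  open Solver R

  quadratic-root-inverse : ∀ p → quadMul R p (- 1#) (0# , 1#) (p , - 1#) ≡ (1# , 0#)
  quadratic-root-inverse p = cong₂ _,_
    (solve 1 (λ p → con (+ 0) :* p :+ :- con (+ 1) :* (con (+ 1) :* :- con (+ 1)) := con (+ 1)) refl p)
    (solve 1 (λ p → con (+ 0) :* :- con (+ 1) :+ con (+ 1) :* p :+ p :* (con (+ 1) :* :- con (+ 1)) := con (+ 0)) refl p)

  [1+i]-multiple : ∀ b k → (b + fromℤ (+ 2) * k , b) ≡ (1# * (b + k) - 1# * - k , 1# * - k + 1# * (b + k))
  [1+i]-multiple b k = cong₂ _,_
    (solve 2 (λ b k → b :+ con (+ 2) :* k := con (+ 1) :* (b :+ k) :- con (+ 1) :* :- k) refl b k)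
    (solve 2 (λ b k → b := con (+ 1) :* :- k :+ con (+ 1) :* (b :+ k)) refl b k)

  +-cancel-diff : ∀ a b → a ≡ b + (a - b)
  +-cancel-diff = solve 2 (λ a b → a := b :+ (a :- b)) refl

-- If a = b + 2 k, then a + b i = (1 + i) b + 2 k, and 2 = (1 + i) (1 - i), so the quotient is (b +
-- k) - k i.
[1+i]∣ : ∀ x → odd? (proj₁ x) ≡ odd? (proj₂ x) → Σ GZ λ κ → x ≡ onePlusI *ᶻ κ
[1+i]∣ (a , b) same = [ even , ⊥-elim ∘ odd ]′ (half (a ℤ.- b))
  where
  even : odd? (a ℤ.- b) ≡ false × Σ ℤ (λ k → a ℤ.- b ≡ + 2 ℤ.* k) → Σ GZ λ κ → (a , b) ≡ onePlusI *ᶻ κ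
  even (_ , k , a-b≡) = (b ℤ.+ k , ℤ.- k) , trans (cong (_, b) a≡) ([1+i]-multiple ℤ-ring b k)
    where
    a≡ : a ≡ b ℤ.+ + 2 ℤ.* k
    a≡ = trans (+-cancel-diff ℤ-ring a b) (cong (λ x → b ℤ.+ x) a-b≡)

  odd : odd? (a ℤ.- b) ≡ true × Σ ℤ (λ k → a ℤ.- b ≡ + 1 ℤ.+ + 2 ℤ.* k) → ⊥
  odd (a-b-odd , _) = true≢false (begin
    true                          ≡⟨ sym a-b-odd ⟩
    odd? (a ℤ.- b)                ≡⟨ Parity.+-homo a (ℤ.- b) ⟩
    odd? a xor odd? (ℤ.- b)       ≡⟨ cong₂ _xor_ same (HomProperties.-‿homo (fromℤ-hom Bool-ring) b) ⟩
    odd? b xor odd? b             ≡⟨ Bool.xor-same (odd? b) ⟩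
    false                         ∎)
    where open ≡-Reasoning

private
  module Mod2ᵢ = QuadraticMap (fromℤ-hom Bool-ring) (+ 0) -[1+ 0 ] _*ᶻ_ (gaussianMul-correct ℤ-ring) (quadMul Bool-ring false true) (λ _ _ → refl)

GZ-mod2 : Ring
GZ-mod2 = Quadratic.quadratic Bool-ring false true (quadMul Bool-ring false true) (λ _ _ → refl)

private
  module Mod2θ (t : ℕ) = QuadraticMap Mod2ᵢ.mapHom (itᶻ t) (-ᶻ 1ᶻ) (quadMul GZ-ring (itᶻ t) (-ᶻ 1ᶻ)) (λ _ _ → refl)
    (quadMul GZ-mod2 (false , odd? (+ t)) (true , false)) (λ _ _ → refl)

  Bool⁴ = (Bool × Bool) × (Bool × Bool)

  -- Four bits are a residue modulo 2 in ℤ[i][θ]; equality of the real and the imaginary bit of a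
  -- coordinate means that 1 + i divides it.
  Ramified : Bool⁴ → Bool⁴ → Set
  Ramified U V = U ⊛ U ≡ ((false , false) , (true , false)) ⊛ (V ⊛ V) →
    ((proj₁ (proj₁ U) ≡ proj₂ (proj₁ U)) × (proj₁ (proj₂ U) ≡ proj₂ (proj₂ U)))
    × ((proj₁ (proj₁ V) ≡ proj₂ (proj₁ V)) × (proj₁ (proj₂ V) ≡ proj₂ (proj₂ V)))
    where
    _⊛_ = quadMul GZ-mod2 (false , true) (true , false)

  ∀Bool⁴? : {P : Bool⁴ → Set} → (∀ x → Dec (P x)) → Dec (∀ x → P x)
  ∀Bool⁴? P? = map′ (λ h ((a , b) , (c , d)) → h a b c d) (λ h a b c d → h ((a , b) , (c , d)))
    (∀Bool? λ a → ∀Bool? λ b → ∀Bool? λ c → ∀Bool? λ d → P? ((a , b) , (c , d)))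

  ramified? : ∀ U V → Dec (Ramified U V)
  ramified? U V = (×.≡-dec pair≟ pair≟ _ _) →-dec
      ((_ Bool.≟ _) ×-dec (_ Bool.≟ _)) ×-dec ((_ Bool.≟ _) ×-dec (_ Bool.≟ _))
    where
    pair≟ = ×.≡-dec Bool._≟_ Bool._≟_

  -- For odd t, θ² = i θ + 1 modulo 2, hence θ³ = i. Squares modulo 2 depend only on the class
  -- modulo 1 + i, where θ generates a field with four elements, so they are 0, 1, θ² and θ⁴ = i θ.
  -- Thus θ is not a square, V cannot be a unit, and V² = 0 gives U² = 0. The 256 pairs are checked
  -- by evaluation.
  ramified : ∀ U V → Ramified U V
  ramified = toWitness {a? = ∀Bool⁴? λ U → ∀Bool⁴? λ V → ramified? U V} _

module _ (t m : ℕ) (t-odd : t ≡ suc (2 ℕ.* m)) where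
  private
    module ZL = Ring (Order.Z (ZL-order t))
    open ZL-Quadratic t using (module QZ)
    module mod2 = Hom (Mod2θ.mapHom t)

    θ ϖ : ZL.Carrier
    θ = 0ᶻ , 1ᶻ
    ϖ = onePlusI , 0ᶻ

    odd-t : odd? (+ t) ≡ true
    odd-t = trans (cong (odd? ∘ +_) t-odd) (trans (Parity.+-homo (+ 1) (+ (2 ℕ.* m)))
      (cong not (trans (cong odd? (ℤ.pos-* 2 m)) (odd?-double (+ m)))))

  θ-ramified : ∀ U V W → U ZL.* U ≡ θ ZL.* (V ZL.* V) ZL.+ ZL.fromℤ (+ 2) ZL.* W →
    Σ ZL.Carrier λ U′ → Σ ZL.Carrier λ V′ → U ≡ ϖ ZL.* U′ × V ≡ ϖ ZL.* V′
  θ-ramified U@(U₀ , U₁) V@(V₀ , V₁) W eq =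
    let ((h₀ , h₁) , (k₀ , k₁)) = ramified mod2.⟦ U ⟧ mod2.⟦ V ⟧ eq₂
        (U₀′ , U₀≡) = [1+i]∣ U₀ h₀
        (U₁′ , U₁≡) = [1+i]∣ U₁ h₁
        (V₀′ , V₀≡) = [1+i]∣ V₀ k₀
        (V₁′ , V₁≡) = [1+i]∣ V₁ k₁
    in (U₀′ , U₁′) , (V₀′ , V₁′) ,
       trans (cong₂ _,_ U₀≡ U₁≡) (sym (QZ.scalar-* onePlusI U₀′ U₁′)) ,
       trans (cong₂ _,_ V₀≡ V₁≡) (sym (QZ.scalar-* onePlusI V₀′ V₁′))
    where
    open ≡-Reasoning
    _⊛_ _⊛ₜ_ : Bool⁴ → Bool⁴ → Bool⁴
    _⊛_ = quadMul GZ-mod2 (false , true) (true , false)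
    _⊛ₜ_ = quadMul GZ-mod2 (false , odd? (+ t)) (true , false)
    -- Reduction lands in a ring whose product contains the parity of t, which does not evaluate for
    -- a variable t; replacing it by `true` makes the finite check applicable.
    ⊛ₜ≡⊛ : ∀ x y → x ⊛ₜ y ≡ x ⊛ y
    ⊛ₜ≡⊛ x y = cong (λ b → quadMul GZ-mod2 (false , b) (true , false) x y) odd-t
    module B⁴ = Ring (Quadratic.quadratic GZ-mod2 (false , odd? (+ t)) (true , false) _⊛ₜ_ (λ _ _ → refl))

    eq₂ : mod2.⟦ U ⟧ ⊛ mod2.⟦ U ⟧ ≡ ((false , false) , (true , false)) ⊛ (mod2.⟦ V ⟧ ⊛ mod2.⟦ V ⟧)
    eq₂ = begin
      mod2.⟦ U ⟧ ⊛ mod2.⟦ U ⟧                         ≡⟨ sym (⊛ₜ≡⊛ mod2.⟦ U ⟧ mod2.⟦ U ⟧) ⟩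
      mod2.⟦ U ⟧ ⊛ₜ mod2.⟦ U ⟧                        ≡⟨ sym (mod2.*-homo U U) ⟩
      mod2.⟦ U ZL.* U ⟧                               ≡⟨ cong mod2.⟦_⟧ eq ⟩
      mod2.⟦ θ ZL.* (V ZL.* V) ZL.+ ZL.fromℤ (+ 2) ZL.* W ⟧  ≡⟨ mod2.+-homo (θ ZL.* (V ZL.* V)) (ZL.fromℤ (+ 2) ZL.* W) ⟩
      mod2.⟦ θ ZL.* (V ZL.* V) ⟧ B⁴.+ mod2.⟦ ZL.fromℤ (+ 2) ZL.* W ⟧
        ≡⟨ cong₂ B⁴._+_ (trans (mod2.*-homo θ (V ZL.* V)) (cong (mod2.⟦ θ ⟧ ⊛ₜ_) (mod2.*-homo V V)))
                        (trans (mod2.*-homo (ZL.fromℤ (+ 2)) W) (B⁴.zeroˡ mod2.⟦ W ⟧)) ⟩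
      (mod2.⟦ θ ⟧ ⊛ₜ (mod2.⟦ V ⟧ ⊛ₜ mod2.⟦ V ⟧)) B⁴.+ B⁴.0#  ≡⟨ B⁴.+-identityʳ _ ⟩
      mod2.⟦ θ ⟧ ⊛ₜ (mod2.⟦ V ⟧ ⊛ₜ mod2.⟦ V ⟧)        ≡⟨ trans (⊛ₜ≡⊛ mod2.⟦ θ ⟧ (mod2.⟦ V ⟧ ⊛ₜ mod2.⟦ V ⟧)) (cong (mod2.⟦ θ ⟧ ⊛_) (⊛ₜ≡⊛ mod2.⟦ V ⟧ mod2.⟦ V ⟧)) ⟩
      mod2.⟦ θ ⟧ ⊛ (mod2.⟦ V ⟧ ⊛ mod2.⟦ V ⟧)          ∎

module ZK-Quadratic (t : ℕ) = QuadraticOrder (ZL-order t) (Ring.0# (Order.Z (ZL-order t))) (0ᶻ , 1ᶻ)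
  (quadMul (Order.F (ZL-order t)) (0q , 0q) (0q , 1q)) (λ _ _ → refl)
  (quadMul (Order.Z (ZL-order t)) (0ᶻ , 0ᶻ) (0ᶻ , 1ᶻ)) (λ _ _ → refl)

ZK-order : ℕ → Order
ZK-order t = ZK-Quadratic.order t

ZK-integrallyClosed : ∀ t m → t ≡ suc (2 ℕ.* m) → SquareFree (t ℕ.* t ℕ.+ 4) → Order.IntegrallyClosed (ZK-order t)
ZK-integrallyClosed t m t-odd sf = SqrtUnitOrder.integrallyClosed-sqrt (ZL-order t) (0ᶻ , 1ᶻ)
  (quadMul (Order.F (ZL-order t)) (0q , 0q) (0q , 1q)) (λ _ _ → refl)
  (quadMul (Order.Z (ZL-order t)) (0ᶻ , 0ᶻ) (0ᶻ , 1ᶻ)) (λ _ _ → refl)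
  (ZL-integrallyClosed t m t-odd sf)
  -- The inverse of θ is its conjugate i t - θ. The divisor ϖ is 1 + i, whose square is 2 i, so j =
  -- i.
  (itᶻ t , -ᶻ 1ᶻ) (onePlusI , 0ᶻ) (iᶻ , 0ᶻ) (-ᶻ iᶻ , 0ᶻ)
  θ-inverse i-inverse [1+i]² (θ-ramified t m t-odd)
  where
  open ZL-Quadratic t using (module QZ)
  module ZL = Ring (Order.Z (ZL-order t))

  θ-inverse : (0ᶻ , 1ᶻ) ZL.* (itᶻ t , -ᶻ 1ᶻ) ≡ ZL.1#
  θ-inverse = quadratic-root-inverse GZ-ring (itᶻ t)

  i-inverse : (iᶻ , 0ᶻ) ZL.* (-ᶻ iᶻ , 0ᶻ) ≡ ZL.1#
  i-inverse = QZ.scalar-* iᶻ (-ᶻ iᶻ) 0ᶻ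

  [1+i]² : (onePlusI , 0ᶻ) ZL.* (onePlusI , 0ᶻ) ≡ ZL.fromℤ (+ 2) ZL.* (iᶻ , 0ᶻ)
  [1+i]² = trans (QZ.scalar-* onePlusI onePlusI 0ᶻ) (sym (QZ.fromℤ-quad-* (+ 2) iᶻ 0ᶻ))

-- The field K of the statement and bases over ℤ[i]

-- mulK, over an arbitrary ring and with the coordinates split into even and odd powers of ξ.
module _ (R : Ring) (c : Ring.Carrier R) where
  open Ring R

  private
    L : Ring
    L = Quadratic.quadratic R c (- 1#) (quadMul R c (- 1#)) (λ _ _ → refl)

    L² = (Carrier × Carrier) × (Carrier × Carrier)

  flatMul : L² → L² → L²
  flatMul ((a0 , a2) , (a1 , a3)) ((b0 , b2) , (b1 , b3)) =
    (p0 - p4 - c * p6 , p2 + c * p4 + (c * c - 1#) * p6) , (p1 - p5 , p3 + c * p5)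
    where
    p0 = a0 * b0
    p1 = a0 * b1 + a1 * b0
    p2 = a0 * b2 + a1 * b1 + a2 * b0
    p3 = a0 * b3 + a1 * b2 + a2 * b1 + a3 * b0
    p4 = a1 * b3 + a2 * b2 + a3 * b1
    p5 = a2 * b3 + a3 * b2
    p6 = a3 * b3

  private
    open Solver R

    -- Repeats `quadMul` on solver expressions, so that the expanded coordinates of a product in the
    -- tower need not be written out.
    module Syntax {n : ℕ} where
      P = Polynomial n

      quad : P → P → P × P → P × P → P × P
      quad p n (u , v) (u′ , v′) = u :* u′ :+ n :* (v :* v′) , u :* v′ :+ v :* u′ :+ p :* (v :* v′)

      plus : P × P → P × P → P × P
      plus (u , v) (u′ , v′) = u :+ u′ , v :+ v′

      tower : P → (P × P) × (P × P) → (P × P) × (P × P) → (P × P) × (P × P)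
      tower c (u , v) (u′ , v′) = plus (u ⊛ u′) (θ ⊛ (v ⊛ v′)) , plus (plus (u ⊛ v′) (v ⊛ u′)) (0' ⊛ (v ⊛ v′))
        where
        _⊛_ = quad c (:- con (+ 1))
        θ 0' : P × P
        θ = con (+ 0) , con (+ 1)
        0' = con (+ 0) , con (+ 0)

    open Syntax

  tower-flat : ∀ x y → quadMul L (0# , 0#) (0# , 1#) x y ≡ flatMul x y
  tower-flat ((a0 , a2) , (a1 , a3)) ((b0 , b2) , (b1 , b3)) = cong₂ _,_ (cong₂ _,_
      (solve 9 (λ c a0 a1 a2 a3 b0 b1 b2 b3 → proj₁ (proj₁ (tower c ((a0 , a2) , (a1 , a3)) ((b0 , b2) , (b1 , b3))))
         := a0 :* b0 :- (a1 :* b3 :+ a2 :* b2 :+ a3 :* b1) :- c :* (a3 :* b3)) refl c a0 a1 a2 a3 b0 b1 b2 b3)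
      (solve 9 (λ c a0 a1 a2 a3 b0 b1 b2 b3 → proj₂ (proj₁ (tower c ((a0 , a2) , (a1 , a3)) ((b0 , b2) , (b1 , b3))))
         := a0 :* b2 :+ a1 :* b1 :+ a2 :* b0 :+ c :* (a1 :* b3 :+ a2 :* b2 :+ a3 :* b1) :+ (c :* c :- con (+ 1)) :* (a3 :* b3))
         refl c a0 a1 a2 a3 b0 b1 b2 b3))
    (cong₂ _,_
      (solve 9 (λ c a0 a1 a2 a3 b0 b1 b2 b3 → proj₁ (proj₂ (tower c ((a0 , a2) , (a1 , a3)) ((b0 , b2) , (b1 , b3))))
         := a0 :* b1 :+ a1 :* b0 :- (a2 :* b3 :+ a3 :* b2)) refl c a0 a1 a2 a3 b0 b1 b2 b3)
      (solve 9 (λ c a0 a1 a2 a3 b0 b1 b2 b3 → proj₂ (proj₂ (tower c ((a0 , a2) , (a1 , a3)) ((b0 , b2) , (b1 , b3))))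
         := a0 :* b3 :+ a1 :* b2 :+ a2 :* b1 :+ a3 :* b0 :+ c :* (a2 :* b3 :+ a3 :* b2)) refl c a0 a1 a2 a3 b0 b1 b2 b3))

-- `K` is given only by its operations and not as a `Ring`, so `embed` is no `Hom`; this collects
-- what `linComb` needs from compatibility with sum and product.
module _ {A B : Set} (_+ᴮ_ _*ᴮ_ : B → B → B) (_+ᴬ_ _*ᴬ_ : A → A → A) (f : A → B)
  (+-homo : ∀ x y → f x +ᴮ f y ≡ f (x +ᴬ y)) (*-homo : ∀ x y → f x *ᴮ f y ≡ f (x *ᴬ y)) where

  operations-homo : ∀ a b c d x →
    f a +ᴮ ((f b *ᴮ f x) +ᴮ ((f c *ᴮ (f x *ᴮ f x)) +ᴮ (f d *ᴮ ((f x *ᴮ f x) *ᴮ f x))))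
      ≡ f (a +ᴬ ((b *ᴬ x) +ᴬ ((c *ᴬ (x *ᴬ x)) +ᴬ (d *ᴬ ((x *ᴬ x) *ᴬ x)))))
  operations-homo a b c d x =
    trans (cong (f a +ᴮ_) (trans (cong₂ _+ᴮ_ (*-homo b x) (trans (cong₂ _+ᴮ_ quadratic cubic) (+-homo _ _))) (+-homo _ _))) (+-homo _ _)
    where
    quadratic : f c *ᴮ (f x *ᴮ f x) ≡ f (c *ᴬ (x *ᴬ x))
    quadratic = trans (cong (f c *ᴮ_) (*-homo x x)) (*-homo c _)
    cubic : f d *ᴮ ((f x *ᴮ f x) *ᴮ f x) ≡ f (d *ᴬ ((x *ᴬ x) *ᴬ x))
    cubic = trans (cong (f d *ᴮ_) (trans (cong (_*ᴮ f x) (*-homo x x)) (*-homo _ x))) (*-homo d _)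

OZ : Set
OZ = (GZ × GZ) × (GZ × GZ)

-- Elements of the two towers over K list the coefficients of 1, ξ², ξ, ξ³ in this order.
fromTower : (GQ × GQ) × (GQ × GQ) → K
fromTower ((a0 , a2) , (a1 , a3)) = mkK a0 a1 a2 a3

toTower : K → (GQ × GQ) × (GQ × GQ)
toTower (mkK a0 a1 a2 a3) = (a0 , a2) , (a1 , a3)

embed : OZ → K
embed ((x0 , x2) , (x1 , x3)) = mkK (GZ→GQ x0) (GZ→GQ x1) (GZ→GQ x2) (GZ→GQ x3)

module Tower (t : ℕ) where
  module O = Order (ZK-order t)
  open O using (module ι; module Z; module F) public

  mulK-tower : ∀ x y → mulK t (fromTower x) (fromTower y) ≡ fromTower (x F.* y)
  mulK-tower x y = cong fromTower (sym (tower-flat ZM.F (itq t) x y))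

  embed-injective : ∀ {x y} → embed x ≡ embed y → x ≡ y
  embed-injective eq = O.ι-injective (cong toTower eq)

  embed-* : ∀ x y → mulK t (embed x) (embed y) ≡ embed (x Z.* y)
  embed-* x y = trans (mulK-tower ι.⟦ x ⟧ ι.⟦ y ⟧) (cong fromTower (sym (ι.*-homo x y)))

  embed-+ : ∀ x y → addK (embed x) (embed y) ≡ embed (x Z.+ y)
  embed-+ x y = cong fromTower (sym (ι.+-homo x y))

  scalarᶻ : ℤ → OZ
  scalarᶻ n = ((n , + 0) , 0ᶻ) , (0ᶻ , 0ᶻ)

  private
    horner-tower : ∀ β acc as → toTower (hornerMonic t β acc as) ≡ O.horner (toTower β) (toTower acc) (map scalarᶻ as)
    horner-tower β acc []       = refl
    horner-tower β acc (a ∷ as) = trans (horner-tower β (addK (mulK t acc β) (ιZ a)) as)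
      (cong (λ x → O.horner (toTower β) (x F.+ ι.⟦ scalarᶻ a ⟧) (map scalarᶻ as)) (cong toTower (mulK-tower (toTower acc) (toTower β))))

  InO-bounded : ∀ β → InO t β → O.Bounded (toTower β)
  InO-bounded β (as , root) = O.bounded-root (toTower β) (map scalarᶻ as)
    (trans (sym (horner-tower β 1K as)) (cong toTower root))

  -- Evaluation in integral coordinates, so that a polynomial can be checked on concrete elements
  -- without rational arithmetic.
  hornerᶻ : OZ → OZ → List ℤ → OZ
  hornerᶻ β acc []       = acc
  hornerᶻ β acc (a ∷ as) = hornerᶻ β (acc Z.* β Z.+ scalarᶻ a) as

  horner-embed : ∀ β acc as → hornerMonic t (embed β) (embed acc) as ≡ embed (hornerᶻ β acc as)
  horner-embed β acc []       = refl
  horner-embed β acc (a ∷ as) = trans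
    (cong (λ x → hornerMonic t (embed β) x as) (trans (cong (λ x → addK x (ιZ a)) (embed-* acc β)) (embed-+ (acc Z.* β) (scalarᶻ a))))
    (horner-embed β (acc Z.* β Z.+ scalarᶻ a) as)

  InO-embed : ∀ β as → hornerᶻ β Z.1# as ≡ Z.0# → InO t (embed β)
  InO-embed β as root = as , trans (horner-embed β Z.1# as) (cong embed root)

  s : GZ → OZ
  s x = (x , 0ᶻ) , (0ᶻ , 0ᶻ)

  combine : OZ → OZ → OZ → OZ → OZ → OZ
  combine P0 P1 P2 P3 ((v0 , v2) , (v1 , v3)) = s v0 Z.* P0 Z.+ (s v1 Z.* P1 Z.+ (s v2 Z.* P2 Z.+ s v3 Z.* P3))

  powerCombine : OZ → OZ → OZ
  powerCombine α = combine Z.1# α (α Z.* α) (α Z.* α Z.* α)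

  private
    linComb-scalars : ∀ α a0 a1 a2 a3 {w0 w1 w2 w3} → ιGZ a0 ≡ w0 → ιGZ a1 ≡ w1 → ιGZ a2 ≡ w2 → ιGZ a3 ≡ w3 →
      linComb t α a0 a1 a2 a3 ≡ addK w0 (addK (mulK t w1 α) (addK (mulK t w2 (mulK t α α)) (mulK t w3 (mulK t (mulK t α α) α))))
    linComb-scalars α a0 a1 a2 a3 refl refl refl refl = refl

  linComb-embed : ∀ α v0 v1 v2 v3 → linComb t (embed α) v0 v1 v2 v3 ≡ embed (powerCombine α ((v0 , v2) , (v1 , v3)))
  linComb-embed α v0 v1 v2 v3 = trans (linComb-scalars (embed α) v0 v1 v2 v3 {embed (s v0)} {embed (s v1)} {embed (s v2)} {embed (s v3)} refl refl refl refl)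
    (trans (operations-homo addK (mulK t) Z._+_ Z._*_ embed embed-+ embed-* (s v0) (s v1) (s v2) (s v3) α)
    (cong (λ x → embed (x Z.+ (s v1 Z.* α Z.+ (s v2 Z.* (α Z.* α) Z.+ s v3 Z.* (α Z.* α Z.* α))))) (sym (Z.*-identityʳ (s v0)))))

module _ (R : Ring) where
  open Ring R
  open Solver R

  combine-linear : ∀ u P0 P1 P2 P3 x0 x1 x2 x3 y0 y1 y2 y3 →
    (x0 + u * y0) * P0 + ((x1 + u * y1) * P1 + ((x2 + u * y2) * P2 + (x3 + u * y3) * P3))
      ≡ (x0 * P0 + (x1 * P1 + (x2 * P2 + x3 * P3))) + u * (y0 * P0 + (y1 * P1 + (y2 * P2 + y3 * P3)))
  combine-linear = solve 13 (λ u P0 P1 P2 P3 x0 x1 x2 x3 y0 y1 y2 y3 →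
    (x0 :+ u :* y0) :* P0 :+ ((x1 :+ u :* y1) :* P1 :+ ((x2 :+ u :* y2) :* P2 :+ (x3 :+ u :* y3) :* P3))
      := (x0 :* P0 :+ (x1 :* P1 :+ (x2 :* P2 :+ x3 :* P3))) :+ u :* (y0 :* P0 :+ (y1 :* P1 :+ (y2 :* P2 :+ y3 :* P3)))) refl

  zero-combination : ∀ P0 P1 P2 P3 → 0# * P0 + (0# * P1 + (0# * P2 + 0# * P3)) ≡ 0#
  zero-combination = solve 4 (λ P0 P1 P2 P3 → con (+ 0) :* P0 :+ (con (+ 0) :* P1 :+ (con (+ 0) :* P2 :+ con (+ 0) :* P3)) := con (+ 0)) refl

  linear-combination : ∀ {A : Set} (s : A → Carrier) (f : Carrier → Carrier) → f 0# ≡ 0# →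
    (∀ a x y → f (x + s a * y) ≡ f x + s a * f y) → ∀ a0 a1 a2 a3 e0 e1 e2 e3 →
    f (s a0 * e0 + (s a1 * e1 + (s a2 * e2 + s a3 * e3))) ≡ s a0 * f e0 + (s a1 * f e1 + (s a2 * f e2 + s a3 * f e3))
  linear-combination s f f0 f-linear a0 a1 a2 a3 e0 e1 e2 e3 =
    trans (step a0 e0 _) (cong (λ z → s a0 * f e0 + z) (trans (step a1 e1 _) (cong (λ z → s a1 * f e1 + z)
      (trans (step a2 e2 _) (cong (λ z → s a2 * f e2 + z) (last a3 e3))))))
    where
    step : ∀ a e r → f (s a * e + r) ≡ s a * f e + f r
    step a e r = trans (cong f (+-comm _ r)) (trans (f-linear a r e) (+-comm (f r) _))

    last : ∀ a e → f (s a * e) ≡ s a * f e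
    last a e = trans (cong f (sym (+-identityˡ _))) (trans (f-linear a 0# e) (trans (cong (_+ s a * f e) f0) (+-identityˡ _)))

  coordinates₀ : ∀ a b c d → a * 1# + (b * 0# + (c * 0# + d * 0#)) ≡ a
  coordinates₀ = solve 4 (λ a b c d → a :* con (+ 1) :+ (b :* con (+ 0) :+ (c :* con (+ 0) :+ d :* con (+ 0))) := a) refl

  coordinates₁ : ∀ a b c d → a * 0# + (b * 1# + (c * 0# + d * 0#)) ≡ b
  coordinates₁ = solve 4 (λ a b c d → a :* con (+ 0) :+ (b :* con (+ 1) :+ (c :* con (+ 0) :+ d :* con (+ 0))) := b) refl

  coordinates₂ : ∀ a b c d → a * 0# + (b * 0# + (c * 1# + d * 0#)) ≡ c
  coordinates₂ = solve 4 (λ a b c d → a :* con (+ 0) :+ (b :* con (+ 0) :+ (c :* con (+ 1) :+ d :* con (+ 0))) := c) refl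

  coordinates₃ : ∀ a b c d → a * 0# + (b * 0# + (c * 0# + d * 1#)) ≡ d
  coordinates₃ = solve 4 (λ a b c d → a :* con (+ 0) :+ (b :* con (+ 0) :+ (c :* con (+ 0) :+ d :* con (+ 1))) := d) refl

module _ {R S : Ring} (σ : Hom R S) where
  open Hom σ
  private
    module R = Ring R
    module S = Ring S

  combine-semilinear : ∀ u x0 x1 x2 x3 y0 y1 y2 y3 P0 P1 P2 P3 →
    ⟦ x0 R.+ u R.* y0 ⟧ S.* P0 S.+ (⟦ x1 R.+ u R.* y1 ⟧ S.* P1 S.+ (⟦ x2 R.+ u R.* y2 ⟧ S.* P2 S.+ ⟦ x3 R.+ u R.* y3 ⟧ S.* P3))
      ≡ (⟦ x0 ⟧ S.* P0 S.+ (⟦ x1 ⟧ S.* P1 S.+ (⟦ x2 ⟧ S.* P2 S.+ ⟦ x3 ⟧ S.* P3)))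
        S.+ ⟦ u ⟧ S.* (⟦ y0 ⟧ S.* P0 S.+ (⟦ y1 ⟧ S.* P1 S.+ (⟦ y2 ⟧ S.* P2 S.+ ⟦ y3 ⟧ S.* P3)))
  combine-semilinear u x0 x1 x2 x3 y0 y1 y2 y3 P0 P1 P2 P3 = trans
    (cong₂ S._+_ (split x0 y0 P0) (cong₂ S._+_ (split x1 y1 P1) (cong₂ S._+_ (split x2 y2 P2) (split x3 y3 P3))))
    (combine-linear S ⟦ u ⟧ P0 P1 P2 P3 ⟦ x0 ⟧ ⟦ x1 ⟧ ⟦ x2 ⟧ ⟦ x3 ⟧ ⟦ y0 ⟧ ⟦ y1 ⟧ ⟦ y2 ⟧ ⟦ y3 ⟧)
    where
    split : ∀ x y p → ⟦ x R.+ u R.* y ⟧ S.* p ≡ (⟦ x ⟧ S.+ ⟦ u ⟧ S.* ⟦ y ⟧) S.* p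
    split x y p = cong (S._* p) (trans (+-homo x (u R.* y)) (cong (⟦ x ⟧ S.+_) (*-homo u y)))

module PowerGenerators (t : ℕ) where
  open Tower t
  private
    module QL = ZL-Quadratic.QZ t
    module QK = ZK-Quadratic.QZ t

  sᴴ : Hom GZ-ring O.Z
  sᴴ = QK.scalar ∘ᴴ QL.scalar

  s-* : ∀ u x0 x1 x2 x3 → s u Z.* ((x0 , x2) , (x1 , x3)) ≡ ((u *ᶻ x0 , u *ᶻ x2) , (u *ᶻ x1 , u *ᶻ x3))
  s-* u x0 x1 x2 x3 = trans (QK.scalar-* (u , 0ᶻ) (x0 , x2) (x1 , x3)) (cong₂ _,_ (QL.scalar-* u x0 x2) (QL.scalar-* u x1 x3))

  basis : Fin 4 → OZ
  basis zero                   = (1ᶻ , 0ᶻ) , (0ᶻ , 0ᶻ)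
  basis (suc zero)             = (0ᶻ , 0ᶻ) , (1ᶻ , 0ᶻ)
  basis (suc (suc zero))       = (0ᶻ , 1ᶻ) , (0ᶻ , 0ᶻ)
  basis (suc (suc (suc zero))) = (0ᶻ , 0ᶻ) , (0ᶻ , 1ᶻ)

  -- A four by four matrix over ℤ[i] by rows: each row is an element of `OZ` read as its coefficient
  -- vector, and v · P is the product of a row vector with the matrix.
  Matrix : Set
  Matrix = Fin 4 → OZ

  infixr 7 _·_
  _·_ : OZ → Matrix → OZ
  ((v0 , v2) , (v1 , v3)) · P = s v0 Z.* P (# 0) Z.+ (s v1 Z.* P (# 1) Z.+ (s v2 Z.* P (# 2) Z.+ s v3 Z.* P (# 3)))

  ·-linear : ∀ P u x y → (x Z.+ s u Z.* y) · P ≡ x · P Z.+ s u Z.* (y · P)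
  ·-linear P u x@((x0 , x2) , (x1 , x3)) ((y0 , y2) , (y1 , y3)) = trans
    (cong (λ z → (x Z.+ z) · P) (s-* u y0 y1 y2 y3))
    (combine-semilinear sᴴ u x0 x1 x2 x3 y0 y1 y2 y3 (P (# 0)) (P (# 1)) (P (# 2)) (P (# 3)))

  ·-zero : ∀ P → Z.0# · P ≡ Z.0#
  ·-zero P = zero-combination O.Z (P (# 0)) (P (# 1)) (P (# 2)) (P (# 3))

  ·-basis : ∀ v → v · basis ≡ v
  ·-basis ((v0 , v2) , (v1 , v3)) = trans
    (cong₂ Z._+_ (s-* v0 1ᶻ 0ᶻ 0ᶻ 0ᶻ) (cong₂ Z._+_ (s-* v1 0ᶻ 1ᶻ 0ᶻ 0ᶻ) (cong₂ Z._+_ (s-* v2 0ᶻ 0ᶻ 1ᶻ 0ᶻ) (s-* v3 0ᶻ 0ᶻ 0ᶻ 1ᶻ))))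
    (cong₂ _,_ (cong₂ _,_ (coordinates₀ GZ-ring v0 v1 v2 v3) (coordinates₂ GZ-ring v0 v1 v2 v3))
               (cong₂ _,_ (coordinates₁ GZ-ring v0 v1 v2 v3) (coordinates₃ GZ-ring v0 v1 v2 v3)))

  Inverse : Matrix → Matrix → Set
  Inverse P Q = ∀ k → P k · Q ≡ basis k

  ·-inverse : ∀ P Q → Inverse P Q → ∀ v → (v · P) · Q ≡ v
  ·-inverse P Q PQ≡1 v@((v0 , v2) , (v1 , v3)) = begin
    (v · P) · Q   ≡⟨ linear-combination O.Z s (_· Q) (·-zero Q) (·-linear Q) v0 v1 v2 v3 (P (# 0)) (P (# 1)) (P (# 2)) (P (# 3)) ⟩
    _             ≡⟨ cong₂ (λ e0 e → s v0 Z.* e0 Z.+ e) (PQ≡1 (# 0)) (cong₂ (λ e1 e → s v1 Z.* e1 Z.+ e) (PQ≡1 (# 1))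
                       (cong₂ (λ e2 e3 → s v2 Z.* e2 Z.+ s v3 Z.* e3) (PQ≡1 (# 2)) (PQ≡1 (# 3)))) ⟩
    v · basis     ≡⟨ ·-basis v ⟩
    v             ∎
    where open ≡-Reasoning

  powers : OZ → Matrix
  powers α zero                   = Z.1#
  powers α (suc zero)             = α
  powers α (suc (suc zero))       = α Z.* α
  powers α (suc (suc (suc zero))) = α Z.* α Z.* α

  -- The matrix of the powers of α is invertible over ℤ[i] and α is a root of a monic integer
  -- polynomial. One inverse relation yields spanning, the other independence, and the polynomial
  -- yields integrality.
  Certificate : OZ → Matrix → List ℤ → Set
  Certificate α Q as = (Inverse (powers α) Q × Inverse Q (powers α)) × hornerᶻ α Z.1# as ≡ Z.0#

  certificate? : ∀ α Q as → Dec (Certificate α Q as)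
  certificate? α Q as = (Fin.all? (λ k → (powers α k · Q) ≟ basis k) ×-dec Fin.all? (λ k → (Q k · powers α) ≟ basis k)) ×-dec (hornerᶻ α Z.1# as ≟ Z.0#)
    where
    _≟_ : (x y : OZ) → Dec (x ≡ y)
    _≟_ = ×.≡-dec (×.≡-dec (×.≡-dec ℤ._≟_ ℤ._≟_) (×.≡-dec ℤ._≟_ ℤ._≟_)) (×.≡-dec (×.≡-dec ℤ._≟_ ℤ._≟_) (×.≡-dec ℤ._≟_ ℤ._≟_))

  isPowerGen : O.IntegrallyClosed → ∀ α Q as → Certificate α Q as → ∀ γ → embed α ≡ γ → IsPowerGen t γ
  isPowerGen closed α Q as ((PQ≡1 , QP≡1) , root) _ refl = InO-embed α as root , spanning , independent
    where
    open ≡-Reasoning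
    P = powers α

    spanning : ∀ β → InO t β → Σ GZ λ a0 → Σ GZ λ a1 → Σ GZ λ a2 → Σ GZ λ a3 → linComb t (embed α) a0 a1 a2 a3 ≡ β
    spanning β β∈O =
      let (z , ιz≡β) = closed (toTower β) (InO-bounded β β∈O)
          ((a0 , a2) , (a1 , a3)) = z · Q
      in a0 , a1 , a2 , a3 , (begin
        linComb t (embed α) a0 a1 a2 a3   ≡⟨ linComb-embed α a0 a1 a2 a3 ⟩
        embed ((z · Q) · P)               ≡⟨ cong embed (·-inverse Q P QP≡1 z) ⟩
        embed z                           ≡⟨ cong fromTower ιz≡β ⟩
        β                                 ∎)

    independent : ∀ a0 a1 a2 a3 → linComb t (embed α) a0 a1 a2 a3 ≡ 0K → a0 ≡ 0ᶻ × a1 ≡ 0ᶻ × a2 ≡ 0ᶻ × a3 ≡ 0ᶻ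
    independent a0 a1 a2 a3 eq = cong (proj₁ ∘ proj₁) a≡0 , cong (proj₁ ∘ proj₂) a≡0 , cong (proj₂ ∘ proj₁) a≡0 , cong (proj₂ ∘ proj₂) a≡0
      where
      a : OZ
      a = (a0 , a2) , (a1 , a3)
      a≡0 : a ≡ Z.0#
      a≡0 = begin
        a             ≡⟨ sym (·-inverse P Q PQ≡1 a) ⟩
        (a · P) · Q   ≡⟨ cong (_· Q) (embed-injective {a · P} {Z.0#} (trans (sym (linComb-embed α a0 a1 a2 a3)) eq)) ⟩
        Z.0# · Q      ≡⟨ ·-zero Q ⟩
        Z.0#          ∎

-- The listed elements

infix 5 _+i_
_+i_ : ℤ → ℤ → GZ
_+i_ = _,_

⟨_,_,_,_⟩ : GZ → GZ → GZ → GZ → OZ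
⟨ x0 , x1 , x2 , x3 ⟩ = (x0 , x2) , (x1 , x3)

powerBasis : OZ → OZ → OZ → Fin 4 → OZ
powerBasis Q1 Q2 Q3 zero                   = ⟨ 1ᶻ , 0ᶻ , 0ᶻ , 0ᶻ ⟩
powerBasis Q1 Q2 Q3 (suc zero)             = Q1
powerBasis Q1 Q2 Q3 (suc (suc zero))       = Q2
powerBasis Q1 Q2 Q3 (suc (suc (suc zero))) = Q3

xyz : GZ → GZ → GZ → OZ
xyz x y z = ⟨ 0ᶻ , x , y , z ⟩

-- (X⁴ + 1)² + t² X⁴
minimalPolynomial : ℕ → List ℤ
minimalPolynomial t = + 0 ∷ + 0 ∷ + 0 ∷ + (2 ℕ.+ t ℕ.* t) ∷ + 0 ∷ + 0 ∷ + 0 ∷ + 1 ∷ []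

module _ where
  open PowerGenerators

  ξ-inverse : Fin 4 → OZ
  ξ-inverse = powerBasis ⟨ 0ᶻ , 1ᶻ , 0ᶻ , 0ᶻ ⟩ ⟨ 0ᶻ , 0ᶻ , 1ᶻ , 0ᶻ ⟩ ⟨ 0ᶻ , 0ᶻ , 0ᶻ , 1ᶻ ⟩

  -- The powers of −1/ξ; as inversion is an involution, they express those of ξ in the same way.
  ξ⁻¹-inverse : ℕ → Fin 4 → OZ
  ξ⁻¹-inverse t = powerBasis ⟨ 0ᶻ , minusItᶻ t , 0ᶻ , 1ᶻ ⟩ ⟨ itᶻ t , 0ᶻ , -ᶻ 1ᶻ , 0ᶻ ⟩ ⟨ 0ᶻ , + (t ℕ.* t ℕ.+ 1) +i + 0 , 0ᶻ , itᶻ t ⟩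

  ξ-Certificate ξ⁻¹-Certificate : ℕ → Set
  ξ-Certificate t   = Certificate t (xyz 1ᶻ 0ᶻ 0ᶻ) ξ-inverse (minimalPolynomial t)
  ξ⁻¹-Certificate t = Certificate t (xyz (minusItᶻ t) 0ᶻ 1ᶻ) (ξ⁻¹-inverse t) (minimalPolynomial t)

  ξ-certificate? : ∀ t → Dec (ξ-Certificate t)
  ξ-certificate? t = certificate? t (xyz 1ᶻ 0ᶻ 0ᶻ) ξ-inverse (minimalPolynomial t)

  ξ⁻¹-certificate? : ∀ t → Dec (ξ⁻¹-Certificate t)
  ξ⁻¹-certificate? t = certificate? t (xyz (minusItᶻ t) 0ᶻ 1ᶻ) (ξ⁻¹-inverse t) (minimalPolynomial t)

  -- For each numeral t a certificate is a closed decidable statement, so evaluation at every t ≤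
  -- 100 replaces a symbolic proof in t.
  ξ-certificate : ∀ {t} → t ℕ.< 101 → ξ-Certificate t
  ξ-certificate = toWitness {a? = ℕ.allUpTo? ξ-certificate? 101} _

  ξ⁻¹-certificate : ∀ {t} → t ℕ.< 101 → ξ⁻¹-Certificate t
  ξ⁻¹-certificate = toWitness {a? = ℕ.allUpTo? ξ⁻¹-certificate? 101} _

  module _ (closed : Order.IntegrallyClosed (ZK-order 1)) where
    certified : ∀ α Q as → {_ : True (certificate? 1 α Q as)} → ∀ γ → embed α ≡ γ → IsPowerGen 1 γ
    certified α Q as {c} = isPowerGen 1 closed α Q as (toWitness {a? = certificate? 1 α Q as} c)

    -- The rows express ξ, ξ² and ξ³ in the powers of α. The list is a monic polynomial of degree 8,
    -- the degree of K over ℚ, with root α.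
    sporadic₁ : IsPowerGen 1 (elemXYZ (+ 3 , + 0) onePlusI (+ 0 , + 2))
    sporadic₁ = certified (xyz (+ 3 , + 0) onePlusI (+ 0 , + 2))
      (powerBasis ⟨ ℤ.- + 36 +i + 36 , ℤ.- + 29 +i + 0 , + 1 +i + 1 , + 0 +i + 2 ⟩
                  ⟨ + 0 +i ℤ.- + 62 , + 28 +i ℤ.- + 28 , ℤ.- + 1 +i + 0 , ℤ.- + 2 +i ℤ.- + 2 ⟩
                  ⟨ ℤ.- + 23 +i ℤ.- + 23 , + 0 +i ℤ.- + 16 , ℤ.- + 1 +i + 1 , ℤ.- + 1 +i + 0 ⟩)
      (+ 4 ∷ + 8 ∷ + 28 ∷ + 279 ∷ + 1260 ∷ + 3200 ∷ + 4400 ∷ + 3025 ∷ []) (elemXYZ (+ 3 , + 0) onePlusI (+ 0 , + 2)) refl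

    -- This generator comes from the previous one by ξ ↦ -ξ followed by a change of sign. Hence the
    -- polynomial is the earlier one at -X, and the rows differ only in signs. The remaining two
    -- generators are related in the same way.
    sporadic₂ : IsPowerGen 1 (elemXYZ (+ 3 , + 0) (-ᶻ onePlusI) (+ 0 , + 2))
    sporadic₂ = certified (xyz (+ 3 , + 0) (-ᶻ onePlusI) (+ 0 , + 2))
      (powerBasis ⟨ + 36 +i ℤ.- + 36 , ℤ.- + 29 +i + 0 , ℤ.- + 1 +i ℤ.- + 1 , + 0 +i + 2 ⟩
                  ⟨ + 0 +i ℤ.- + 62 , ℤ.- + 28 +i + 28 , ℤ.- + 1 +i + 0 , + 2 +i + 2 ⟩
                  ⟨ + 23 +i + 23 , + 0 +i ℤ.- + 16 , + 1 +i ℤ.- + 1 , ℤ.- + 1 +i + 0 ⟩)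
      (ℤ.- + 4 ∷ + 8 ∷ ℤ.- + 28 ∷ + 279 ∷ ℤ.- + 1260 ∷ + 3200 ∷ ℤ.- + 4400 ∷ + 3025 ∷ []) (elemXYZ (+ 3 , + 0) (-ᶻ onePlusI) (+ 0 , + 2)) refl

    sporadic₃ : IsPowerGen 1 (elemXYZ iᶻ onePlusI 1ᶻ)
    sporadic₃ = certified (xyz iᶻ onePlusI 1ᶻ)
      (powerBasis ⟨ ℤ.- + 2 +i ℤ.- + 2 , + 0 +i + 7 , + 3 +i ℤ.- + 3 , + 1 +i + 0 ⟩
                  ⟨ + 0 +i + 13 , + 18 +i ℤ.- + 18 , ℤ.- + 11 +i + 0 , ℤ.- + 2 +i ℤ.- + 2 ⟩
                  ⟨ + 11 +i ℤ.- + 11 , ℤ.- + 28 +i + 0 , + 8 +i + 8 , + 0 +i + 3 ⟩)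
      (+ 4 ∷ + 8 ∷ ℤ.- + 72 ∷ + 179 ∷ ℤ.- + 240 ∷ + 200 ∷ ℤ.- + 100 ∷ + 25 ∷ []) (elemXYZ iᶻ onePlusI 1ᶻ) refl

    sporadic₄ : IsPowerGen 1 (elemXYZ iᶻ (-ᶻ onePlusI) 1ᶻ)
    sporadic₄ = certified (xyz iᶻ (-ᶻ onePlusI) 1ᶻ)
      (powerBasis ⟨ + 2 +i + 2 , + 0 +i + 7 , ℤ.- + 3 +i + 3 , + 1 +i + 0 ⟩
                  ⟨ + 0 +i + 13 , ℤ.- + 18 +i + 18 , ℤ.- + 11 +i + 0 , + 2 +i + 2 ⟩
                  ⟨ ℤ.- + 11 +i + 11 , ℤ.- + 28 +i + 0 , ℤ.- + 8 +i ℤ.- + 8 , + 0 +i + 3 ⟩)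
      (ℤ.- + 4 ∷ + 8 ∷ + 72 ∷ + 179 ∷ + 240 ∷ + 200 ∷ + 100 ∷ + 25 ∷ []) (elemXYZ iᶻ (-ᶻ onePlusI) 1ᶻ) refl

listed-isPowerGen : ∀ {t} → t ℕ.≤ 100 → Order.IntegrallyClosed (ZK-order t) → ∀ α → Listed t α → IsPowerGen t α
listed-isPowerGen {t} t≤100 closed α (inj₁ α≡) =
  PowerGenerators.isPowerGen t closed (xyz 1ᶻ 0ᶻ 0ᶻ) ξ-inverse (minimalPolynomial t) (ξ-certificate {t} (ℕ.s≤s t≤100)) α (sym α≡)
listed-isPowerGen {t} t≤100 closed α (inj₂ (inj₁ α≡)) =
  PowerGenerators.isPowerGen t closed (xyz (minusItᶻ t) 0ᶻ 1ᶻ) (ξ⁻¹-inverse t) (minimalPolynomial t) (ξ⁻¹-certificate {t} (ℕ.s≤s t≤100)) α (sym α≡)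
listed-isPowerGen _ closed _ (inj₂ (inj₂ (refl , inj₁ refl)))                      = sporadic₁ closed
listed-isPowerGen _ closed _ (inj₂ (inj₂ (refl , inj₂ (inj₁ refl))))               = sporadic₂ closed
listed-isPowerGen _ closed _ (inj₂ (inj₂ (refl , inj₂ (inj₂ (inj₁ refl)))))        = sporadic₃ closed
listed-isPowerGen _ closed _ (inj₂ (inj₂ (refl , inj₂ (inj₂ (inj₂ refl)))))        = sporadic₄ closed

-- The index form

module _ (R : Ring) where
  open Ring R
  open Solver R

  cubic : (a0 a1 a2 a3 α : Carrier) → Carrier
  cubic a0 a1 a2 a3 α = a0 * 1# + (a1 * α + (a2 * (α * α) + a3 * (α * α * α)))

  cubic-quotient : (a1 a2 a3 α α′ : Carrier) → Carrier
  cubic-quotient a1 a2 a3 α α′ = a1 + (a2 * (α + α′) + a3 * (α * α + α * α′ + α′ * α′))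

  -- If g is a polynomial with g(α) = ω and g(α′) = ω′, then α - α′ divides ω - ω′. Together with α
  -- - α′ = (ω - ω′) k this makes k a unit as soon as ω - ω′ can be cancelled, which is left to each
  -- application.
  cubic-difference : ∀ a0 a1 a2 a3 {α α′ ω ω′ k} → cubic a0 a1 a2 a3 α ≡ ω → cubic a0 a1 a2 a3 α′ ≡ ω′ →
    α - α′ ≡ (ω - ω′) * k → (ω - ω′) * (k * cubic-quotient a1 a2 a3 α α′) ≡ ω - ω′
  cubic-difference a0 a1 a2 a3 {α} {α′} {ω} {ω′} {k} gα gα′ diff =
    trans (sym (*-assoc (ω - ω′) k _)) (trans (cong (_* cubic-quotient a1 a2 a3 α α′) (sym diff)) (trans
    (solve 6 (λ a0 a1 a2 a3 α β → (α :- β) :* (a1 :+ (a2 :* (α :+ β) :+ a3 :* (α :* α :+ α :* β :+ β :* β)))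
      := (a0 :* con (+ 1) :+ (a1 :* α :+ (a2 :* (α :* α) :+ a3 :* (α :* α :* α))))
      :- (a0 :* con (+ 1) :+ (a1 :* β :+ (a2 :* (β :* β) :+ a3 :* (β :* β :* β))))) refl a0 a1 a2 a3 α α′)
    (cong₂ _-_ gα gα′)))

  module _ {δ θ θ̄ : Carrier} (δ² : δ * δ ≡ 1#) (θθ̄ : θ * θ̄ ≡ 1#) where

    -- With δ = ±1, e = δ θ̄ is the factor in δ/ξ = e ξ. Squaring shows ξ ↦ e ξ to be compatible
    -- with θ ↦ θ̄.
    twist-square : θ * (δ * θ̄ * (δ * θ̄)) ≡ θ̄
    twist-square = trans (solve 3 (λ δ θ θ̄ → θ :* (δ :* θ̄ :* (δ :* θ̄)) := δ :* δ :* (θ :* θ̄ :* θ̄)) refl δ θ θ̄)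
      (trans (cong₂ (λ a b → a * (b * θ̄)) δ² θθ̄) (solve 1 (λ θ̄ → con (+ 1) :* (con (+ 1) :* θ̄) := θ̄) refl θ̄))

    -- This and the next identity are the even and the odd part of α - α′ for ξ′ = e ξ. Both exhibit
    -- the factor 1 - e of ξ - ξ′ = (1 - e) ξ, and the quotient is x + (c + δ) z + y (1 + e) ξ.
    twisted-difference₁ : ∀ y → y * θ - y * θ̄ ≡ θ * ((1# - δ * θ̄) * (y * (1# + δ * θ̄)))
    twisted-difference₁ y = sym (trans
      (solve 4 (λ δ θ θ̄ y → θ :* ((con (+ 1) :- δ :* θ̄) :* (y :* (con (+ 1) :+ δ :* θ̄))) := y :* θ :- y :* (δ :* δ :* (θ :* θ̄) :* θ̄)) refl δ θ θ̄ y)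
      (trans (cong₂ (λ a b → y * θ - y * (a * b * θ̄)) δ² θθ̄)
        (solve 3 (λ θ θ̄ y → y :* θ :- y :* (con (+ 1) :* con (+ 1) :* θ̄) := y :* θ :- y :* θ̄) refl θ θ̄ y)))

    twisted-difference₂ : ∀ x z → (x + z * θ) - δ * θ̄ * (x + z * θ̄) ≡ (1# - δ * θ̄) * (x + (θ + θ̄ + δ) * z)
    twisted-difference₂ x z = sym (trans
      (solve 5 (λ δ θ θ̄ x z → (con (+ 1) :- δ :* θ̄) :* (x :+ (θ :+ θ̄ :+ δ) :* z)
         := (x :+ z :* θ) :- δ :* θ̄ :* (x :+ z :* θ̄) :+ (δ :* z :- δ :* (θ :* θ̄) :* z) :+ (θ̄ :* z :- δ :* δ :* θ̄ :* z)) refl δ θ θ̄ x z)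
      (trans (cong₂ (λ a b → (x + z * θ) - δ * θ̄ * (x + z * θ̄) + (δ * z - δ * b * z) + (θ̄ * z - a * θ̄ * z)) δ² θθ̄)
        (solve 5 (λ δ θ θ̄ x z → (x :+ z :* θ) :- δ :* θ̄ :* (x :+ z :* θ̄) :+ (δ :* z :- δ :* con (+ 1) :* z) :+ (θ̄ :* z :- con (+ 1) :* θ̄ :* z)
          := (x :+ z :* θ) :- δ :* θ̄ :* (x :+ z :* θ̄)) refl δ θ θ̄ x z)))

    twisted-norm₋ : θ * ((1# - δ * θ̄) * (1# - δ * θ̄)) ≡ θ + θ̄ - fromℤ (+ 2) * δ
    twisted-norm₋ = trans
      (solve 3 (λ δ θ θ̄ → θ :* ((con (+ 1) :- δ :* θ̄) :* (con (+ 1) :- δ :* θ̄)) := θ :+ δ :* δ :* (θ :* θ̄) :* θ̄ :- con (+ 2) :* (δ :* (θ :* θ̄))) refl δ θ θ̄)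
      (trans (cong₂ (λ a b → θ + a * b * θ̄ - fromℤ (+ 2) * (δ * b)) δ² θθ̄)
        (solve 3 (λ δ θ θ̄ → θ :+ con (+ 1) :* con (+ 1) :* θ̄ :- con (+ 2) :* (δ :* con (+ 1)) := θ :+ θ̄ :- con (+ 2) :* δ) refl δ θ θ̄))

    twisted-norm₊ : ∀ y → θ * (y * (1# + δ * θ̄) * (y * (1# + δ * θ̄))) ≡ y * y * (θ + θ̄ + fromℤ (+ 2) * δ)
    twisted-norm₊ y = trans
      (solve 4 (λ δ θ θ̄ y → θ :* (y :* (con (+ 1) :+ δ :* θ̄) :* (y :* (con (+ 1) :+ δ :* θ̄))) := y :* y :* (θ :+ δ :* δ :* (θ :* θ̄) :* θ̄ :+ con (+ 2) :* (δ :* (θ :* θ̄)))) refl δ θ θ̄ y)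
      (trans (cong₂ (λ a b → y * y * (θ + a * b * θ̄ + fromℤ (+ 2) * (δ * b))) δ² θθ̄)
        (solve 4 (λ δ θ θ̄ y → y :* y :* (θ :+ con (+ 1) :* con (+ 1) :* θ̄ :+ con (+ 2) :* (δ :* con (+ 1))) := y :* y :* (θ :+ θ̄ :+ con (+ 2) :* δ)) refl δ θ θ̄ y))

cubic-homo : ∀ {R S} (φ : Hom R S) → let open Hom φ in ∀ a0 a1 a2 a3 α →
  ⟦ cubic R a0 a1 a2 a3 α ⟧ ≡ cubic S ⟦ a0 ⟧ ⟦ a1 ⟧ ⟦ a2 ⟧ ⟦ a3 ⟧ ⟦ α ⟧
cubic-homo {R} {S} φ a0 a1 a2 a3 α = trans (+-homo _ _) (cong₂ S._+_ (trans (*-homo _ _) (cong (⟦ a0 ⟧ S.*_) 1-homo))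
  (trans (+-homo _ _) (cong₂ S._+_ (*-homo a1 α) (trans (+-homo _ _) (cong₂ S._+_
    (trans (*-homo a2 _) (cong (⟦ a2 ⟧ S.*_) (*-homo α α)))
    (trans (*-homo a3 _) (cong (⟦ a3 ⟧ S.*_) (trans (*-homo _ α) (cong (S._* ⟦ α ⟧) (*-homo α α))))))))))
  where
  open Hom φ
  module S = Ring S

-- An automorphism f of R sending n to e² n extends to R[√n] by √n ↦ e √n.
module _ (R : Ring) (n : Ring.Carrier R) (f : Hom R R) (e : Ring.Carrier R)
  (twist : Ring._*_ R n (Ring._*_ R e e) ≡ Hom.⟦_⟧ f n) where
  open Ring R
  open Solver R
  private
    module f = Hom f
    S = Quadratic.quadratic R 0# n (quadMul R 0# n) (λ _ _ → refl)

  twistedHom : Hom S S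
  twistedHom = record
    { ⟦_⟧    = λ (u , v) → f.⟦ u ⟧ , e * f.⟦ v ⟧
    ; +-homo = λ a b → cong₂ _,_ (f.+-homo _ _) (trans (cong (e *_) (f.+-homo _ _)) (distribˡ _ _ _))
    ; *-homo = λ (a , a′) (b , b′) → cong₂ _,_
        (trans (f.+-homo _ _) (cong₂ _+_ (f.*-homo a b) (trans (trans (f.*-homo n _) (cong₂ _*_ (sym twist) (f.*-homo a′ b′)))
          (solve 4 (λ n e a b → n :* (e :* e) :* (a :* b) := n :* (e :* a :* (e :* b))) refl n e f.⟦ a′ ⟧ f.⟦ b′ ⟧))))
        (trans (cong (e *_) (trans (f.+-homo _ _) (cong₂ _+_ (trans (f.+-homo _ _) (cong₂ _+_ (f.*-homo a b′) (f.*-homo a′ b)))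
            (trans (f.*-homo 0# _) (trans (cong (_* f.⟦ a′ * b′ ⟧) (HomProperties.0-homo f)) (zeroˡ _))))))
          (solve 5 (λ e a a′ b b′ → e :* (a :* b′ :+ a′ :* b :+ con (+ 0)) := a :* (e :* b′) :+ e :* a′ :* b :+ con (+ 0) :* (e :* a′ :* (e :* b′)))
            refl e f.⟦ a ⟧ f.⟦ a′ ⟧ f.⟦ b ⟧ f.⟦ b′ ⟧))
    ; 1-homo = cong₂ _,_ f.1-homo (trans (cong (e *_) (HomProperties.0-homo f)) (zeroʳ e))
    }

module _ (R : Ring) where
  open Ring R
  open Solver R

  -- Over a variable ring the products with zero that `conj` and `norm` produce at p = 0 do not
  -- compute away, hence the shape of this identity and of several that follow.
  sqrt-conj-difference : ∀ n u v → (u - (u + 0# * v) , v - - v) ≡ quadMul R 0# n (0# - (0# + 0# * 1#) , 1# - - 1#) (v , 0#)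
  sqrt-conj-difference n u v = cong₂ _,_
    (solve 3 (λ n u v → u :- (u :+ con (+ 0) :* v)
      := (con (+ 0) :- (con (+ 0) :+ con (+ 0) :* con (+ 1))) :* v :+ n :* ((con (+ 1) :- :- con (+ 1)) :* con (+ 0))) refl n u v)
    (solve 1 (λ v → v :- :- v := (con (+ 0) :- (con (+ 0) :+ con (+ 0) :* con (+ 1))) :* con (+ 0) :+ (con (+ 1) :- :- con (+ 1)) :* v
      :+ con (+ 0) :* ((con (+ 1) :- :- con (+ 1)) :* con (+ 0))) refl v)

  sqrt-conj-scalar : ∀ a → (a + 0# * 0# , - 0#) ≡ (a , 0#)
  sqrt-conj-scalar a = cong₂ _,_ (solve 1 (λ a → a :+ con (+ 0) :* con (+ 0) := a) refl a) (solve 0 (:- con (+ 0) := con (+ 0)) refl)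

  second-coordinate : ∀ r₀ r₁ → (0# - (0# + 0# * 1#)) * r₁ + (1# - - 1#) * r₀ + 0# * ((1# - - 1#) * r₁) ≡ 1# - - 1# →
    fromℤ (+ 2) * r₀ ≡ fromℤ (+ 2) * 1#
  second-coordinate r₀ r₁ eq = trans
    (solve 2 (λ r₀ r₁ → con (+ 2) :* r₀ := (con (+ 0) :- (con (+ 0) :+ con (+ 0) :* con (+ 1))) :* r₁ :+ (con (+ 1) :- :- con (+ 1)) :* r₀ :+ con (+ 0) :* ((con (+ 1) :- :- con (+ 1)) :* r₁)) refl r₀ r₁)
    (trans eq (solve 0 (con (+ 1) :- :- con (+ 1) := con (+ 2) :* con (+ 1)) refl))

  pure-multiple : ∀ n w κ η → quadMul R 0# n (0# , w) (κ , η) ≡ (n * (w * η) , w * κ)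
  pure-multiple n w κ η = cong₂ _,_
    (solve 4 (λ n w κ η → con (+ 0) :* κ :+ n :* (w :* η) := n :* (w :* η)) refl n w κ η)
    (solve 3 (λ w κ η → con (+ 0) :* η :+ w :* κ :+ con (+ 0) :* (w :* η) := w :* κ) refl w κ η)

  sqrt-norm : ∀ n u v → u * u + 0# * (u * v) + - (n * (v * v)) ≡ u * u - n * (v * v)
  sqrt-norm = solve 3 (λ n u v → u :* u :+ con (+ 0) :* (u :* v) :+ :- (n :* (v :* v)) := u :* u :- n :* (v :* v)) refl

  pure-norm : ∀ n v → 0# * 0# + 0# * (0# * v) + - (n * (v * v)) ≡ - (n * (v * v))
  pure-norm = solve 2 (λ n v → con (+ 0) :* con (+ 0) :+ con (+ 0) :* (con (+ 0) :* v) :+ :- (n :* (v :* v)) := :- (n :* (v :* v))) refl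

  neg-cancel : ∀ a b → - a * b ≡ - a → a * b ≡ a
  neg-cancel a b eq = trans (solve 2 (λ a b → a :* b := :- (:- a :* b)) refl a b) (trans (cong -_ eq) (solve 1 (λ a → :- :- a := a) refl a))

  linear-coordinates : ∀ x z → (x + z * 0# , 0# + z * 1#) ≡ (x , z)
  linear-coordinates x z = cong₂ _,_ (solve 2 (λ x z → x :+ z :* con (+ 0) := x) refl x z) (solve 1 (λ z → con (+ 0) :+ z :* con (+ 1) := z) refl z)

  trace-root : ∀ p → 0# + 0# + p * 1# ≡ p
  trace-root = solve 1 (λ p → con (+ 0) :+ con (+ 0) :+ p :* con (+ 1) := p) refl

  norm-root : ∀ p → 0# * 0# + p * (0# * 1#) + - (- 1# * (1# * 1#)) ≡ 1#
  norm-root = solve 1 (λ p → con (+ 0) :* con (+ 0) :+ p :* (con (+ 0) :* con (+ 1)) :+ :- (:- con (+ 1) :* (con (+ 1) :* con (+ 1))) := con (+ 1)) refl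

  conj-scalar : ∀ p x → (x + p * 0# , - 0#) ≡ (x , 0#)
  conj-scalar p x = cong₂ _,_ (solve 2 (λ p x → x :+ p :* con (+ 0) := x) refl p x) (solve 0 (:- con (+ 0) := con (+ 0)) refl)

-- The index form of x ξ + y ξ² + z ξ³ factors according to the pairs of conjugates (ξ, −ξ), (ξ, 1/ξ), (ξ, −1/ξ):
-- if ω is a cubic polynomial in α, then α − α′ divides ω − ω′ for every conjugation.
module IndexForm (R : Ring) (c : Ring.Carrier R) where
  open Ring R
  module QL = Quadratic R c (- 1#) (quadMul R c (- 1#)) (λ _ _ → refl)
  module L = Ring QL.quadratic

  θ θ̄ : L.Carrier
  θ = 0# , 1#
  θ̄ = Hom.⟦_⟧ QL.conj θ

  module QK = Quadratic QL.quadratic L.0# θ (quadMul QL.quadratic L.0# θ) (λ _ _ → refl)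
  module OK = Ring QK.quadratic
  private
    module sL = Hom QL.scalar
    module conjL = Hom QL.conj

  s : Carrier → OK.Carrier
  s x = (x , 0#) , L.0#

  θ+θ̄ : θ L.+ θ̄ ≡ sL.⟦ c ⟧
  θ+θ̄ = trans (QL.+-conj θ) (cong sL.⟦_⟧ (trace-root R c))

  θθ̄ : θ L.* θ̄ ≡ L.1#
  θθ̄ = trans (QL.*-conj θ) (cong sL.⟦_⟧ (norm-root R c))

  linear : ∀ x z → (x , z) ≡ sL.⟦ x ⟧ L.+ sL.⟦ z ⟧ L.* θ
  linear x z = sym (trans (cong (λ e → sL.⟦ x ⟧ L.+ e) (QL.scalar-* z 0# 1#)) (linear-coordinates R x z))

  module _ (x y z a0 a1 a2 a3 : Carrier)
    (power-basis : cubic QK.quadratic (s a0) (s a1) (s a2) (s a3) ((0# , y) , (x , z)) ≡ (L.0# , L.1#)) where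
    private
      α ξ : OK.Carrier
      α = (0# , y) , (x , z)
      ξ = L.0# , L.1#

      conjugate : ∀ (φ : Hom QK.quadratic QK.quadratic) → (∀ a → Hom.⟦_⟧ φ (s a) ≡ s a) →
        cubic QK.quadratic (s a0) (s a1) (s a2) (s a3) (Hom.⟦_⟧ φ α) ≡ Hom.⟦_⟧ φ ξ
      conjugate φ fixed = trans (sym (trans (cubic-homo φ (s a0) (s a1) (s a2) (s a3) α) (fix (fixed a0) (fixed a1) (fixed a2) (fixed a3))))
        (cong (Hom.⟦_⟧ φ) power-basis)
        where
        fix : ∀ {b0 b1 b2 b3 c0 c1 c2 c3 β} → b0 ≡ c0 → b1 ≡ c1 → b2 ≡ c2 → b3 ≡ c3 → cubic QK.quadratic b0 b1 b2 b3 β ≡ cubic QK.quadratic c0 c1 c2 c3 β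
        fix refl refl refl refl = refl

      quotient : Hom QK.quadratic QK.quadratic → OK.Carrier
      quotient φ = cubic-quotient QK.quadratic (s a1) (s a2) (s a3) α (Hom.⟦_⟧ φ α)

    -- For ξ′ = -ξ the differences are 2 ξ and 2 ξ (x + z θ). Cancelling 2 in the coefficient of ξ
    -- shows that x + z θ is invertible in L, and F₁ is its norm.
    F₁-unit : (∀ a b → L.fromℤ (+ 2) L.* a ≡ L.fromℤ (+ 2) L.* b → a ≡ b) → Σ Carrier λ m → QL.norm (x , z) * m ≡ 1#
    F₁-unit cancel₂ = QL.norm h₀ , QL.norm-unit (x , z) h₀ (cancel₂ ((x , z) L.* h₀) L.1#
        (second-coordinate QL.quadratic ((x , z) L.* h₀) ((x , z) L.* h₁) (cong proj₂ (trans (cong (λ e → (ξ OK.- Hom.⟦_⟧ QK.conj ξ) OK.* e)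
          (sym (QK.scalar-* (x , z) h₀ h₁))) difference))))
      where
      h = quotient QK.conj
      h₀ = proj₁ h
      h₁ = proj₂ h
      difference : (ξ OK.- Hom.⟦_⟧ QK.conj ξ) OK.* (((x , z) , L.0#) OK.* h) ≡ ξ OK.- Hom.⟦_⟧ QK.conj ξ
      difference = cubic-difference QK.quadratic (s a0) (s a1) (s a2) (s a3)
        {α} {Hom.⟦_⟧ QK.conj α} {ξ} {Hom.⟦_⟧ QK.conj ξ} {(x , z) , L.0#} power-basis
        (conjugate QK.conj (λ a → sqrt-conj-scalar QL.quadratic (a , 0#)))
        (sqrt-conj-difference QL.quadratic θ (0# , y) (x , z))

    -- For ξ′ = δ/ξ one has (ξ - ξ′) k h = ξ - ξ′. Norms to L are taken before cancelling, because
    -- N(ξ - ξ′) = -(c - 2 δ) and N(k) = F are scalars, so that cancellation takes place in R.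
    Fδ-unit : ∀ δ → δ * δ ≡ 1# → (∀ a → (c - fromℤ (+ 2) * δ) * a ≡ c - fromℤ (+ 2) * δ → a ≡ 1#) →
      Σ Carrier λ m → ((x + (c + δ) * z) * (x + (c + δ) * z) - y * y * (c + fromℤ (+ 2) * δ)) * m ≡ 1#
    Fδ-unit δ δ² cancelδ = proj₁ (QK.norm h) , cancelδ _ (trans
        (cong (C *_) (cong proj₁ (sym (QL.scalar-* F _ _))))
        (cong proj₁ (trans (sym (QL.scalar-* C _ _)) (neg-cancel QL.quadratic sL.⟦ C ⟧ _ (begin
          L.- sL.⟦ C ⟧ L.* (sL.⟦ F ⟧ L.* QK.norm h)   ≡⟨ sym (cong₂ L._*_ norm-ω (trans (QK.norm-* k h) (cong (L._* QK.norm h) norm-k))) ⟩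
          QK.norm ω L.* QK.norm (k OK.* h)           ≡⟨ sym (QK.norm-* ω (k OK.* h)) ⟩
          QK.norm (ω OK.* (k OK.* h))                ≡⟨ cong QK.norm (trans (cong (OK._* (k OK.* h)) (sym ξ-ξ′)) (trans difference ξ-ξ′)) ⟩
          QK.norm ω                                  ≡⟨ norm-ω ⟩
          L.- sL.⟦ C ⟧                               ∎)))))
      where
      open ≡-Reasoning
      C = c - fromℤ (+ 2) * δ
      κ = x + (c + δ) * z
      F = κ * κ - y * y * (c + fromℤ (+ 2) * δ)
      δL = sL.⟦ δ ⟧
      δL² : δL L.* δL ≡ L.1#
      δL² = trans (sym (sL.*-homo δ δ)) (cong sL.⟦_⟧ δ²)
      e = δL L.* θ̄
      w = L.1# L.- e
      ω = L.0# , w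
      η = sL.⟦ y ⟧ L.* (L.1# L.+ e)
      k = sL.⟦ κ ⟧ , η
      σ = twistedHom QL.quadratic θ QL.conj e (twist-square QL.quadratic δL² θθ̄)
      module σ = Hom σ
      h = quotient σ

      conjL-0 : conjL.⟦ L.0# ⟧ ≡ L.0#
      conjL-0 = HomProperties.0-homo QL.conj

      conjL-scalar : ∀ a → conjL.⟦ sL.⟦ a ⟧ ⟧ ≡ sL.⟦ a ⟧
      conjL-scalar = conj-scalar R c

      σ-scalar : ∀ a → σ.⟦ s a ⟧ ≡ s a
      σ-scalar a = cong₂ _,_ (conjL-scalar a) (trans (cong (e L.*_) conjL-0) (L.zeroʳ e))

      conjL-linear : ∀ x z → conjL.⟦ x , z ⟧ ≡ sL.⟦ x ⟧ L.+ sL.⟦ z ⟧ L.* θ̄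
      conjL-linear x z = trans (cong conjL.⟦_⟧ (linear x z)) (trans (conjL.+-homo _ _) (cong₂ L._+_ (conjL-scalar x)
        (trans (conjL.*-homo _ θ) (cong (L._* θ̄) (conjL-scalar z)))))

      ξ-ξ′ : ξ OK.- σ.⟦ ξ ⟧ ≡ ω
      ξ-ξ′ = cong₂ _,_ (trans (cong (λ e → L.0# L.- e) conjL-0) (L.-‿inverseʳ L.0#))
        (cong (λ e → L.1# L.- e) (trans (cong (e L.*_) conjL.1-homo) (L.*-identityʳ e)))

      sL-sum : ∀ a b d → sL.⟦ a + b * d ⟧ ≡ sL.⟦ a ⟧ L.+ sL.⟦ b ⟧ L.* sL.⟦ d ⟧
      sL-sum a b d = trans (sL.+-homo a _) (cong (λ e → sL.⟦ a ⟧ L.+ e) (sL.*-homo b d))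

      κ≡ : sL.⟦ κ ⟧ ≡ sL.⟦ x ⟧ L.+ (θ L.+ θ̄ L.+ δL) L.* sL.⟦ z ⟧
      κ≡ = trans (sL-sum x (c + δ) z) (cong (λ e → sL.⟦ x ⟧ L.+ e L.* sL.⟦ z ⟧) (trans (sL.+-homo c δ) (cong (L._+ δL) (sym θ+θ̄))))

      α-α′ : α OK.- σ.⟦ α ⟧ ≡ (ξ OK.- σ.⟦ ξ ⟧) OK.* k
      α-α′ = begin
        α OK.- σ.⟦ α ⟧
          ≡⟨ cong₂ _,_ (trans (cong₂ L._-_ (trans (linear 0# y) (L.+-identityˡ _)) (trans (conjL-linear 0# y) (L.+-identityˡ _)))
                         (twisted-difference₁ QL.quadratic δL² θθ̄ sL.⟦ y ⟧))
                       (trans (cong₂ (λ a b → a L.- e L.* b) (linear x z) (conjL-linear x z))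
                         (trans (twisted-difference₂ QL.quadratic δL² θθ̄ sL.⟦ x ⟧ sL.⟦ z ⟧) (cong (w L.*_) (sym κ≡)))) ⟩
        (θ L.* (w L.* η) , w L.* sL.⟦ κ ⟧)   ≡⟨ sym (pure-multiple QL.quadratic θ w sL.⟦ κ ⟧ η) ⟩
        ω OK.* k                             ≡⟨ cong (OK._* k) (sym ξ-ξ′) ⟩
        (ξ OK.- σ.⟦ ξ ⟧) OK.* k              ∎

      difference : (ξ OK.- σ.⟦ ξ ⟧) OK.* (k OK.* h) ≡ ξ OK.- σ.⟦ ξ ⟧
      difference = cubic-difference QK.quadratic (s a0) (s a1) (s a2) (s a3)
        {α} {σ.⟦ α ⟧} {ξ} {σ.⟦ ξ ⟧} {k} power-basis (conjugate σ σ-scalar) α-α′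

      2δ : L.fromℤ (+ 2) L.* δL ≡ sL.⟦ fromℤ (+ 2) * δ ⟧
      2δ = trans (QL.fromℤ-quad-* (+ 2) δ 0#) (cong (fromℤ (+ 2) * δ ,_) (zeroʳ _))

      norm-ω : QK.norm ω ≡ L.- sL.⟦ C ⟧
      norm-ω = trans (pure-norm QL.quadratic θ w) (cong L.-_ (trans (twisted-norm₋ QL.quadratic δL² θθ̄)
        (trans (cong₂ L._-_ θ+θ̄ 2δ) (sym (trans (sL.+-homo c _) (cong (λ e → sL.⟦ c ⟧ L.+ e) (HomProperties.-‿homo QL.scalar _)))))))

      norm-k : QK.norm k ≡ sL.⟦ F ⟧
      norm-k = trans (sqrt-norm QL.quadratic θ sL.⟦ κ ⟧ η) (trans (cong₂ L._-_ (sym (sL.*-homo κ κ))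
        (trans (twisted-norm₊ QL.quadratic δL² θθ̄ sL.⟦ y ⟧) (trans (cong₂ L._*_ (sym (sL.*-homo y y)) (trans (cong₂ L._+_ θ+θ̄ 2δ) (sym (sL.+-homo c _))))
          (sym (sL.*-homo (y * y) _)))))
        (sym (trans (sL.+-homo _ _) (cong (λ e → sL.⟦ κ * κ ⟧ L.+ e) (HomProperties.-‿homo QL.scalar _)))))

-- Squares and units in ℤ[i]

unit : Fin 4 → GZ
unit zero                   = 1ᶻ
unit (suc zero)             = -ᶻ 1ᶻ
unit (suc (suc zero))       = iᶻ
unit (suc (suc (suc zero))) = -ᶻ iᶻ

square-abs : ∀ i → i ℤ.* i ≡ + (ℤ.∣ i ∣ ℕ.* ℤ.∣ i ∣)
square-abs (+ n)    = sym (ℤ.pos-* n n)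
square-abs -[1+ n ] = refl

normℕ : GZ → ℕ
normℕ (a , b) = ℤ.∣ a ∣ ℕ.* ℤ.∣ a ∣ ℕ.+ ℤ.∣ b ∣ ℕ.* ℤ.∣ b ∣

normᶻ-normℕ : ∀ x → normᶻ x ≡ + normℕ x
normᶻ-normℕ (a , b) = cong₂ ℤ._+_ (square-abs a) (square-abs b)

module _ (R : Ring) where
  open Ring R
  open Solver R

  gaussian-norm-* : ∀ a b c d → (a * c - b * d) * (a * c - b * d) + (a * d + b * c) * (a * d + b * c)
                  ≡ (a * a + b * b) * (c * c + d * d)
  gaussian-norm-* = solve 4 (λ a b c d → (a :* c :- b :* d) :* (a :* c :- b :* d) :+ (a :* d :+ b :* c) :* (a :* d :+ b :* c)
    := (a :* a :+ b :* b) :* (c :* c :+ d :* d)) refl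

normℕ-* : ∀ x y → normℕ (x *ᶻ y) ≡ normℕ x ℕ.* normℕ y
normℕ-* x@(a , b) y@(c , d) = ℤ.+-injective (begin
  + normℕ (x *ᶻ y)             ≡⟨ sym (normᶻ-normℕ (x *ᶻ y)) ⟩
  normᶻ (x *ᶻ y)               ≡⟨ gaussian-norm-* ℤ-ring a b c d ⟩
  normᶻ x ℤ.* normᶻ y          ≡⟨ cong₂ ℤ._*_ (normᶻ-normℕ x) (normᶻ-normℕ y) ⟩
  + normℕ x ℤ.* + normℕ y      ≡⟨ sym (ℤ.pos-* (normℕ x) (normℕ y)) ⟩
  + (normℕ x ℕ.* normℕ y)      ∎)
  where open ≡-Reasoning

normℕ≡0 : ∀ x → normℕ x ≡ 0 → x ≡ 0ᶻ
normℕ≡0 (a , b) eq = cong₂ _,_ (ℤ.∣i∣≡0⇒i≡0 (root (ℕ.m+n≡0⇒m≡0 _ eq))) (ℤ.∣i∣≡0⇒i≡0 (root (ℕ.m+n≡0⇒n≡0 (ℤ.∣ a ∣ ℕ.* ℤ.∣ a ∣) eq)))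
  where
  root : ∀ {n} → n ℕ.* n ≡ 0 → n ≡ 0
  root {zero} _ = refl

normℕ≡1 : ∀ x → normℕ x ≡ 1 → Σ (Fin 4) λ k → x ≡ unit k
normℕ≡1 (+ 1 , + 0) _ = # 0 , refl
normℕ≡1 (-[1+ 0 ] , + 0) _ = # 1 , refl
normℕ≡1 (+ 0 , + 1) _ = # 2 , refl
normℕ≡1 (+ 0 , -[1+ 0 ]) _ = # 3 , refl
normℕ≡1 (+ 0 , + 0) ()
normℕ≡1 (+ 0 , + suc (suc _)) ()
normℕ≡1 (+ 0 , -[1+ suc _ ]) ()
normℕ≡1 (+ 1 , + suc _) ()
normℕ≡1 (+ 1 , -[1+ _ ]) ()
normℕ≡1 (+ suc (suc _) , _) ()
normℕ≡1 (-[1+ 0 ] , + suc _) ()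
normℕ≡1 (-[1+ 0 ] , -[1+ _ ]) ()
normℕ≡1 (-[1+ suc _ ] , _) ()

unit-classification : ∀ u v → u *ᶻ v ≡ 1ᶻ → Σ (Fin 4) λ k → u ≡ unit k
unit-classification u v uv≡1 = normℕ≡1 u (ℕ.m*n≡1⇒m≡1 (normℕ u) (normℕ v) (trans (sym (normℕ-* u v)) (cong normℕ uv≡1)))

module GR = Ring GZ-ring

GZ-domain : ∀ x y → x *ᶻ y ≡ 0ᶻ → x ≡ 0ᶻ ⊎ y ≡ 0ᶻ
GZ-domain x y xy≡0 = [ inj₁ ∘ normℕ≡0 x , inj₂ ∘ normℕ≡0 y ]′
  (ℕ.m*n≡0⇒m≡0∨n≡0 (normℕ x) (trans (sym (normℕ-* x y)) (cong normℕ xy≡0)))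

module _ (R : Ring) where
  open Ring R
  open Solver R

  difference-zero : ∀ a b → a - b ≡ 0# → a ≡ b
  difference-zero a b eq = trans (solve 2 (λ a b → a := (a :- b) :+ b) refl a b) (trans (cong (_+ b) eq) (+-identityˡ b))

  *-difference : ∀ c a b → c * a ≡ c * b → c * (a - b) ≡ 0#
  *-difference c a b eq = trans (solve 3 (λ c a b → c :* (a :- b) := c :* a :- c :* b) refl c a b)
    (trans (cong (_- c * b) eq) (-‿inverseʳ _))

  difference-of-squares : ∀ a b → a * a ≡ b * b → (a - b) * (a - - b) ≡ 0#
  difference-of-squares a b eq = trans (solve 2 (λ a b → (a :- b) :* (a :- :- b) := a :* a :- b :* b) refl a b)
    (trans (cong (_- b * b) eq) (-‿inverseʳ _))

GZ-cancel : ∀ c a b → c ≢ 0ᶻ → c *ᶻ a ≡ c *ᶻ b → a ≡ b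
GZ-cancel c a b c≢0 eq = [ ⊥-elim ∘ c≢0 , difference-zero GZ-ring a b ]′ (GZ-domain c (a GR.- b) (*-difference GZ-ring c a b eq))

square-roots : ∀ a b → a *ᶻ a ≡ b *ᶻ b → a ≡ b ⊎ a ≡ -ᶻ b
square-roots a b eq = [ inj₁ ∘ difference-zero GZ-ring a b , inj₂ ∘ difference-zero GZ-ring a (-ᶻ b) ]′
  (GZ-domain (a GR.- b) (a GR.- (-ᶻ b)) (difference-of-squares GZ-ring a b eq))

-- Refuting squares in ℤ[i] by evaluation

-- Boolean instead of decidable quantification: the search evaluates without building proofs, and
-- soundness is proved once.
all< : ℕ → (ℕ → Bool) → Bool
all< zero    p = true
all< (suc n) p = p n ∧ all< n p

all<-sound : ∀ n p → T (all< n p) → ∀ {i} → i ℕ.< n → T (p i)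
all<-sound (suc n) p h {i} i<1+n with Equivalence.to Bool.T-∧ h | ℕ.m≤n⇒m<n∨m≡n (ℕ.≤-pred i<1+n)
... | _  , hn | inj₁ i<n  = all<-sound n p hn i<n
... | pn , _  | inj₂ refl = pn

strictlyBetweenSquares : ℕ → ℕ → Bool
strictlyBetweenSquares s n = (s ℕ.* s ℕ.<ᵇ n) ∧ (n ℕ.<ᵇ suc s ℕ.* suc s)

strictlyBetweenSquares-sound : ∀ s m → ¬ T (strictlyBetweenSquares s (m ℕ.* m))
strictlyBetweenSquares-sound s m h with Equivalence.to (Bool.T-∧ {s ℕ.* s ℕ.<ᵇ m ℕ.* m}) h
... | lower , upper = ℕ.<⇒≱ (root-< s m (ℕ.<ᵇ⇒< _ _ lower)) (ℕ.≤-pred (root-< m (suc s) (ℕ.<ᵇ⇒< _ _ upper)))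
  where
  root-< : ∀ a b → a ℕ.* a ℕ.< b ℕ.* b → a ℕ.< b
  root-< a b a²<b² = ℕ.≰⇒> (λ b≤a → ℕ.<⇒≱ a²<b² (ℕ.*-mono-≤ b≤a b≤a))

-- Newton's iteration for ⌊√n⌋; its result is only used through checks that do not trust it.
newton : ℕ → ℕ → ℕ → ℕ
newton zero       n s         = s
newton (suc fuel) n zero      = zero
newton (suc fuel) n s@(suc _) = if s ℕ.* s ℕ.≤ᵇ n then s else newton fuel n ((s ℕ.+ n ℕ./ s) ℕ./ 2)

isOdd : ℕ → Bool
isOdd n = n ℕ.% 2 ℕ.≡ᵇ 1

isOdd-double : ∀ k → ¬ T (isOdd (k ℕ.* 2))
isOdd-double k h = subst (λ r → T (r ℕ.≡ᵇ 1)) (ℕ.m*n%n≡0 k 2) h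

notTwiceSquare : ℕ → Bool
notTwiceSquare n = isOdd n ∨ strictlyBetweenSquares (newton 40 (n ℕ./ 2) (n ℕ./ 2)) (n ℕ./ 2)

notTwiceSquare-sound : ∀ m → ¬ T (notTwiceSquare (m ℕ.* m ℕ.* 2))
notTwiceSquare-sound m h with Equivalence.to (Bool.T-∨ {isOdd (m ℕ.* m ℕ.* 2)}) h
... | inj₁ odd = isOdd-double (m ℕ.* m) odd
... | inj₂ b = strictlyBetweenSquares-sound (newton 40 (m ℕ.* m) (m ℕ.* m)) m
  (subst (λ n → T (strictlyBetweenSquares (newton 40 n n) n)) (ℕ.m*n/n≡m (m ℕ.* m) 2) b)

-- If (p + q i)² = a + b i, then p² + q² is the root s of the norm and s + a = 2 p².
nonSquareWithRoot : ℤ → ℕ → ℕ → Bool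
nonSquareWithRoot a n s = strictlyBetweenSquares s n ∨ ((s ℕ.* s ℕ.≡ᵇ n) ∧ notTwiceSquare ℤ.∣ + s ℤ.+ a ∣)

nonSquareWithNorm : ℕ → ℤ → ℕ → Bool
nonSquareWithNorm guess a n = nonSquareWithRoot a n (newton 40 n guess)

-- A one-sided test: `true` rules out a square, `false` asserts nothing. It starts from the fact
-- that the imaginary part 2 p q of (p + q i)² is even.
nonSquare : ℕ → GZ → Bool
nonSquare guess x@(a , b) = isOdd ℤ.∣ b ∣ ∨ nonSquareWithNorm guess a (normℕ x)

module _ (R : Ring) where
  open Ring R
  open Solver R

  norm+real : ∀ p q → (p * p + q * q) + (p * p - q * q) ≡ p * p * fromℤ (+ 2)
  norm+real = solve 2 (λ p q → (p :* p :+ q :* q) :+ (p :* p :- q :* q) := p :* p :* con (+ 2)) refl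

  double-product : ∀ p q → p * q + q * p ≡ p * q * fromℤ (+ 2)
  double-product = solve 2 (λ p q → p :* q :+ q :* p := p :* q :* con (+ 2)) refl

nonSquare-sound : ∀ guess B → ¬ T (nonSquare guess (B *ᶻ B))
nonSquare-sound guess B@(p , q) h with Equivalence.to (Bool.T-∨ {isOdd ℤ.∣ p ℤ.* q ℤ.+ q ℤ.* p ∣}) h
... | inj₁ odd = isOdd-double ℤ.∣ p ℤ.* q ∣ (subst (T ∘ isOdd) (trans (cong ℤ.∣_∣ (double-product ℤ-ring p q)) (ℤ.abs-* (p ℤ.* q) (+ 2))) odd)
... | inj₂ h′ = withRoot (newton 40 (normℕ (B *ᶻ B)) guess) h′
  where
  M = normℕ B
  norm≡ : normℕ (B *ᶻ B) ≡ M ℕ.* M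
  norm≡ = normℕ-* B B
  open ≡-Reasoning

  withRoot : ∀ s → ¬ T (nonSquareWithRoot (p ℤ.* p ℤ.- q ℤ.* q) (normℕ (B *ᶻ B)) s)
  withRoot s h with Equivalence.to (Bool.T-∨ {strictlyBetweenSquares s (normℕ (B *ᶻ B))}) h
  ... | inj₁ between = strictlyBetweenSquares-sound s M (subst (T ∘ strictlyBetweenSquares s) norm≡ between)
  ... | inj₂ h′ with Equivalence.to (Bool.T-∧ {s ℕ.* s ℕ.≡ᵇ normℕ (B *ᶻ B)}) h′
  ... | s²≡N , notTwice = notTwiceSquare-sound ℤ.∣ p ∣ (subst (T ∘ notTwiceSquare) (begin
      ℤ.∣ + s ℤ.+ (p ℤ.* p ℤ.- q ℤ.* q) ∣                       ≡⟨ cong (λ m → ℤ.∣ + m ℤ.+ (p ℤ.* p ℤ.- q ℤ.* q) ∣) s≡M ⟩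
      ℤ.∣ + M ℤ.+ (p ℤ.* p ℤ.- q ℤ.* q) ∣                       ≡⟨ cong (λ m → ℤ.∣ m ℤ.+ (p ℤ.* p ℤ.- q ℤ.* q) ∣) (sym (normᶻ-normℕ B)) ⟩
      ℤ.∣ (p ℤ.* p ℤ.+ q ℤ.* q) ℤ.+ (p ℤ.* p ℤ.- q ℤ.* q) ∣     ≡⟨ cong ℤ.∣_∣ (norm+real ℤ-ring p q) ⟩
      ℤ.∣ p ℤ.* p ℤ.* + 2 ∣                                     ≡⟨ trans (ℤ.abs-* (p ℤ.* p) (+ 2)) (cong (ℕ._* 2) (ℤ.abs-* p p)) ⟩
      ℤ.∣ p ∣ ℕ.* ℤ.∣ p ∣ ℕ.* 2                                 ∎) notTwice)
    where
    square-injective : ∀ m n → m ℕ.* m ≡ n ℕ.* n → m ≡ n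
    square-injective m n eq = ℕ.≤-antisym (ℕ.≮⇒≥ λ n<m → ℕ.<-irrefl (sym eq) (ℕ.*-mono-< n<m n<m)) (ℕ.≮⇒≥ λ m<n → ℕ.<-irrefl eq (ℕ.*-mono-< m<n m<n))

    s≡M : s ≡ M
    s≡M = square-injective s M (trans (ℕ.≡ᵇ⇒≡ _ _ s²≡N) norm≡)

_≟ᶻ_ : (x y : GZ) → Dec (x ≡ y)
_≟ᶻ_ = ×.≡-dec ℤ._≟_ ℤ._≟_

it+2 it-2 : ℕ → GZ
it+2 t = + 2 , + t
it-2 t = ℤ.- + 2 , + t

-- √(t² + 4) is close to t + 2 / t.
rootGuess : ℕ → ℕ → ℕ
rootGuess zero      n = 0
rootGuess t@(suc _) n = n ℕ.* t ℕ.+ (2 ℕ.* n) ℕ./ t ℕ.+ 2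

refutedBy : ℕ → GZ → GZ → GZ → Bool
refutedBy guess V W ε = nonSquare guess (ε +ᶻ V) ∨ nonSquare guess (ε +ᶻ W)

refutedFor : ℕ → GZ → GZ → Bool
refutedFor guess V W = refutedBy guess V W (unit (# 0)) ∧ refutedBy guess V W (unit (# 1))
                     ∧ refutedBy guess V W (unit (# 2)) ∧ refutedBy guess V W (unit (# 3))

-- Kept abstract because unfolding it on variables would unroll Newton's iteration.
abstract
  refuted : ℕ → ℕ → GZ → Bool
  refuted t guess y² = refutedFor guess (y² *ᶻ it+2 t) (y² *ᶻ it-2 t)

-- Points of the box that lie outside the disc, and the origin, pass at once. The point 1 + i is
-- exempt for t = 1, since there both values really are squares for ε = -1.
excluded : ℕ → ℕ → ℕ → Bool
excluded t m n = excludedWith (m ℕ.* m ℕ.+ n ℕ.* n)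
  where
  excludedWith : ℕ → Bool
  excludedWith N = (900 ℕ.<ᵇ N) ∨ (N ℕ.≡ᵇ 0) ∨ ((t ℕ.≡ᵇ 1) ∧ (m ℕ.≡ᵇ 1) ∧ (n ℕ.≡ᵇ 1))
    ∨ refuted t (rootGuess t N) ((+ m , + n) *ᶻ (+ m , + n))

all<³-sound : ∀ k m n (p : ℕ → ℕ → ℕ → Bool) → T (all< k λ x → all< m λ y → all< n λ z → p x y z) →
  ∀ {x y z} → x ℕ.< k → y ℕ.< m → z ℕ.< n → T (p x y z)
all<³-sound k m n p h {x} {y} x<k y<m z<n =
  all<-sound n (p x y) (all<-sound m (λ y → all< n λ z → p x y z) (all<-sound k (λ x → all< m λ y → all< n λ z → p x y z) h x<k) y<m) z<n

abstract
  -- The search is the check that `tt` has the required type: t = 2 k + 1 runs through the odd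
  -- numbers below 100, and m + n i through a quadrant box of side 30.
  exhaustive-search : ∀ {k m n} → k ℕ.< 50 → m ℕ.< 31 → n ℕ.< 31 → T (excluded (suc (2 ℕ.* k)) m n)
  exhaustive-search {k} {m} {n} = all<³-sound 50 31 31 (λ k → excluded (suc (2 ℕ.* k))) tt {k} {m} {n}

refutedFor-sound : ∀ guess V W → T (refutedFor guess V W) → ∀ i B C → B *ᶻ B ≡ unit i +ᶻ V → C *ᶻ C ≡ unit i +ᶻ W → ⊥
refutedFor-sound guess V W h i B C B² C² = [ (λ r → nonSquare-sound guess B (subst (T ∘ nonSquare guess) (sym B²) r))
                                           , (λ r → nonSquare-sound guess C (subst (T ∘ nonSquare guess) (sym C²) r)) ]′
    (Equivalence.to (Bool.T-∨ {nonSquare guess (unit i +ᶻ V)}) (pick i))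
  where
  pick : ∀ i → T (refutedBy guess V W (unit i))
  pick i with Equivalence.to (Bool.T-∧ {refutedBy guess V W (unit (# 0))}) h
  ... | h0 , h′ with Equivalence.to (Bool.T-∧ {refutedBy guess V W (unit (# 1))}) h′
  ... | h1 , h″ with Equivalence.to (Bool.T-∧ {refutedBy guess V W (unit (# 2))}) h″
  ... | h2 , h3 with i
  ... | zero                   = h0
  ... | suc zero               = h1
  ... | suc (suc zero)         = h2
  ... | suc (suc (suc zero))   = h3

abstract
  refuted-sound : ∀ t guess Y → T (refuted t guess Y) → ∀ i B C →
    B *ᶻ B ≡ unit i +ᶻ Y *ᶻ it+2 t → C *ᶻ C ≡ unit i +ᶻ Y *ᶻ it-2 t → ⊥
  refuted-sound t guess Y = refutedFor-sound guess (Y *ᶻ it+2 t) (Y *ᶻ it-2 t)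

module _ (R : Ring) where
  open Ring R
  open Solver R

  neg-square : ∀ x → - x * - x ≡ x * x
  neg-square = solve 1 (λ x → :- x :* :- x := x :* x) refl

  -- Multiplying a root by i turns a solution for the unit u and the square y into one for -u and
  -- -y, so the quadrants with y² = -Y reduce to the first.
  square-*i : ∀ i b {u y Y k} → i * i ≡ - 1# → y ≡ - Y → b * b ≡ u + y * k → i * b * (i * b) ≡ - u + Y * k
  square-*i i b {u} {_} {Y} {k} i² refl b² = trans (solve 2 (λ i b → i :* b :* (i :* b) := i :* i :* (b :* b)) refl i b)
    (trans (cong₂ _*_ i² b²) (solve 3 (λ u Y k → :- con (+ 1) :* (u :+ :- Y :* k) := :- u :+ Y :* k) refl u Y k))

  square-swap : ∀ m n → (m * m - - n * - n , m * - n + - n * m) ≡ (- (n * n - m * m) , - (n * m + m * n))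
  square-swap m n = cong₂ _,_
    (solve 2 (λ m n → m :* m :- :- n :* :- n := :- (n :* n :- m :* m)) refl m n)
    (solve 2 (λ m n → m :* :- n :+ :- n :* m := :- (n :* m :+ m :* n)) refl m n)

-- Up to a power of i, y lies in the first quadrant.
square-normalised : ∀ a b → let m = ℤ.∣ a ∣; n = ℤ.∣ b ∣ in
  ((a , b) *ᶻ (a , b) ≡ (+ m , + n) *ᶻ (+ m , + n)) ⊎ ((a , b) *ᶻ (a , b) ≡ -ᶻ ((+ n , + m) *ᶻ (+ n , + m)))
square-normalised (+ m)    (+ n)        = inj₁ refl
square-normalised (+ m)    b@(-[1+ n ]) = inj₂ (square-swap ℤ-ring (+ m) (+ suc n))
square-normalised -[1+ m ] (+ n)        = inj₂ (trans (sym (neg-square GZ-ring (-[1+ m ] , + n))) (square-swap ℤ-ring (+ suc m) (+ n)))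
square-normalised -[1+ m ] -[1+ n ]     = inj₁ (sym (neg-square GZ-ring (-[1+ m ] , -[1+ n ])))

neg-unit : ∀ i → Σ (Fin 4) λ j → -ᶻ unit i ≡ unit j
neg-unit zero                   = # 1 , refl
neg-unit (suc zero)             = # 0 , refl
neg-unit (suc (suc zero))       = # 3 , refl
neg-unit (suc (suc (suc zero))) = # 2 , refl

Sporadic : ℕ → GZ → Set
Sporadic t (a , b) = t ≡ 1 × ℤ.∣ a ∣ ≡ 1 × ℤ.∣ b ∣ ≡ 1

excluded-sound : ∀ t m n → let N = m ℕ.* m ℕ.+ n ℕ.* n in N ℕ.≤ 900 → N ≢ 0 → T (excluded t m n) →
  Sporadic t (+ m , + n) ⊎ T (refuted t (rootGuess t N) ((+ m , + n) *ᶻ (+ m , + n)))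
excluded-sound t m n small N≢0 h with Equivalence.to (Bool.T-∨ {900 ℕ.<ᵇ m ℕ.* m ℕ.+ n ℕ.* n}) h
... | inj₁ large = ⊥-elim (ℕ.<⇒≱ (ℕ.<ᵇ⇒< 900 (m ℕ.* m ℕ.+ n ℕ.* n) large) small)
... | inj₂ h₁ with Equivalence.to (Bool.T-∨ {m ℕ.* m ℕ.+ n ℕ.* n ℕ.≡ᵇ 0}) h₁
... | inj₁ zero-norm = ⊥-elim (N≢0 (ℕ.≡ᵇ⇒≡ (m ℕ.* m ℕ.+ n ℕ.* n) 0 zero-norm))
... | inj₂ h₂ with Equivalence.to (Bool.T-∨ {(t ℕ.≡ᵇ 1) ∧ (m ℕ.≡ᵇ 1) ∧ (n ℕ.≡ᵇ 1)}) h₂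
... | inj₂ r = inj₂ r
... | inj₁ sporadic =
      let (t≡1 , h₃) = Equivalence.to (Bool.T-∧ {t ℕ.≡ᵇ 1}) sporadic
          (m≡1 , n≡1) = Equivalence.to (Bool.T-∧ {m ℕ.≡ᵇ 1}) h₃
      in inj₁ (ℕ.≡ᵇ⇒≡ t 1 t≡1 , ℕ.≡ᵇ⇒≡ m 1 m≡1 , ℕ.≡ᵇ⇒≡ n 1 n≡1)

no-solutions : ∀ k → k ℕ.< 50 → ∀ y → normℕ y ℕ.≤ 900 → y ≢ 0ᶻ → ∀ i B C → let t = suc (2 ℕ.* k) in
  B *ᶻ B ≡ unit i +ᶻ y *ᶻ y *ᶻ it+2 t → C *ᶻ C ≡ unit i +ᶻ y *ᶻ y *ᶻ it-2 t → Sporadic t y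
no-solutions k k<50 y@(a , b) small y≢0 i B C B² C² = [ first-quadrant , other-quadrants ]′ (square-normalised a b)
  where
  t = suc (2 ℕ.* k)
  m = ℤ.∣ a ∣
  n = ℤ.∣ b ∣

  -- The summands 901 and 60 make up 31².
  bound : ∀ m → m ℕ.* m ℕ.≤ 900 → m ℕ.< 31
  bound m m²≤900 = ℕ.≰⇒> (λ 31≤m → ℕ.<⇒≱ (ℕ.s≤s m²≤900) (ℕ.≤-trans (ℕ.m≤m+n 901 60) (ℕ.*-mono-≤ 31≤m 31≤m)))

  m<31 : m ℕ.< 31
  m<31 = bound m (ℕ.m+n≤o⇒m≤o (m ℕ.* m) small)

  n<31 : n ℕ.< 31
  n<31 = bound n (ℕ.m+n≤o⇒n≤o (m ℕ.* m) small)

  swap-norm : n ℕ.* n ℕ.+ m ℕ.* m ≡ normℕ y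
  swap-norm = ℕ.+-comm (n ℕ.* n) (m ℕ.* m)

  first-quadrant : y *ᶻ y ≡ (+ m , + n) *ᶻ (+ m , + n) → Sporadic t y
  first-quadrant y²≡ = [ id , (λ r → ⊥-elim (contradiction _ y²≡ r)) ]′
      (excluded-sound t m n small (y≢0 ∘ normℕ≡0 y) (exhaustive-search {k} {m} {n} k<50 m<31 n<31))
    where
    contradiction : ∀ Y → y *ᶻ y ≡ Y → T (refuted t (rootGuess t (normℕ y)) Y) → ⊥
    contradiction Y refl r = refuted-sound t (rootGuess t (normℕ y)) Y r i B C B² C²

  other-quadrants : y *ᶻ y ≡ -ᶻ ((+ n , + m) *ᶻ (+ n , + m)) → Sporadic t y
  other-quadrants y²≡ = [ (λ (t≡1 , n≡1 , m≡1) → t≡1 , m≡1 , n≡1) , (λ r → ⊥-elim (contradiction ((+ n , + m) *ᶻ (+ n , + m)) y²≡ r (neg-unit i))) ]′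
      (excluded-sound t n m (subst (ℕ._≤ 900) (sym swap-norm) small) (λ N≡0 → y≢0 (normℕ≡0 y (trans (sym swap-norm) N≡0)))
        (exhaustive-search {k} {n} {m} k<50 n<31 m<31))
    where
    guess = rootGuess t (n ℕ.* n ℕ.+ m ℕ.* m)
    contradiction : ∀ Y → y *ᶻ y ≡ -ᶻ Y → T (refuted t guess Y) → Σ (Fin 4) (λ j → -ᶻ unit i ≡ unit j) → ⊥
    contradiction Y y²≡ r (j , -u≡) = refuted-sound t guess Y r j (iᶻ *ᶻ B) (iᶻ *ᶻ C)
      (trans (square-*i GZ-ring iᶻ B {unit i} {y *ᶻ y} {Y} {it+2 t} refl y²≡ B²) (cong (_+ᶻ Y *ᶻ it+2 t) -u≡))
      (trans (square-*i GZ-ring iᶻ C {unit i} {y *ᶻ y} {Y} {it-2 t} refl y²≡ C²) (cong (_+ᶻ Y *ᶻ it-2 t) -u≡))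

-- Solving the index form equation

module _ (R : Ring) where
  open Ring R
  open Solver R

  Fδ : (c δ x y z : Carrier) → Carrier
  Fδ c δ x y z = (x + (c + δ) * z) * (x + (c + δ) * z) - y * y * (c + fromℤ (+ 2) * δ)

  -- Written as the norm of x + z θ unfolds, hence the double negation.
  F₁ : (c x z : Carrier) → Carrier
  F₁ c x z = x * x + c * (x * z) + - (- 1# * (z * z))

  factors-relation : ∀ c x y z →
    (fromℤ (+ 2) - c) * Fδ c 1# x y z + (fromℤ (+ 2) + c) * Fδ c (- 1#) x y z ≡ fromℤ (+ 4) * F₁ c x z
  factors-relation = solve 4 (λ c x y z →
    (con (+ 2) :- c) :* ((x :+ (c :+ con (+ 1)) :* z) :* (x :+ (c :+ con (+ 1)) :* z) :- y :* y :* (c :+ con (+ 2) :* con (+ 1)))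
    :+ (con (+ 2) :+ c) :* ((x :+ (c :+ :- con (+ 1)) :* z) :* (x :+ (c :+ :- con (+ 1)) :* z) :- y :* y :* (c :+ con (+ 2) :* :- con (+ 1)))
    := con (+ 4) :* (x :* x :+ c :* (x :* z) :+ :- (:- con (+ 1) :* (z :* z)))) refl

  UnitRelation : (c u v w : Carrier) → Set
  UnitRelation c u v w = (fromℤ (+ 2) - c) * u + (fromℤ (+ 2) + c) * v ≡ fromℤ (+ 4) * w

  unit-relation : ∀ c x y z {u v w} → Fδ c 1# x y z ≡ u → Fδ c (- 1#) x y z ≡ v → F₁ c x z ≡ w → UnitRelation c u v w
  unit-relation c x y z refl refl refl = factors-relation c x y z

  -- F₊ - F₋ = 4 (z (x + c z) - y²).
  factors-difference : ∀ c x y z → Fδ c 1# x y z ≡ Fδ c (- 1#) x y z → fromℤ (+ 4) * (y * y) ≡ fromℤ (+ 4) * (z * (x + c * z))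
  factors-difference c x y z eq = trans
    (solve 4 (λ c x y z → con (+ 4) :* (y :* y) := con (+ 4) :* (z :* (x :+ c :* z))
      :- (((x :+ (c :+ con (+ 1)) :* z) :* (x :+ (c :+ con (+ 1)) :* z) :- y :* y :* (c :+ con (+ 2) :* con (+ 1)))
      :- ((x :+ (c :+ :- con (+ 1)) :* z) :* (x :+ (c :+ :- con (+ 1)) :* z) :- y :* y :* (c :+ con (+ 2) :* :- con (+ 1))))) refl c x y z)
    (trans (cong (λ e → fromℤ (+ 4) * (z * (x + c * z)) - (e - Fδ c (- 1#) x y z)) eq)
      (solve 2 (λ a b → a :- (b :- b) := a) refl (fromℤ (+ 4) * (z * (x + c * z))) (Fδ c (- 1#) x y z)))

  Fδ-square : ∀ c δ x y z {u} → Fδ c δ x y z ≡ u → (x + (c + δ) * z) * (x + (c + δ) * z) ≡ u + y * y * (c + fromℤ (+ 2) * δ)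
  Fδ-square c δ x y z refl = solve 2 (λ a b → a := (a :- b) :+ b) refl _ _

  F₁-z=0 : ∀ c x → F₁ c x 0# ≡ x * x
  F₁-z=0 = solve 2 (λ c x → x :* x :+ c :* (x :* con (+ 0)) :+ :- (:- con (+ 1) :* (con (+ 0) :* con (+ 0))) := x :* x) refl

  F₁-x+cz=0 : ∀ c x z → x + c * z ≡ 0# → F₁ c x z ≡ z * z
  F₁-x+cz=0 c x z eq = trans (solve 3 (λ c x z → x :* x :+ c :* (x :* z) :+ :- (:- con (+ 1) :* (z :* z)) := x :* (x :+ c :* z) :+ z :* z) refl c x z)
    (trans (cong (λ e → x * e + z * z) eq) (solve 2 (λ x z → x :* con (+ 0) :+ z :* z := z :* z) refl x z))

  x-from-A : ∀ c x z v → x + c * z ≡ 0# → v * z ≡ 1# → v * x ≡ - c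
  x-from-A c x z v eq vz = trans (solve 4 (λ c x z v → v :* x := v :* (x :+ c :* z) :- c :* (v :* z)) refl c x z v)
    (trans (cong₂ (λ a b → v * a - c * b) eq vz) (solve 2 (λ v c → v :* con (+ 0) :- c :* con (+ 1) := :- c) refl v c))

  z-difference : ∀ c x z → fromℤ (+ 2) * z ≡ (x + (c + 1#) * z) - (x + (c + - 1#) * z)
  z-difference = solve 3 (λ c x z → con (+ 2) :* z := (x :+ (c :+ con (+ 1)) :* z) :- (x :+ (c :+ :- con (+ 1)) :* z)) refl

  x-difference : ∀ c x z → x ≡ (x + (c + 1#) * z) - (c + 1#) * z
  x-difference = solve 3 (λ c x z → x := (x :+ (c :+ con (+ 1)) :* z) :- (c :+ con (+ 1)) :* z) refl

UnitsAgree : ℕ → Fin 4 → Fin 4 → Fin 4 → Set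
UnitsAgree t i j k = UnitRelation GZ-ring (itᶻ t) (unit i) (unit j) (unit k) → i ≡ j

OddUnitsAgree : ℕ → Set
OddUnitsAgree m = ∀ i j k → UnitsAgree (suc (2 ℕ.* m)) i j k

oddUnitsAgree? : ∀ m → Dec (OddUnitsAgree m)
oddUnitsAgree? m = Fin.all? λ i → Fin.all? λ j → Fin.all? λ k → (_ ≟ᶻ _) →-dec (i Fin.≟ j)

-- The relation reads 2 (u + v) + c (v - u) = 4 w. For odd t it makes u and v congruent modulo 2, so
-- v = ±u; and v = -u would give c u = -2 w, that is t = 2. Here this is checked for each t and all
-- triples of units.
oddUnitsAgree : ∀ {m} → m ℕ.< 50 → OddUnitsAgree m
oddUnitsAgree = toWitness {a? = ℕ.allUpTo? oddUnitsAgree? 50} _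

it-2δ≢0 : ∀ t δ → proj₂ (GR.fromℤ (+ 2) *ᶻ δ) ≡ + 0 → 1 ℕ.≤ t → itᶻ t GR.- GR.fromℤ (+ 2) *ᶻ δ ≢ 0ᶻ
it-2δ≢0 t δ im≡0 1≤t eq = ℕ.>⇒≢ 1≤t (ℤ.+-injective (trans (sym (ℤ.+-identityʳ (+ t))) (trans (cong (λ e → + t ℤ.- e) (sym im≡0)) (cong proj₂ eq))))

it+2≡ : ∀ t → itᶻ t +ᶻ GR.fromℤ (+ 2) *ᶻ 1ᶻ ≡ it+2 t
it+2≡ t = cong (+ 2 ,_) (ℤ.+-identityʳ (+ t))

it-2≡ : ∀ t → itᶻ t +ᶻ GR.fromℤ (+ 2) *ᶻ -ᶻ 1ᶻ ≡ it-2 t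
it-2≡ t = cong (ℤ.- + 2 ,_) (ℤ.+-identityʳ (+ t))

module _ (t : ℕ) where
  open Tower t
  open PowerGenerators t

  obtained : ∀ u v x y z x′ y′ z′ → u *ᶻ v ≡ 1ᶻ → u *ᶻ x ≡ x′ → u *ᶻ y ≡ y′ → u *ᶻ z ≡ z′ →
    ObtainedFrom t (elemXYZ x y z) (elemXYZ x′ y′ z′)
  obtained u v x y z _ _ _ uv≡1 refl refl refl = u , (v , uv≡1) , 0ᶻ , sym (begin
    addK (mulK t (embed (s u)) (embed (xyz x y z))) (embed Z.0#)   ≡⟨ cong (λ e → addK e (embed Z.0#)) (embed-* (s u) (xyz x y z)) ⟩
    addK (embed (s u Z.* xyz x y z)) (embed Z.0#)                  ≡⟨ embed-+ (s u Z.* xyz x y z) Z.0# ⟩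
    embed (s u Z.* xyz x y z Z.+ Z.0#)                             ≡⟨ cong embed (Z.+-identityʳ (s u Z.* xyz x y z)) ⟩
    embed (s u Z.* xyz x y z)                                      ≡⟨ cong embed (s-* u 0ᶻ x y z) ⟩
    embed ⟨ u *ᶻ 0ᶻ , u *ᶻ x , u *ᶻ y , u *ᶻ z ⟩                   ≡⟨ cong (λ e → embed ⟨ e , u *ᶻ x , u *ᶻ y , u *ᶻ z ⟩) (GR.zeroʳ u) ⟩
    embed (xyz (u *ᶻ x) (u *ᶻ y) (u *ᶻ z))                         ∎)
    where open ≡-Reasoning

  EquivalentToListed : GZ → GZ → GZ → Set
  EquivalentToListed x y z = Σ K λ β → Listed t β × Equivalent t (elemXYZ x y z) β

  private module IF = IndexForm GZ-ring (itᶻ t)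

  ξ-combination : ∀ x y z → IsPowerGen t (elemXYZ x y z) → InO t ξK → Σ OZ λ a → powerCombine (xyz x y z) a ≡ xyz 1ᶻ 0ᶻ 0ᶻ
  ξ-combination x y z (_ , spanning , _) ξ∈O = from (spanning ξK ξ∈O)
    where
    embed-xyz : embed (xyz x y z) ≡ elemXYZ x y z
    embed-xyz = refl

    from : (Σ GZ λ a0 → Σ GZ λ a1 → Σ GZ λ a2 → Σ GZ λ a3 → linComb t (elemXYZ x y z) a0 a1 a2 a3 ≡ ξK) →
      Σ OZ λ a → powerCombine (xyz x y z) a ≡ xyz 1ᶻ 0ᶻ 0ᶻ
    from (a0 , a1 , a2 , a3 , comb) = ((a0 , a2) , (a1 , a3)) , embed-injective {powerCombine (xyz x y z) ((a0 , a2) , (a1 , a3))} {xyz 1ᶻ 0ᶻ 0ᶻ}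
      (trans (sym (linComb-embed (xyz x y z) a0 a1 a2 a3)) (trans (cong (λ α → linComb t α a0 a1 a2 a3) embed-xyz) comb))

  FactorsAreUnits : GZ → GZ → GZ → Set
  FactorsAreUnits x y z =
    (Σ GZ λ m → F₁ GZ-ring (itᶻ t) x z *ᶻ m ≡ 1ᶻ)
    × (Σ GZ λ m → Fδ GZ-ring (itᶻ t) 1ᶻ x y z *ᶻ m ≡ 1ᶻ)
    × (Σ GZ λ m → Fδ GZ-ring (itᶻ t) (-ᶻ 1ᶻ) x y z *ᶻ m ≡ 1ᶻ)

  index-form-units : 1 ℕ.≤ t → ∀ x y z → IsPowerGen t (elemXYZ x y z) → InO t ξK → FactorsAreUnits x y z
  index-form-units 1≤t x y z gen ξ∈O = from (ξ-combination x y z gen ξ∈O)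
    where
    cancel₂ : ∀ a b → IF.L.fromℤ (+ 2) IF.L.* a ≡ IF.L.fromℤ (+ 2) IF.L.* b → a ≡ b
    cancel₂ (a , a′) (b , b′) eq = cong₂ _,_ (GZ-cancel (GR.fromℤ (+ 2)) a b (λ ()) (cong proj₁ eq′)) (GZ-cancel (GR.fromℤ (+ 2)) a′ b′ (λ ()) (cong proj₂ eq′))
      where
      eq′ : (GR.fromℤ (+ 2) *ᶻ a , GR.fromℤ (+ 2) *ᶻ a′) ≡ (GR.fromℤ (+ 2) *ᶻ b , GR.fromℤ (+ 2) *ᶻ b′)
      eq′ = trans (sym (IF.QL.fromℤ-quad-* (+ 2) a a′)) (trans eq (IF.QL.fromℤ-quad-* (+ 2) b b′))

    cancelδ : ∀ δ → proj₂ (GR.fromℤ (+ 2) *ᶻ δ) ≡ + 0 → ∀ a →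
      (itᶻ t GR.- GR.fromℤ (+ 2) *ᶻ δ) *ᶻ a ≡ itᶻ t GR.- GR.fromℤ (+ 2) *ᶻ δ → a ≡ 1ᶻ
    cancelδ δ im a eq = GZ-cancel (itᶻ t GR.- GR.fromℤ (+ 2) *ᶻ δ) a 1ᶻ (it-2δ≢0 t δ im 1≤t) (trans eq (sym (GR.*-identityʳ (itᶻ t GR.- GR.fromℤ (+ 2) *ᶻ δ))))

    from : (Σ OZ λ a → powerCombine (xyz x y z) a ≡ xyz 1ᶻ 0ᶻ 0ᶻ) → FactorsAreUnits x y z
    from (((a0 , a2) , (a1 , a3)) , ξ≡) =
        IF.F₁-unit x y z a0 a1 a2 a3 ξ≡ cancel₂
      , IF.Fδ-unit x y z a0 a1 a2 a3 ξ≡ 1ᶻ refl (cancelδ 1ᶻ refl)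
      , IF.Fδ-unit x y z a0 a1 a2 a3 ξ≡ (-ᶻ 1ᶻ) refl (cancelδ (-ᶻ 1ᶻ) refl)

  y=0-solutions : ∀ x z m → F₁ GZ-ring (itᶻ t) x z *ᶻ m ≡ 1ᶻ → z *ᶻ (x +ᶻ itᶻ t *ᶻ z) ≡ 0ᶻ → EquivalentToListed x 0ᶻ z
  y=0-solutions x z m F₁m≡1 zA≡0 = [ z≡0 , A≡0 ]′ (GZ-domain z (x +ᶻ itᶻ t *ᶻ z) zA≡0)
    where
    -- In both cases F₁ degenerates to a square w², so w m inverts w.
    inverse : ∀ w → F₁ GZ-ring (itᶻ t) x z ≡ w *ᶻ w → w *ᶻ m *ᶻ w ≡ 1ᶻ
    inverse w F₁≡w² = trans (GR.*-comm (w *ᶻ m) w) (trans (sym (GR.*-assoc w w m)) (trans (cong (_*ᶻ m) (sym F₁≡w²)) F₁m≡1))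

    z≡0 : z ≡ 0ᶻ → EquivalentToListed x 0ᶻ z
    z≡0 refl = elemXYZ 1ᶻ 0ᶻ 0ᶻ , inj₁ refl ,
      inj₁ (obtained (x *ᶻ m) x x 0ᶻ 0ᶻ 1ᶻ 0ᶻ 0ᶻ x⁻¹x x⁻¹x (GR.zeroʳ (x *ᶻ m)) (GR.zeroʳ (x *ᶻ m)))
      where
      x⁻¹x = inverse x (F₁-z=0 GZ-ring (itᶻ t) x)

    A≡0 : x +ᶻ itᶻ t *ᶻ z ≡ 0ᶻ → EquivalentToListed x 0ᶻ z
    A≡0 A≡0 = elemXYZ (minusItᶻ t) 0ᶻ 1ᶻ , inj₂ (inj₁ refl) ,
      inj₁ (obtained (z *ᶻ m) z x 0ᶻ z (minusItᶻ t) 0ᶻ 1ᶻ z⁻¹z (x-from-A GZ-ring (itᶻ t) x z (z *ᶻ m) A≡0 z⁻¹z) (GR.zeroʳ (z *ᶻ m)) z⁻¹z)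
      where
      z⁻¹z = inverse z (F₁-x+cz=0 GZ-ring (itᶻ t) x z A≡0)

open import Data.Nat using (_≤_; _+_; _*_)

-- The sporadic solutions for t = 1

unit-inverse : Fin 4 → GZ
unit-inverse zero                   = 1ᶻ
unit-inverse (suc zero)             = -ᶻ 1ᶻ
unit-inverse (suc (suc zero))       = -ᶻ iᶻ
unit-inverse (suc (suc (suc zero))) = iᶻ

unit-inverse-correct : ∀ k → unit k *ᶻ unit-inverse k ≡ 1ᶻ
unit-inverse-correct zero                   = refl
unit-inverse-correct (suc zero)             = refl
unit-inverse-correct (suc (suc zero))       = refl
unit-inverse-correct (suc (suc (suc zero))) = refl

sporadicX sporadicY sporadicZ : Fin 4 → GZ
sporadicX zero                   = + 3 , + 0
sporadicX (suc zero)             = + 3 , + 0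
sporadicX (suc (suc zero))       = iᶻ
sporadicX (suc (suc (suc zero))) = iᶻ
sporadicY zero                   = onePlusI
sporadicY (suc zero)             = -ᶻ onePlusI
sporadicY (suc (suc zero))       = onePlusI
sporadicY (suc (suc (suc zero))) = -ᶻ onePlusI
sporadicZ zero                   = + 0 , + 2
sporadicZ (suc zero)             = + 0 , + 2
sporadicZ (suc (suc zero))       = 1ᶻ
sporadicZ (suc (suc (suc zero))) = 1ᶻ

sporadic-listed : ∀ l → Listed 1 (elemXYZ (sporadicX l) (sporadicY l) (sporadicZ l))
sporadic-listed zero                   = inj₂ (inj₂ (refl , inj₁ refl))
sporadic-listed (suc zero)             = inj₂ (inj₂ (refl , inj₂ (inj₁ refl)))
sporadic-listed (suc (suc zero))       = inj₂ (inj₂ (refl , inj₂ (inj₂ (inj₁ refl))))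
sporadic-listed (suc (suc (suc zero))) = inj₂ (inj₂ (refl , inj₂ (inj₂ (inj₂ refl))))

Match : GZ → GZ → GZ → Set
Match x y z = Σ (Fin 4) λ k → Σ (Fin 4) λ l →
  (unit k *ᶻ x ≡ sporadicX l) × (unit k *ᶻ y ≡ sporadicY l) × (unit k *ᶻ z ≡ sporadicZ l)

match? : ∀ x y z → Dec (Match x y z)
match? x y z = Fin.any? λ k → Fin.any? λ l → (_ ≟ᶻ _) ×-dec ((_ ≟ᶻ _) ×-dec (_ ≟ᶻ _))

match-equivalent : ∀ x y z → Match x y z → EquivalentToListed 1 x y z
match-equivalent x y z (k , l , ux , uy , uz) = elemXYZ (sporadicX l) (sporadicY l) (sporadicZ l) , sporadic-listed l ,
  inj₁ (obtained 1 (unit k) (unit-inverse k) x y z _ _ _ (unit-inverse-correct k) ux uy uz)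

-- B and C stand for x + (c + 1) z and x + (c − 1) z, whose difference is 2 z.
Recovers : GZ → GZ → GZ → GZ → Set
Recovers y B C z = (B GR.- C ≡ GR.fromℤ (+ 2) *ᶻ z) × Match (B GR.- (itᶻ 1 +ᶻ 1ᶻ) *ᶻ z) y z

recovers? : ∀ y B C z → Dec (Recovers y B C z)
recovers? y B C z = (_ ≟ᶻ _) ×-dec match? _ _ _

recover : ∀ x y z B C z₀ → Recovers y B C z₀ → x +ᶻ (itᶻ 1 +ᶻ 1ᶻ) *ᶻ z ≡ B → x +ᶻ (itᶻ 1 +ᶻ -ᶻ 1ᶻ) *ᶻ z ≡ C → EquivalentToListed 1 x y z
recover x y z B C z₀ (B-C≡2z₀ , match) B≡ C≡ = match-equivalent x y z (subst₂ (λ x z → Match x y z) (sym x≡) (sym z≡) match)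
  where
  z≡ : z ≡ z₀
  z≡ = GZ-cancel (GR.fromℤ (+ 2)) z z₀ (λ ()) (trans (z-difference GZ-ring (itᶻ 1) x z) (trans (cong₂ GR._-_ B≡ C≡) B-C≡2z₀))
  x≡ : x ≡ B GR.- (itᶻ 1 +ᶻ 1ᶻ) *ᶻ z₀
  x≡ = trans (x-difference GZ-ring (itᶻ 1) x z) (cong₂ (λ b z → b GR.- (itᶻ 1 +ᶻ 1ᶻ) *ᶻ z) B≡ z≡)

-- The two square roots are known only up to independent signs. Here z₋ and z₊ stand for (B - C)/2
-- and (B + C)/2, which with their negatives are the values of z for the four choices.
AllSigns : GZ → GZ → GZ → GZ → GZ → Set
AllSigns y B C z₋ z₊ = (Recovers y B C z₋ × Recovers y B (-ᶻ C) z₊) × (Recovers y (-ᶻ B) C (-ᶻ z₊) × Recovers y (-ᶻ B) (-ᶻ C) (-ᶻ z₋))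

allSigns? : ∀ y B C z₋ z₊ → Dec (AllSigns y B C z₋ z₊)
allSigns? y B C z₋ z₊ = (recovers? y B C z₋ ×-dec recovers? y B (-ᶻ C) z₊) ×-dec (recovers? y (-ᶻ B) C (-ᶻ z₊) ×-dec recovers? y (-ᶻ B) (-ᶻ C) (-ᶻ z₋))

recoverAll : ∀ x y z B C z₋ z₊ → AllSigns y B C z₋ z₊ → let b = x +ᶻ (itᶻ 1 +ᶻ 1ᶻ) *ᶻ z; c = x +ᶻ (itᶻ 1 +ᶻ -ᶻ 1ᶻ) *ᶻ z in
  b *ᶻ b ≡ B *ᶻ B → c *ᶻ c ≡ C *ᶻ C → EquivalentToListed 1 x y z
recoverAll x y z B C z₋ z₊ ((r₁ , r₂) , (r₃ , r₄)) b² c² = signs (square-roots b B b²) (square-roots c C c²)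
  where
  b = x +ᶻ (itᶻ 1 +ᶻ 1ᶻ) *ᶻ z
  c = x +ᶻ (itᶻ 1 +ᶻ -ᶻ 1ᶻ) *ᶻ z
  signs : b ≡ B ⊎ b ≡ -ᶻ B → c ≡ C ⊎ c ≡ -ᶻ C → EquivalentToListed 1 x y z
  signs (inj₁ b≡) (inj₁ c≡) = recover x y z B C z₋ r₁ b≡ c≡
  signs (inj₁ b≡) (inj₂ c≡) = recover x y z B (-ᶻ C) z₊ r₂ b≡ c≡
  signs (inj₂ b≡) (inj₁ c≡) = recover x y z (-ᶻ B) C (-ᶻ z₊) r₃ b≡ c≡
  signs (inj₂ b≡) (inj₂ c≡) = recover x y z (-ᶻ B) (-ᶻ C) (-ᶻ z₋) r₄ b≡ c≡

-- For |y|² = 2 the absolute value of ε + y² (2 + i) is at most 1 + 2 √5 < 6, so Newton's iteration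
-- starts above the root.
Refutes : GZ → Fin 4 → Set
Refutes y i = T (nonSquare 6 (unit i +ᶻ y *ᶻ y *ᶻ it+2 1))

module _ (x y z : GZ) where
  private
    b = x +ᶻ (itᶻ 1 +ᶻ 1ᶻ) *ᶻ z
    c = x +ᶻ (itᶻ 1 +ᶻ -ᶻ 1ᶻ) *ᶻ z

  refutes : ∀ {i} {A : Set} → Refutes y i → b *ᶻ b ≡ unit i +ᶻ y *ᶻ y *ᶻ it+2 1 → A
  refutes r b² = ⊥-elim (nonSquare-sound 6 b (subst (T ∘ nonSquare 6) (sym b²) r))

  sporadic-with : ∀ B C z₋ z₊ → AllSigns y B C z₋ z₊ → ∀ j → B *ᶻ B ≡ unit j +ᶻ y *ᶻ y *ᶻ it+2 1 → C *ᶻ C ≡ unit j +ᶻ y *ᶻ y *ᶻ it-2 1 →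
    (∀ i → i ≢ j → Refutes y i) → ∀ i → b *ᶻ b ≡ unit i +ᶻ y *ᶻ y *ᶻ it+2 1 → c *ᶻ c ≡ unit i +ᶻ y *ᶻ y *ᶻ it-2 1 → EquivalentToListed 1 x y z
  sporadic-with B C z₋ z₊ signs j B² C² others i b² c² with i Fin.≟ j
  ... | yes refl = recoverAll x y z B C z₋ z₊ signs (trans b² (sym B²)) (trans c² (sym C²))
  ... | no  i≢j  = refutes {i} (others i i≢j) b²

others₀ : ∀ y → Refutes y (# 1) → Refutes y (# 2) → Refutes y (# 3) → ∀ i → i ≢ # 0 → Refutes y i
others₀ y r₁ r₂ r₃ zero                   i≢0 = ⊥-elim (i≢0 refl)
others₀ y r₁ r₂ r₃ (suc zero)             _   = r₁
others₀ y r₁ r₂ r₃ (suc (suc zero))       _   = r₂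
others₀ y r₁ r₂ r₃ (suc (suc (suc zero))) _   = r₃

others₁ : ∀ y → Refutes y (# 0) → Refutes y (# 2) → Refutes y (# 3) → ∀ i → i ≢ # 1 → Refutes y i
others₁ y r₀ r₂ r₃ zero                   _   = r₀
others₁ y r₀ r₂ r₃ (suc zero)             i≢1 = ⊥-elim (i≢1 refl)
others₁ y r₀ r₂ r₃ (suc (suc zero))       _   = r₂
others₁ y r₀ r₂ r₃ (suc (suc (suc zero))) _   = r₃

-- For y = ±(1 + i), y² = 2 i and only ε = -1 survives, with -3 ± 4 i = (1 ± 2 i)². For y = ±(1 -
-- i), y² = -2 i and only ε = 1 survives, with 3 ± 4 i = (2 ± i)².
sporadic-solutions : ∀ t x y z → Sporadic t y → ∀ i → let b = x +ᶻ (itᶻ t +ᶻ 1ᶻ) *ᶻ z; c = x +ᶻ (itᶻ t +ᶻ -ᶻ 1ᶻ) *ᶻ z in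
  b *ᶻ b ≡ unit i +ᶻ y *ᶻ y *ᶻ it+2 t → c *ᶻ c ≡ unit i +ᶻ y *ᶻ y *ᶻ it-2 t → EquivalentToListed t x y z
sporadic-solutions .1 x y@(+ 1 , + 1) z (refl , refl , refl) =
  sporadic-with x y z (+ 1 , + 2) (+ 1 , ℤ.- + 2) (+ 0 , + 2) (+ 1 , + 0) (toWitness {a? = allSigns? y (+ 1 , + 2) (+ 1 , ℤ.- + 2) (+ 0 , + 2) (+ 1 , + 0)} tt) (# 1) refl refl (others₁ y tt tt tt)
sporadic-solutions .1 x y@(-[1+ 0 ] , -[1+ 0 ]) z (refl , refl , refl) =
  sporadic-with x y z (+ 1 , + 2) (+ 1 , ℤ.- + 2) (+ 0 , + 2) (+ 1 , + 0) (toWitness {a? = allSigns? y (+ 1 , + 2) (+ 1 , ℤ.- + 2) (+ 0 , + 2) (+ 1 , + 0)} tt) (# 1) refl refl (others₁ y tt tt tt)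
sporadic-solutions .1 x y@(+ 1 , -[1+ 0 ]) z (refl , refl , refl) =
  sporadic-with x y z (+ 2 , ℤ.- + 1) (+ 2 , + 1) (+ 0 , ℤ.- + 1) (+ 2 , + 0) (toWitness {a? = allSigns? y (+ 2 , ℤ.- + 1) (+ 2 , + 1) (+ 0 , ℤ.- + 1) (+ 2 , + 0)} tt) (# 0) refl refl (others₀ y tt tt tt)
sporadic-solutions .1 x y@(-[1+ 0 ] , + 1) z (refl , refl , refl) =
  sporadic-with x y z (+ 2 , ℤ.- + 1) (+ 2 , + 1) (+ 0 , ℤ.- + 1) (+ 2 , + 0) (toWitness {a? = allSigns? y (+ 2 , ℤ.- + 1) (+ 2 , + 1) (+ 0 , ℤ.- + 1) (+ 2 , + 0)} tt) (# 0) refl refl (others₀ y tt tt tt)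

-- Parity of t and the classification of generators

even-or-odd : ∀ n → Σ ℕ (λ m → n ≡ 2 * m) ⊎ Σ ℕ (λ m → n ≡ suc (2 * m))
even-or-odd zero    = inj₁ (0 , refl)
even-or-odd (suc n) with even-or-odd n
... | inj₁ (m , n≡2m)   = inj₂ (m , cong suc n≡2m)
... | inj₂ (m , n≡1+2m) = inj₁ (suc m , trans (cong suc n≡1+2m) (sym (ℕ.*-suc 2 m)))

even-discriminant : ∀ m → 2 * m * (2 * m) + 4 ≡ (m * m + 1) * 4
even-discriminant = solve 1 (λ m → con 2 :* m :* (con 2 :* m) :+ con 4 := (m :* m :+ con 1) :* con 4) refl
  where
  open ℕSolver.+-*-Solver

-- For even t the square 4 divides t² + 4.
squareFree⇒odd : ∀ t → SquareFree (t * t + 4) → Σ ℕ λ m → t ≡ suc (2 * m)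
squareFree⇒odd t sf = [ (λ (m , t≡2m) → ⊥-elim (even m t≡2m)) , id ]′ (even-or-odd t)
  where
  even : ∀ m → t ≡ 2 * m → ⊥
  even m refl with () ← sf 2 (divides (m * m + 1) (even-discriminant m))

module _ (t m : ℕ) (t-odd : t ≡ suc (2 * m)) (m<50 : m ℕ.< 50) where
  private
    units-agree : ∀ t → t ≡ suc (2 * m) → ∀ i j k → UnitRelation GZ-ring (itᶻ t) (unit i) (unit j) (unit k) → i ≡ j
    units-agree _ refl = oddUnitsAgree {m} m<50

    only-sporadic : ∀ t → t ≡ suc (2 * m) → ∀ y → normℕ y ℕ.≤ 900 → y ≢ 0ᶻ → ∀ i B C →
      B *ᶻ B ≡ unit i +ᶻ y *ᶻ y *ᶻ it+2 t → C *ᶻ C ≡ unit i +ᶻ y *ᶻ y *ᶻ it-2 t → Sporadic t y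
    only-sporadic _ refl = no-solutions m m<50

    t>0 : ∀ t → t ≡ suc (2 * m) → 1 ≤ t
    t>0 _ refl = ℕ.s≤s ℕ.z≤n

  generators-listed : ∀ x y z → AbsLe30 y → IsPowerGen t (elemXYZ x y z) → InO t ξK → EquivalentToListed t x y z
  generators-listed x y z ∣y∣≤30 gen ξ∈O =
    classify (index-form-units t (t>0 t t-odd) x y z gen ξ∈O)
    where
    4ᶻ = GR.fromℤ (+ 4)

    conclude : ∀ i m₁ → F₁ GZ-ring (itᶻ t) x z *ᶻ m₁ ≡ 1ᶻ → Fδ GZ-ring (itᶻ t) 1ᶻ x y z ≡ unit i → Fδ GZ-ring (itᶻ t) (-ᶻ 1ᶻ) x y z ≡ unit i → EquivalentToListed t x y z
    conclude i m₁ F₁m≡1 F₊≡ F₋≡ = dispatch (y ≟ᶻ 0ᶻ)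
      where
      y²≡zA : y *ᶻ y ≡ z *ᶻ (x +ᶻ itᶻ t *ᶻ z)
      y²≡zA = GZ-cancel 4ᶻ (y *ᶻ y) (z *ᶻ (x +ᶻ itᶻ t *ᶻ z)) (λ ()) (factors-difference GZ-ring (itᶻ t) x y z (trans F₊≡ (sym F₋≡)))

      b² : (x +ᶻ (itᶻ t +ᶻ 1ᶻ) *ᶻ z) *ᶻ (x +ᶻ (itᶻ t +ᶻ 1ᶻ) *ᶻ z) ≡ unit i +ᶻ y *ᶻ y *ᶻ it+2 t
      b² = trans (Fδ-square GZ-ring (itᶻ t) 1ᶻ x y z F₊≡) (cong (λ e → unit i +ᶻ y *ᶻ y *ᶻ e) (it+2≡ t))

      c² : (x +ᶻ (itᶻ t +ᶻ -ᶻ 1ᶻ) *ᶻ z) *ᶻ (x +ᶻ (itᶻ t +ᶻ -ᶻ 1ᶻ) *ᶻ z) ≡ unit i +ᶻ y *ᶻ y *ᶻ it-2 t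
      c² = trans (Fδ-square GZ-ring (itᶻ t) (-ᶻ 1ᶻ) x y z F₋≡) (cong (λ e → unit i +ᶻ y *ᶻ y *ᶻ e) (it-2≡ t))

      small : normℕ y ℕ.≤ 900
      small = ℤ.drop‿+≤+ (subst (ℤ._≤ + 900) (normᶻ-normℕ y) ∣y∣≤30)

      dispatch : Dec (y ≡ 0ᶻ) → EquivalentToListed t x y z
      dispatch (yes y≡0) = subst (λ y → EquivalentToListed t x y z) (sym y≡0)
        (y=0-solutions t x z m₁ F₁m≡1 (trans (sym y²≡zA) (cong (λ y → y *ᶻ y) y≡0)))
      dispatch (no y≢0)  = sporadic-solutions t x y z
        (only-sporadic t t-odd y small y≢0 i (x +ᶻ (itᶻ t +ᶻ 1ᶻ) *ᶻ z) (x +ᶻ (itᶻ t +ᶻ -ᶻ 1ᶻ) *ᶻ z) b² c²) i b² c²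

    unify : ∀ m₁ → F₁ GZ-ring (itᶻ t) x z *ᶻ m₁ ≡ 1ᶻ → Σ (Fin 4) (λ k → F₁ GZ-ring (itᶻ t) x z ≡ unit k) →
      Σ (Fin 4) (λ i → Fδ GZ-ring (itᶻ t) 1ᶻ x y z ≡ unit i) → Σ (Fin 4) (λ j → Fδ GZ-ring (itᶻ t) (-ᶻ 1ᶻ) x y z ≡ unit j) → EquivalentToListed t x y z
    unify m₁ F₁m≡1 (k , F₁≡) (i , F₊≡) (j , F₋≡) = conclude i m₁ F₁m≡1 F₊≡
      (trans F₋≡ (cong unit (sym (units-agree t t-odd i j k (unit-relation GZ-ring (itᶻ t) x y z F₊≡ F₋≡ F₁≡)))))

    classify : FactorsAreUnits t x y z → EquivalentToListed t x y z
    classify ((m₁ , F₁m≡1) , (m₊ , F₊m≡1) , (m₋ , F₋m≡1)) = unify m₁ F₁m≡1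
      (unit-classification (F₁ GZ-ring (itᶻ t) x z) m₁ F₁m≡1)
      (unit-classification (Fδ GZ-ring (itᶻ t) 1ᶻ x y z) m₊ F₊m≡1)
      (unit-classification (Fδ GZ-ring (itᶻ t) (-ᶻ 1ᶻ) x y z) m₋ F₋m≡1)

theorem4 : (t : ℕ) → 1 ≤ t → t ≤ 100 → SquareFree (t * t + 4) →
    ((α : K) → Listed t α → IsPowerGen t α)
    × ((x y z : GZ) → AbsLe30 x → AbsLe30 y → AbsLe30 z →
    IsPowerGen t (elemXYZ x y z) →
    Σ K (λ β → Listed t β × Equivalent t (elemXYZ x y z) β))
theorem4 t _ t≤100 sf = listed , λ x y z _ ∣y∣≤30 _ gen → generators-listed t m t≡ m<50 x y z ∣y∣≤30 gen ξ∈O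
  where
  m = proj₁ (squareFree⇒odd t sf)
  t≡ = proj₂ (squareFree⇒odd t sf)
  listed : (α : K) → Listed t α → IsPowerGen t α
  listed = listed-isPowerGen {t} t≤100 (ZK-integrallyClosed t m t≡ sf)
  -- ξ is integral because it is itself the first listed generator.
  ξ∈O : InO t ξK
  ξ∈O = proj₁ (listed ξK (inj₁ refl))
  m<50 : m ℕ.< 50
  m<50 = ℕ.≰⇒> λ 50≤m → ℕ.<⇒≱ (ℕ.s≤s (ℕ.*-monoʳ-≤ 2 50≤m)) (subst (_≤ 100) t≡ t≤100)
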